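{- Let $n$ be a finite ordinal with $n>2$. (1) There exists a $\mathsf{PEA}_n$ atom structure $\mathbf{At}$ such that the term algebra $\mathfrak{Tm}\mathbf{At}$ is representable as a $\mathsf{PEA}_n$, but $\mathbf{At}$ is not strongly representable. In fact, for every signature $t$ between that of $\mathsf{Df}_n$ and that of $\mathsf{PEA}_n$, the $t$-reduct of the complex algebra $\mathfrak{Cm}\mathbf{At}$ is not representable. (2) Furthermore, there exists an atomic relation algebra $\mathfrak{R}$ such that the set $\mathsf{Mat}_n\mathrm{At}\mathfrak{R}$ of all $n$-dimensional basic matrices over $\mathfrak{R}$ forms an $n$-dimensional polyadic equality basis, the term algebra $\mathfrak{Tm}\,\mathsf{Mat}_n\mathrm{At}\mathfrak{R}$ is representable as a polyadic equality algebra of dimension $n$, while the diagonal-free reduct of $\mathfrak{Cm}\,\mathsf{Mat}_n\mathrm{At}\mathfrak{R}$ is not representable (as a diagonal-free cylindric algebra of dimension $n$). In particular, the relation algebra atom structure $\mathrm{At}\mathfrak{R}$ is weakly but not strongly representable.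
   Context: Signatures. $\mathsf{Df}_n$ has the Boolean operations and cylindrifiers $c_i$ ($i<n$); $\mathsf{PEA}_n$ (polyadic equality algebras of finite dimension $n$) has in addition the diagonal constants $d_{ij}$, replacement operators $s^i_j$ and transposition operators $s_{ij}$ ($i,j<n$). A signature is between them if it is obtained from that of $\mathsf{Df}_n$ by adding some of the families $d_{ij}$, $s^i_j$, $s_{ij}$ (for instance $\mathsf{Df}$, $\mathsf{Sc}$ = substitution algebras with $c_i,s^i_j$; $\mathsf{CA}$ = cylindric algebras with $c_i,d_{ij}$; $\mathsf{PA}$ with $c_i,s^i_j,s_{ij}$; $\mathsf{PEA}$). Representability. In a set algebra with unit ${}^nU$: $c_iX=\{s:\exists t\in X,\ t_j=s_j\ \forall j\ne i\}$, $d_{ij}=\{s:s_i=s_j\}$, $s^i_jX=\{s:s\circ[i|j]\in X\}$, $s_{ij}X=\{s: s\circ[i,j]\in X\}$, where $[i|j]$ sends $i$ to $j$ and fixes everything else and $[i,j]$ swaps $i$ and $j$. An algebra is representable if it is isomorphic to a subalgebra of a direct product of set algebras of the same type. Atom structures. The atom structure $\mathrm{At}\mathfrak A$ of an atomic algebra (Boolean algebra with operators) $\mathfrak A$ has as universe the atoms, with a relation $R_\Omega(a_0,\dots,a_r)\iff \Omega(a_1,\dots,a_r)\ge a_0$ for every extra-Boolean operator $\Omega$. $\mathfrak{Cm}\,S$ is the complex algebra of $S$ (all subsets of $S$, with $\Omega(X_1,\dots,X_r)=\{s:\exists s_i\in X_i,\ R_\Omega(s,s_1,\dots,s_r)\}$),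 and $\mathfrak{Tm}\,S$ is the subalgebra of $\mathfrak{Cm}\,S$ generated by the singletons. An atom structure is weakly representable if at least one atomic algebra having it as atom structure is representable (equivalently, its term algebra is representable), and strongly representable if all atomic algebras having it as atom structure are representable (equivalently its complex algebra is). Basic matrices. For an atomic relation algebra $\mathfrak R$, an $n$-dimensional basic matrix is a map $f:n\times n\to\mathrm{At}\mathfrak R$ with $f(x,x)\le 1'$, $f(y,x)=f(x,y)^{\smile}$ and $f(x,z)\le f(x,y);f(y,z)$ for all $x,y,z<n$. $\mathsf{Mat}_n\mathrm{At}\mathfrak R$, the set of all of them, is regarded as an atom structure with $R_{c_i}(f,g)$ iff $f(x,y)=g(x,y)$ for all $x,y\neq i$, $R_{d_{ij}}(f)$ iff $f(i,j)\le 1'$, $R_{s_{ij}}(f,g)$ iff $f\circ[i,j]=g$, and $R_{s^i_j}(f,g)$ iff $f\circ[i|j]=g$ (here $(f\circ\tau)(x,y)=f(\tau(x),\tau(y))$). A set $\mathcal M$ of basic matrices is an $n$-dimensional cylindric basis if: every atom is $f(0,1)$ for some $f\in\mathcal M$; if $f\in\mathcal M$, $f(x,y)\le a;b$ with $a,b$ atoms and $z\ne x,y$, there is $g\in\mathcal M$ agreeing with $f$ off $z$ with $g(x,z)=a$, $g(z,y)=b$; and if $f,g\in\mathcal M$ agree off $\{x,y\}$ there is $h\in\mathcal M$ agreeing with $f$ off $x$ and with $g$ off $y$. It is a polyadic equality basis if it is moreover closed under $f\mapsto f\circ\tau$ for all $\tau:n\to n$. -}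

module Defs where

open import Level using (Level; _⊔_; 0ℓ) renaming (suc to lsuc)
open import Algebra.Core using (Op₁; Op₂)
open import Algebra.Definitions using (Congruent₁; Congruent₂)
open import Algebra.Lattice.Structures using (IsBooleanAlgebra)
open import Data.Bool using (Bool; true; false; T)
open import Data.Empty.Polymorphic using () renaming (⊥ to ⊥ₚ)
open import Data.Fin using (Fin; fromℕ<)
open import Data.Fin.Permutation.Components using (transpose)
open import Data.Nat using (ℕ; _<_)
open import Data.Nat.Properties using (<⇒≤)
open import Data.Product using (Σ; ∃; ∃-syntax; _×_; _,_; proj₁; proj₂)
open import Data.Product.Relation.Binary.Pointwise.NonDependent using (×-setoid)
open import Data.Sum using (_⊎_; inj₁; inj₂; [_,_]) renaming (map to ⊎-map)
open import Data.Unit.Polymorphic using (tt) renaming (⊤ to ⊤ₚ)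
open import Data.Vec using (Vec; []; _∷_; lookup; map)
open import Data.Vec.Functional using (updateAt)
open import Data.Vec.Functional.Relation.Binary.Pointwise.Properties using () renaming (setoid to vectorSetoid)
open import Data.Vec.Relation.Binary.Pointwise.Inductive as Pw using (Pointwise; []; _∷_)
open import Data.Vec.Relation.Unary.All as All using (All)
open import Data.Vec.Relation.Unary.All.Properties using (map⁺)
open import Function using (_∘_; id; const; _⇔_)
open import Function.Bundles using (Bijection)
open import Relation.Binary using (Rel; Setoid; IsEquivalence; _Respects_)
open import Relation.Binary.Construct.On as On using ()
open import Relation.Binary.PropositionalEquality using (_≡_; _≢_)
open import Relation.Nullary using (¬_)
open import Relation.Unary using (Pred; _∈_; _≐_; _∪_; _∩_; ∁)
open import Relation.Unary.Relation.Binary.Equality using (≐-setoid)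

private
  variable
    a b e e′ k ℓ m q u r : Level
    F G : ℕ → Set

------------------------------------------------------------------------
-- Algebras with Boolean operations and further operations

-- Throughout, sets are setoids.  A similarity type  F : ℕ → Set  gives
-- the extra-Boolean operation symbols of each arity.  No Boolean axioms
-- are built in: they are part of the classes IsPEA and IsRelationAlgebra.

record Algebra (F : ℕ → Set) (a ℓ : Level) : Set (lsuc (a ⊔ ℓ)) where
  infix  4 _≈_ _≤_
  infixr 6 _∨_
  infixr 7 _∧_
  infix  8 -_
  field
    Carrier       : Set a
    _≈_           : Rel Carrier ℓ
    isEquivalence : IsEquivalence _≈_
    _∨_ _∧_       : Op₂ Carrier
    -_            : Op₁ Carrier
    𝟙 𝟘           : Carrier
    op            : ∀ {n} → F n → Vec Carrier n → Carrier
    ∨-cong        : Congruent₂ _≈_ _∨_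
    ∧-cong        : Congruent₂ _≈_ _∧_
    -‿cong        : Congruent₁ _≈_ (-_)
    op-cong       : ∀ {n} (Ω : F n) {xs ys : Vec Carrier n} →
                    Pointwise _≈_ xs ys → op Ω xs ≈ op Ω ys

  setoid : Setoid a ℓ
  setoid = record { isEquivalence = isEquivalence }

  open IsEquivalence isEquivalence public

  _≤_ : Rel Carrier ℓ
  x ≤ y = x ∧ y ≈ x

  IsAtom : Pred Carrier (a ⊔ ℓ)
  IsAtom x = ¬ (x ≈ 𝟘) × (∀ y → y ≤ x → y ≈ 𝟘 ⊎ y ≈ x)

  Atom : Set (a ⊔ ℓ)
  Atom = Σ Carrier IsAtom

  IsAtomic : Set (a ⊔ ℓ)
  IsAtomic = ∀ x → ¬ (x ≈ 𝟘) → ∃[ y ] IsAtom y × y ≤ x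

record _≅_ (A : Algebra F a e) (B : Algebra F b e′) : Set (a ⊔ b ⊔ e ⊔ e′) where
  private
    module A = Algebra A
    module B = Algebra B
  field
    bijection : Bijection A.setoid B.setoid
  open Bijection bijection public
  field
    ∨-homo  : ∀ x y → to (x A.∨ y) B.≈ to x B.∨ to y
    ∧-homo  : ∀ x y → to (x A.∧ y) B.≈ to x B.∧ to y
    -‿homo  : ∀ x → to (A.- x) B.≈ B.- to x
    𝟙-homo  : to A.𝟙 B.≈ B.𝟙
    𝟘-homo  : to A.𝟘 B.≈ B.𝟘
    op-homo : ∀ {n} (Ω : F n) (xs : Vec A.Carrier n) →
              to (A.op Ω xs) B.≈ B.op Ω (map to xs)

reduct : (∀ {n} → G n → F n) → Algebra F a ℓ → Algebra G a ℓ
reduct ι A = record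
  { Carrier       = Carrier
  ; _≈_           = _≈_
  ; isEquivalence = isEquivalence
  ; _∨_           = _∨_
  ; _∧_           = _∧_
  ; -_            = -_
  ; 𝟙             = 𝟙
  ; 𝟘             = 𝟘
  ; op            = λ Ω → op (ι Ω)
  ; ∨-cong        = ∨-cong
  ; ∧-cong        = ∧-cong
  ; -‿cong        = -‿cong
  ; op-cong       = λ Ω → op-cong (ι Ω)
  } where open Algebra A

∏ : {I : Set u} → (I → Algebra F a ℓ) → Algebra F (u ⊔ a) (u ⊔ ℓ)
∏ {I = I} A = record
  { Carrier       = ∀ i → A.Carrier i
  ; _≈_           = λ x y → ∀ i → A._≈_ i (x i) (y i)
  ; isEquivalence = record
    { refl  = λ i → A.refl i
    ; sym   = λ x≈y i → A.sym i (x≈y i)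
    ; trans = λ x≈y y≈z i → A.trans i (x≈y i) (y≈z i)
    }
  ; _∨_           = λ x y i → A._∨_ i (x i) (y i)
  ; _∧_           = λ x y i → A._∧_ i (x i) (y i)
  ; -_            = λ x i → A.-_ i (x i)
  ; 𝟙             = λ i → A.𝟙 i
  ; 𝟘             = λ i → A.𝟘 i
  ; op            = λ Ω xs i → A.op i Ω (map (λ x → x i) xs)
  ; ∨-cong        = λ p q i → A.∨-cong i (p i) (q i)
  ; ∧-cong        = λ p q i → A.∧-cong i (p i) (q i)
  ; -‿cong        = λ p i → A.-‿cong i (p i)
  ; op-cong       = λ Ω ps i → A.op-cong i Ω (Pw.map⁺ (λ p → p i) ps)
  } where module A (i : I) = Algebra (A i)

record Subuniverse (A : Algebra F a ℓ) (m : Level) : Set (a ⊔ ℓ ⊔ lsuc m) where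
  open Algebra A
  field
    member    : Pred Carrier m
    resp      : member Respects _≈_
    ∨-closed  : ∀ {x y} → x ∈ member → y ∈ member → x ∨ y ∈ member
    ∧-closed  : ∀ {x y} → x ∈ member → y ∈ member → x ∧ y ∈ member
    -‿closed  : ∀ {x} → x ∈ member → - x ∈ member
    𝟙-closed  : 𝟙 ∈ member
    𝟘-closed  : 𝟘 ∈ member
    op-closed : ∀ {n} (Ω : F n) {xs : Vec Carrier n} →
                All member xs → op Ω xs ∈ member

Subalgebra : (A : Algebra F a ℓ) → Subuniverse A m → Algebra F (a ⊔ m) ℓ
Subalgebra A B = record
  { Carrier       = Σ Carrier member
  ; _≈_           = λ x y → proj₁ x ≈ proj₁ y
  ; isEquivalence = On.isEquivalence proj₁ isEquivalence
  ; _∨_           = λ x y → proj₁ x ∨ proj₁ y , ∨-closed (proj₂ x) (proj₂ y)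
  ; _∧_           = λ x y → proj₁ x ∧ proj₁ y , ∧-closed (proj₂ x) (proj₂ y)
  ; -_            = λ x → - proj₁ x , -‿closed (proj₂ x)
  ; 𝟙             = 𝟙 , 𝟙-closed
  ; 𝟘             = 𝟘 , 𝟘-closed
  ; op            = λ Ω xs → op Ω (map proj₁ xs) , op-closed Ω (map⁺ (all xs))
  ; ∨-cong        = ∨-cong
  ; ∧-cong        = ∧-cong
  ; -‿cong        = -‿cong
  ; op-cong       = λ Ω ps → op-cong Ω (Pw.map⁺ id ps)
  }
  where
  open Algebra A
  open Subuniverse B
  all : ∀ {n} (xs : Vec (Σ Carrier member) n) → All (member ∘ proj₁) xs
  all []       = All.[]
  all (x ∷ xs) = proj₂ x All.∷ all xs

module _ (A : Algebra F a ℓ) (X : Pred (Algebra.Carrier A) m) where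
  open Algebra A

  data Generated : Pred Carrier (a ⊔ ℓ ⊔ m) where
    gen  : ∀ {x} → x ∈ X → x ∈ Generated
    resp : ∀ {x y} → x ≈ y → x ∈ Generated → y ∈ Generated
    join : ∀ {x y} → x ∈ Generated → y ∈ Generated → x ∨ y ∈ Generated
    meet : ∀ {x y} → x ∈ Generated → y ∈ Generated → x ∧ y ∈ Generated
    neg  : ∀ {x} → x ∈ Generated → - x ∈ Generated
    one  : 𝟙 ∈ Generated
    zero : 𝟘 ∈ Generated
    oper : ∀ {n} (Ω : F n) {xs : Vec Carrier n} →
           All Generated xs → op Ω xs ∈ Generated

  generatedBy : Subuniverse A (a ⊔ ℓ ⊔ m)
  generatedBy = record
    { member    = Generated
    ; resp      = resp
    ; ∨-closed  = join
    ; ∧-closed  = meet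
    ; -‿closed  = neg
    ; 𝟙-closed  = one
    ; 𝟘-closed  = zero
    ; op-closed = oper
    }

------------------------------------------------------------------------
-- Power set algebras

-- Subsets are predicates respecting the setoid equality, compared
-- extensionally; they form a Boolean algebra given excluded middle.

Subset : Setoid ℓ ℓ → Set (lsuc ℓ)
Subset {ℓ} S = Σ (Pred Carrier ℓ) (_Respects _≈_)
  where open Setoid S

infix 4 _≐ₛ_
_≐ₛ_ : {S : Setoid ℓ ℓ} → Rel (Subset S) ℓ
X ≐ₛ Y = proj₁ X ≐ proj₁ Y

powersetAlgebra : (S : Setoid ℓ ℓ)
  (op : ∀ {n} → F n → Vec (Subset S) n → Subset S) →
  (∀ {n} (Ω : F n) {Xs Ys : Vec (Subset S) n} →
    Pointwise (_≐ₛ_ {S = S}) Xs Ys → _≐ₛ_ {S = S} (op Ω Xs) (op Ω Ys)) →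
  Algebra F (lsuc ℓ) ℓ
powersetAlgebra {ℓ} S op op-cong = record
  { Carrier       = Subset S
  ; _≈_           = _≐ₛ_ {S = S}
  ; isEquivalence = On.isEquivalence proj₁ (Setoid.isEquivalence (≐-setoid S.Carrier ℓ))
  ; _∨_           = λ X Y → proj₁ X ∪ proj₁ Y , λ x≈y → ⊎-map (proj₂ X x≈y) (proj₂ Y x≈y)
  ; _∧_           = λ X Y → proj₁ X ∩ proj₁ Y , λ x≈y (x∈X , x∈Y) → proj₂ X x≈y x∈X , proj₂ Y x≈y x∈Y
  ; -_            = λ X → ∁ (proj₁ X) , λ x≈y x∉X y∈X → x∉X (proj₂ X (S.sym x≈y) y∈X)
  ; 𝟙             = const ⊤ₚ , λ _ _ → tt
  ; 𝟘             = const ⊥ₚ , λ _ ()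
  ; op            = op
  ; ∨-cong        = λ p q → ⊎-map (proj₁ p) (proj₁ q) , ⊎-map (proj₂ p) (proj₂ q)
  ; ∧-cong        = λ p q → (λ (x , y) → proj₁ p x , proj₁ q y) , (λ (x , y) → proj₂ p x , proj₂ q y)
  ; -‿cong        = λ p → (λ x∉X x∈Y → x∉X (proj₂ p x∈Y)) , (λ x∉Y x∈X → x∉Y (proj₁ p x∈X))
  ; op-cong       = op-cong
  } where module S = Setoid S

------------------------------------------------------------------------
-- Signatures between Df and PEA, and their set algebras

record Signature : Set where
  constructor signature
  field
    diagonals replacements transpositions : Bool
open Signature

Df PEA : Signature
Df  = signature false false false
PEA = signature true true true

data CylOp (t : Signature) (n : ℕ) : ℕ → Set where
  cyl   : (i : Fin n) → CylOp t n 1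
  diag  : T (diagonals t) → (i j : Fin n) → CylOp t n 0
  repl  : T (replacements t) → (i j : Fin n) → CylOp t n 1
  tran  : T (transpositions t) → (i j : Fin n) → CylOp t n 1

toPEA : ∀ {t n o} → CylOp t n o → CylOp PEA n o
toPEA (cyl i)       = cyl i
toPEA (diag _ i j)  = diag _ i j
toPEA (repl _ i j)  = repl _ i j
toPEA (tran _ i j) = tran _ i j

[_∣_] : ∀ {n} → Fin n → Fin n → Fin n → Fin n
[ i ∣ j ] = updateAt id i (const j)

[_,,_] : ∀ {n} → Fin n → Fin n → Fin n → Fin n
[ i ,, j ] = transpose i j

module _ (t : Signature) (n : ℕ) (U : Setoid ℓ ℓ) where
  private
    module U = Setoid U
    ⁿU = vectorSetoid U n
    module ⁿU = Setoid ⁿU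

  cylinder : Fin n → Subset ⁿU → Subset ⁿU
  cylinder i (X , _) =
    (λ s → ∃[ x ] x ∈ X × (∀ j → j ≢ i → x j U.≈ s j)) ,
    λ s≈s′ (x , x∈X , x≈s) → x , x∈X , λ j j≢i → U.trans (x≈s j j≢i) (s≈s′ j)

  diagonal : Fin n → Fin n → Subset ⁿU
  diagonal i j =
    (λ s → s i U.≈ s j) ,
    λ s≈s′ si≈sj → U.trans (U.sym (s≈s′ i)) (U.trans si≈sj (s≈s′ j))

  substitution : (Fin n → Fin n) → Subset ⁿU → Subset ⁿU
  substitution τ (X , X-resp) = (λ s → s ∘ τ ∈ X) , λ s≈s′ → X-resp (λ i → s≈s′ (τ i))

  setAlgebra : Algebra (CylOp t n) (lsuc ℓ) ℓ
  setAlgebra = powersetAlgebra ⁿU set-op λ where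
      (cyl i)       (X≐Y ∷ []) → (λ (x , x∈X , x≈s) → x , proj₁ X≐Y x∈X , x≈s) ,
                                 (λ (y , y∈Y , y≈s) → y , proj₂ X≐Y y∈Y , y≈s)
      (diag _ i j)  []         → id , id
      (repl _ i j)  (X≐Y ∷ []) → (λ {_} → proj₁ X≐Y) , (λ {_} → proj₂ X≐Y)
      (tran _ i j) (X≐Y ∷ []) → (λ {_} → proj₁ X≐Y) , (λ {_} → proj₂ X≐Y)
    where
    set-op : ∀ {o} → CylOp t n o → Vec (Subset ⁿU) o → Subset ⁿU
    set-op (cyl i)       (X ∷ []) = cylinder i X
    set-op (diag _ i j)  []       = diagonal i j
    set-op (repl _ i j)  (X ∷ []) = substitution [ i ∣ j ] X
    set-op (tran _ i j) (X ∷ []) = substitution [ i ,, j ] X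

-- The level ℓ bounds the index set and the base sets of a representation.

RepresentableBy : (ℓ : Level) → (Setoid ℓ ℓ → Algebra F (lsuc ℓ) ℓ) →
                  Algebra F a e → Set (a ⊔ e ⊔ lsuc (a ⊔ lsuc ℓ))
RepresentableBy {a = a} ℓ full A =
  Σ (Set ℓ) λ I →
  Σ (I → Setoid ℓ ℓ) λ U →
  Σ (Subuniverse (∏ (λ i → full (U i))) (a ⊔ lsuc ℓ)) λ B →
  A ≅ Subalgebra (∏ (λ i → full (U i))) B

Representable : ∀ {t n} (ℓ : Level) → Algebra (CylOp t n) a e → Set (a ⊔ e ⊔ lsuc (a ⊔ lsuc ℓ))
Representable {t = t} {n} ℓ = RepresentableBy ℓ (setAlgebra t n)

-- Polyadic equality algebras in the primitives c, d, s^i_j, s_ij: the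
-- Sain–Thompson axioms, equivalent to Halmos' in finite dimension n > 2.

record IsPEA {n} (A : Algebra (CylOp PEA n) a ℓ) : Set (a ⊔ ℓ) where
  open Algebra A

  c : Fin n → Op₁ Carrier
  c i x = op (cyl i) (x ∷ [])

  d : Fin n → Fin n → Carrier
  d i j = op (diag _ i j) []

  s : Fin n → Fin n → Op₁ Carrier
  s i j x = op (repl _ i j) (x ∷ [])

  p : Fin n → Fin n → Op₁ Carrier
  p i j x = op (tran _ i j) (x ∷ [])

  field
    isBooleanAlgebra : IsBooleanAlgebra _≈_ _∨_ _∧_ -_ 𝟙 𝟘
    s-refl  : ∀ i x → s i i x ≈ x
    p-refl  : ∀ i x → p i i x ≈ x
    p-sym   : ∀ i j x → p i j x ≈ p j i x
    c-incr  : ∀ i x → x ≤ c i x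
    c-∨     : ∀ i x y → c i (x ∨ y) ≈ c i x ∨ c i y
    s-c     : ∀ i j x → s i j (c i x) ≈ c i x
    c-s     : ∀ i j x → i ≢ j → c i (s i j x) ≈ s i j x
    s-c-≢   : ∀ i j k x → k ≢ i → k ≢ j → s i j (c k x) ≈ c k (s i j x)
    s-∨     : ∀ i j x y → s i j (x ∨ y) ≈ s i j x ∨ s i j y
    s-neg   : ∀ i j x → s i j (- x) ≈ - s i j x
    p-∨     : ∀ i j x y → p i j (x ∨ y) ≈ p i j x ∨ p i j y
    p-neg   : ∀ i j x → p i j (- x) ≈ - p i j x
    p-invol : ∀ i j x → p i j (p i j x) ≈ x
    p-p     : ∀ i j k x → i ≢ j → i ≢ k → j ≢ k → p i j (p i k x) ≈ p j k (p i j x)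
    p-s     : ∀ i j x → p i j (s j i x) ≈ s i j x
    s-d     : ∀ i j → s i j (d i j) ≈ 𝟙
    d-s     : ∀ i j x → x ∧ d i j ≤ s i j x

------------------------------------------------------------------------
-- Atom structures

record AtomStructure (F : ℕ → Set) (a e r : Level) : Set (lsuc (a ⊔ e ⊔ r)) where
  field
    setoid : Setoid a e
  open Setoid setoid public
  field
    R      : ∀ {n} → F n → Carrier → Vec Carrier n → Set r
    R-resp : ∀ {n} (Ω : F n) {x y : Carrier} {xs ys : Vec Carrier n} →
             x ≈ y → Pointwise _≈_ xs ys → R Ω x xs → R Ω y ys

record _≅ᵃ_ (S : AtomStructure F a e r) (S′ : AtomStructure F b e′ q) :
            Set (a ⊔ b ⊔ e ⊔ e′ ⊔ r ⊔ q) where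
  private
    module S  = AtomStructure S
    module S′ = AtomStructure S′
  field
    bijection : Bijection S.setoid S′.setoid
  open Bijection bijection public
  field
    R-iff : ∀ {n} (Ω : F n) (x : S.Carrier) (xs : Vec S.Carrier n) →
            S.R Ω x xs ⇔ S′.R Ω (to x) (map to xs)

At : Algebra F a ℓ → AtomStructure F (a ⊔ ℓ) ℓ ℓ
At A = record
  { setoid = On.setoid setoid (proj₁ {B = IsAtom})
  ; R      = λ Ω x xs → proj₁ x ≤ op Ω (map proj₁ xs)
  ; R-resp = λ Ω x≈y xs≈ys x≤ → trans (∧-cong (sym x≈y) (sym (op-cong Ω (Pw.map⁺ id xs≈ys)))) (trans x≤ x≈y)
  } where open Algebra A

module _ (S : AtomStructure F ℓ ℓ ℓ) where
  open AtomStructure S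

  Cm : Algebra F (lsuc ℓ) ℓ
  Cm = powersetAlgebra setoid Cm-op λ Ω Xs≐Ys →
      (λ (ys , ys∈Xs , Rxys) → ys , (λ k → proj₁ (Pw.lookup Xs≐Ys k) (ys∈Xs k)) , Rxys) ,
      (λ (ys , ys∈Ys , Rxys) → ys , (λ k → proj₂ (Pw.lookup Xs≐Ys k) (ys∈Ys k)) , Rxys)
    where
    Cm-op : ∀ {n} → F n → Vec (Subset setoid) n → Subset setoid
    Cm-op Ω Xs =
      (λ x → ∃[ ys ] (∀ k → lookup ys k ∈ proj₁ (lookup Xs k)) × R Ω x ys) ,
      λ x≈x′ (ys , ys∈Xs , Rxys) → ys , ys∈Xs , R-resp Ω x≈x′ (Pw.refl refl) Rxys

  isSingleton : Pred (Subset setoid) ℓ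
  isSingleton (X , _) = ∃[ x ] X ≐ (_≈ x)

  Tm : Algebra F (lsuc ℓ) ℓ
  Tm = Subalgebra Cm (generatedBy Cm isSingleton)

-- Weak and strong representability are relative to a class K of algebras
-- and a notion Rep of representability for it.  The algebras range over
-- the universe of Cm S, the largest algebra with atom structure S.

module _ (K : Pred (Algebra F (lsuc ℓ) ℓ) k) where

  AtomicWith : AtomStructure F ℓ ℓ ℓ → Pred (Algebra F (lsuc ℓ) ℓ) (lsuc ℓ ⊔ k)
  AtomicWith S A = K A × Algebra.IsAtomic A × At A ≅ᵃ S

  IsAtomStructureOf : Pred (AtomStructure F ℓ ℓ ℓ) (lsuc (lsuc ℓ) ⊔ k)
  IsAtomStructureOf S = ∃[ A ] A ∈ AtomicWith S

  module _ (Rep : Pred (Algebra F (lsuc ℓ) ℓ) q) where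

    WeaklyRepresentable : Pred (AtomStructure F ℓ ℓ ℓ) (lsuc (lsuc ℓ) ⊔ k ⊔ q)
    WeaklyRepresentable S = ∃[ A ] A ∈ AtomicWith S × A ∈ Rep

    StronglyRepresentable : Pred (AtomStructure F ℓ ℓ ℓ) (lsuc (lsuc ℓ) ⊔ k ⊔ q)
    StronglyRepresentable S = ∀ A → A ∈ AtomicWith S → A ∈ Rep

------------------------------------------------------------------------
-- Relation algebras

data RAOp : ℕ → Set where
  ident : RAOp 0
  conv  : RAOp 1
  comp  : RAOp 2

module RAOperations (A : Algebra RAOp a ℓ) where
  open Algebra A

  infixr 7 _⨾_
  infix  9 _˘

  1′ : Carrier
  1′ = op ident []

  _˘ : Op₁ Carrier
  x ˘ = op conv (x ∷ [])

  _⨾_ : Op₂ Carrier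
  x ⨾ y = op comp (x ∷ y ∷ [])

record IsRelationAlgebra (A : Algebra RAOp a ℓ) : Set (a ⊔ ℓ) where
  open Algebra A
  open RAOperations A
  field
    isBooleanAlgebra : IsBooleanAlgebra _≈_ _∨_ _∧_ -_ 𝟙 𝟘
    ⨾-assoc     : ∀ x y z → (x ⨾ y) ⨾ z ≈ x ⨾ (y ⨾ z)
    ⨾-∨         : ∀ x y z → (x ∨ y) ⨾ z ≈ (x ⨾ z) ∨ (y ⨾ z)
    ⨾-identityʳ : ∀ x → x ⨾ 1′ ≈ x
    ˘-invol     : ∀ x → (x ˘) ˘ ≈ x
    ˘-∨         : ∀ x y → (x ∨ y) ˘ ≈ x ˘ ∨ y ˘
    ˘-⨾         : ∀ x y → (x ⨾ y) ˘ ≈ y ˘ ⨾ x ˘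
    ˘-⨾-neg     : ∀ x y → x ˘ ⨾ (- (x ⨾ y)) ≤ - y

module _ (U : Setoid ℓ ℓ) where
  private
    module U = Setoid U
    U² = ×-setoid U U

  relationSetAlgebra : Algebra RAOp (lsuc ℓ) ℓ
  relationSetAlgebra = powersetAlgebra U² rel-op λ where
      ident []                   → id , id
      conv  (X≐X′ ∷ [])          → (λ {_} → proj₁ X≐X′) , (λ {_} → proj₂ X≐X′)
      comp  (X≐X′ ∷ Y≐Y′ ∷ []) →
        (λ (z , x , y) → z , proj₁ X≐X′ x , proj₁ Y≐Y′ y) ,
        (λ (z , x , y) → z , proj₂ X≐X′ x , proj₂ Y≐Y′ y)
    where
    rel-op : ∀ {o} → RAOp o → Vec (Subset U²) o → Subset U²
    rel-op ident [] =
      (λ (x , y) → x U.≈ y) ,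
      λ (x≈x′ , y≈y′) x≈y → U.trans (U.sym x≈x′) (U.trans x≈y y≈y′)
    rel-op conv ((X , X-resp) ∷ []) =
      (λ (x , y) → (y , x) ∈ X) ,
      λ (x≈x′ , y≈y′) → X-resp (y≈y′ , x≈x′)
    rel-op comp ((X , X-resp) ∷ (Y , Y-resp) ∷ []) =
      (λ (x , y) → ∃[ z ] (x , z) ∈ X × (z , y) ∈ Y) ,
      λ (x≈x′ , y≈y′) (z , xz , zy) → z , X-resp (x≈x′ , U.refl) xz , Y-resp (U.refl , y≈y′) zy

RepresentableRA : (ℓ : Level) → Algebra RAOp a e → Set (a ⊔ e ⊔ lsuc (a ⊔ lsuc ℓ))
RepresentableRA ℓ = RepresentableBy ℓ relationSetAlgebra

------------------------------------------------------------------------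
-- Basic matrices

module _ (n : ℕ) (𝔄 : Algebra RAOp ℓ ℓ) where
  open Algebra 𝔄
  open RAOperations 𝔄

  record BasicMatrix : Set ℓ where
    field
      atom : Fin n → Fin n → Atom

    entry : Fin n → Fin n → Carrier
    entry x y = proj₁ (atom x y)

    field
      entry-diag : ∀ x → entry x x ≤ 1′
      entry-conv : ∀ x y → entry y x ≈ entry x y ˘
      entry-comp : ∀ x y z → entry x z ≤ entry x y ⨾ entry y z

  open BasicMatrix

  infix 4 _≈ₘ_ _≡[_]_
  infixl 9 _∘ₘ_

  _≈ₘ_ : Rel BasicMatrix ℓ
  f ≈ₘ g = ∀ x y → entry f x y ≈ entry g x y

  _∘ₘ_ : BasicMatrix → (Fin n → Fin n) → BasicMatrix
  f ∘ₘ τ = record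
    { atom       = λ x y → atom f (τ x) (τ y)
    ; entry-diag = λ x → entry-diag f (τ x)
    ; entry-conv = λ x y → entry-conv f (τ x) (τ y)
    ; entry-comp = λ x y z → entry-comp f (τ x) (τ y) (τ z)
    }

  _≡[_]_ : BasicMatrix → Fin n → BasicMatrix → Set ℓ
  f ≡[ i ] g = ∀ x y → x ≢ i → y ≢ i → entry f x y ≈ entry g x y

  Mat : AtomStructure (CylOp PEA n) ℓ ℓ ℓ
  Mat = record
    { setoid = record
      { Carrier       = BasicMatrix
      ; _≈_           = _≈ₘ_
      ; isEquivalence = record
        { refl  = λ x y → refl
        ; sym   = λ f≈g x y → sym (f≈g x y)
        ; trans = λ f≈g g≈h x y → trans (f≈g x y) (g≈h x y)
        }
      }
    ; R      = R
    ; R-resp = R-resp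
    }
    where
    R : ∀ {o} → CylOp PEA n o → BasicMatrix → Vec BasicMatrix o → Set ℓ
    R (cyl i)       f (g ∷ []) = f ≡[ i ] g
    R (diag _ i j)  f []       = entry f i j ≤ 1′
    R (repl _ i j)  f (g ∷ []) = f ∘ₘ [ i ∣ j ] ≈ₘ g
    R (tran _ i j) f (g ∷ []) = f ∘ₘ [ i ,, j ] ≈ₘ g

    move : ∀ {w x y z} → x ≈ w → y ≈ z → x ≈ y → w ≈ z
    move x≈w y≈z x≈y = trans (sym x≈w) (trans x≈y y≈z)

    R-resp : ∀ {o} (Ω : CylOp PEA n o) {f f′ : BasicMatrix} {gs gs′ : Vec BasicMatrix o} →
             f ≈ₘ f′ → Pointwise _≈ₘ_ gs gs′ → R Ω f gs → R Ω f′ gs′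
    R-resp (cyl i)       {gs = _ ∷ []} f≈ (g≈ ∷ []) Rfg x y x≢i y≢i = move (f≈ x y) (g≈ x y) (Rfg x y x≢i y≢i)
    R-resp (diag _ i j)  {gs = []}     f≈ []        Rf      = move (∧-cong (f≈ i j) refl) (f≈ i j) Rf
    R-resp (repl _ i j)  {gs = _ ∷ []} f≈ (g≈ ∷ []) Rfg x y = move (f≈ _ _) (g≈ x y) (Rfg x y)
    R-resp (tran _ i j) {gs = _ ∷ []} f≈ (g≈ ∷ []) Rfg x y = move (f≈ _ _) (g≈ x y) (Rfg x y)

  record IsCylindricBasis (1<n : 1 < n) (M : Pred BasicMatrix m) : Set (ℓ ⊔ m) where
    field
      atoms : ∀ (a : Atom) →
              ∃[ f ] f ∈ M × entry f (fromℕ< (<⇒≤ 1<n)) (fromℕ< 1<n) ≈ proj₁ a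
      witness : ∀ f → f ∈ M → ∀ (a b : Atom) x y z → z ≢ x → z ≢ y →
                entry f x y ≤ proj₁ a ⨾ proj₁ b →
                ∃[ g ] g ∈ M × f ≡[ z ] g × entry g x z ≈ proj₁ a × entry g z y ≈ proj₁ b
      amalgam : ∀ f g → f ∈ M → g ∈ M → ∀ x y →
                (∀ v w → v ≢ x → v ≢ y → w ≢ x → w ≢ y → entry f v w ≈ entry g v w) →
                ∃[ h ] h ∈ M × f ≡[ x ] h × g ≡[ y ] h

  record IsPolyadicEqualityBasis (1<n : 1 < n) (M : Pred BasicMatrix m) : Set (ℓ ⊔ m) where
    field
      isCylindricBasis : IsCylindricBasis 1<n M
      ∘-closed         : ∀ f → f ∈ M → ∀ (τ : Fin n → Fin n) → f ∘ₘ τ ∈ M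

{-# OPTIONS --safe #-}
module Submission where

-- Fix n > 2 and let G be the disjoint union of infinitely many cliques, each
-- with N = n * n + n + 1 vertices.  The atoms of the relation algebra are the
-- identity together with all pairs (vertex of G, colour), where there are
-- n + 1 colours; every atom is its own converse.  Apart from the identity
-- laws, the only forbidden triangles are the monochromatic ones no two of whose
-- vertices are adjacent in G.  The relation algebra consists of all sets of
-- atoms, and the atom structure of part (1) consists of its n-dimensional
-- basic matrices.
--
-- The full complex algebras are not representable.  Sort the nonidentity
-- atoms into finitely many classes by colour and by position inside the
-- clique.  Two vertices with the same position are never adjacent, so no
-- consistent triangle has all three sides in one class (no-class-triangle).
-- A representation contains infinitely many points at pairwise different
-- labels from a fixed point; Ramsey's theorem (monochromatic-triangle) finds
-- among them a triangle inside one class.  With cylindrifiers only, the n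
-- coordinates live in unrelated copies of the base, and the point found in
-- coordinate 1 is copied to coordinates 0 and 2 along the images of the
-- diagonal elements (collapse).  Only cylindrifiers and Boolean operations
-- are used, so the argument covers every signature between Df and PEA.
--
-- The term algebra is representable.  It is too small to name the positions
-- in all cliques at once: every element of it is closed, for some K, under
-- the relation that fixes the vertices of the first K cliques and otherwise
-- remembers only colours, equalities between vertices, and which vertices
-- share a clique (tame).  Add to G one infinite clique.  A finite configuration
-- of labels over the enlarged graph can be copied into G up to this relation,
-- and conversely, one label at a time, because n * n + n labels never exhaust a
-- clique (Extension.extend).  Over the enlarged graph a universal homogeneous
-- model exists: whenever a new point is added, its prescribed labels are
-- obeyed, and its labels to the other earlier points are different vertices of
-- the infinite clique in a colour avoided by the prescribed labels (Model).  The
-- tuples of points of this model represent the term algebra: a tuple belongs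
-- to the image of X when X contains a basic matrix similar to the matrix of
-- labels of the tuple.  Pairs of points likewise represent the subalgebra
-- of tame elements of the relation algebra.
--
-- The model also proves that the basic matrices form a polyadic equality
-- basis: a matrix is realised by a tuple, a point is added to the tuple, and
-- the extended configuration is copied back into G (net-witness, net-amalgam).

open import Defs
open import Level using (Level; 0ℓ; Lift; lift) renaming (suc to lsuc; _⊔_ to _⊔ℓ_)
open import Algebra.Lattice.Structures using (IsBooleanAlgebra)
open import Axiom.ExcludedMiddle using (ExcludedMiddle)
open import Data.Bool using (Bool; true; false; not) renaming (_∨_ to _∨ᵇ_; _∧_ to _∧ᵇ_)
import Data.Bool.Properties as Bₚ
open import Data.Empty using (⊥; ⊥-elim)
open import Data.Empty.Polymorphic using () renaming (⊥ to ⊥ₚ)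
open import Data.Fin using (Fin; zero; suc; toℕ; fromℕ<; remQuot; combine) renaming (_<_ to _<ᶠ_)
open import Data.Fin.Permutation.Components using (transpose; transpose-inverse)
open import Data.Fin.Properties using (_≟_; toℕ-injective; toℕ-fromℕ<; remQuot-combine; combine-injective; pigeonhole; <⇒notInjective)
open import Data.List as List using (List; []; _∷_)
open import Data.List.Membership.Propositional using (_∈_; _∉_)
open import Data.List.Membership.Propositional.Properties using (∈-map⁺; ∈-tabulate⁺; ∈-tabulate⁻)
import Data.List.Properties as Listₚ
open import Data.List.Relation.Unary.Any using (here; there; index)
open import Data.List.Relation.Unary.Any.Properties using (lookup-index)
open import Data.Maybe using (Maybe; just; nothing)
open import Data.Maybe.Properties using (just-injective)
open import Data.Nat using (ℕ; zero; suc; _+_; _*_; _<_; z≤n; s≤s; _⊔_) renaming (_≤_ to _≤ℕ_)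
open import Data.Nat.Properties as ℕₚ using (≤-trans; m≤m+n; m≤n+m; <-≤-trans; ≤-<-trans; <⇒≤)
open import Data.Product using (Σ; ∃-syntax; _×_; _,_; proj₁; proj₂; uncurry)
open import Data.Sum using (_⊎_; inj₁; inj₂; [_,_]) renaming (map to ⊎-map)
open import Data.Unit using (tt)
import Data.Unit.Polymorphic as Unitₚ
open import Data.Vec using (Vec; []; _∷_; lookup; map)
open import Data.Vec.Functional using (updateAt)
open import Data.Vec.Functional.Properties using (updateAt-updates; updateAt-minimal)
open import Data.Vec.Properties using (lookup-map; map-∘)
open import Data.Vec.Relation.Binary.Pointwise.Extensional using (ext; extensional⇒inductive)
open import Data.Vec.Relation.Binary.Pointwise.Inductive as Pw using (Pointwise; []; _∷_)
open import Data.Vec.Relation.Unary.All as All using (All)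
open import Function using (_∘_; _⇔_; mk⇔; Equivalence; id; const)
open import Function.Construct.Composition using (_⇔-∘_)
open import Function.Construct.Identity using (⇔-id)
open import Function.Construct.Symmetry using (⇔-sym)
open import Relation.Binary using (Setoid; tri<; tri≈; tri>)
open import Relation.Binary.PropositionalEquality using (_≡_; _≢_; refl; sym; trans; cong; cong₂; subst; subst₂)
open import Relation.Nullary using (¬_; Dec; yes; no; does)
open import Relation.Nullary.Negation using (contradiction)
open import Relation.Unary using (U; _≐_)
open import Relation.Unary.Algebra
open Equivalence using (to; from)

-- Logical preliminaries

⇔-trans : ∀ {a b c} {A : Set a} {B : Set b} {C : Set c} → A ⇔ B → B ⇔ C → A ⇔ C
⇔-trans e e′ = e′ ⇔-∘ e

both : ∀ {a b} {A : Set a} {B : Set b} → A → B → A ⇔ B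
both x y = mk⇔ (λ _ → y) (λ _ → x)

neither : ∀ {a b} {A : Set a} {B : Set b} → ¬ A → ¬ B → A ⇔ B
neither x y = mk⇔ (λ p → contradiction p x) (λ p → contradiction p y)

⇔-≡sym : ∀ {A : Set} {B : Set} {a b : A} {c d : B} → (a ≡ b ⇔ c ≡ d) → (b ≡ a ⇔ d ≡ c)
⇔-≡sym e = mk⇔ (sym ∘ to e ∘ sym) (sym ∘ from e ∘ sym)

bound : ∀ (xs : List ℕ) → ∃[ M ] (∀ {x} → x ∈ xs → x < M)
bound []       = 0 , λ ()
bound (y ∷ ys) with bound ys
... | M , f = suc y ⊔ M ,
      λ { (here refl) → ℕₚ.m≤m⊔n (suc y) M ; (there p) → ≤-trans (f p) (ℕₚ.m≤n⊔m (suc y) M) }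

-- Graphs, labels and consistent triangles

module _ {N C : ℕ} where

  -- The vertices: fin m p is the vertex at position p of the m-th finite clique,
  -- and the vertices inf q, for q in I, form one further clique.  The original
  -- graph is the case I = ⊥, the enlarged graph the case I = ℕ.
  data Node (I : Set) : Set where
    fin : (m : ℕ) (p : Fin N) → Node I
    inf : (q : I) → Node I

  -- The possible labels of an edge.  The labels over I = ⊥ are the atoms of the
  -- relation algebra.
  data Label (I : Set) : Set where
    idₗ : Label I
    at  : (ν : Node I) (c : Fin C) → Label I

  -- The index of the clique of a vertex, with 0 for the additional clique.
  clique : ∀ {I} → Node I → ℕ
  clique (inf q)   = 0
  clique (fin m p) = suc m

  clique-fin : ∀ {I m} (ν : Node I) → suc m ≡ clique ν → ∃[ p ] ν ≡ fin m p
  clique-fin (fin m p) refl = p , refl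

  Adjacent : ∀ {I} → Node I → Node I → Set
  Adjacent ν μ = clique ν ≡ clique μ × ν ≢ μ

  -- Consistency of a triangle with sides labelled l, k and j.
  Tri : ∀ {I} → Label I → Label I → Label I → Set
  Tri idₗ      l        k        = l ≡ k
  Tri (at ν c) idₗ      k        = at ν c ≡ k
  Tri (at ν c) (at μ d) idₗ      = at ν c ≡ at μ d
  Tri (at ν c) (at μ d) (at ρ e) =
    c ≡ d → d ≡ e → Adjacent ν μ ⊎ Adjacent ν ρ ⊎ Adjacent μ ρ

  Adj-sym : ∀ {I} {ν μ : Node I} → Adjacent ν μ → Adjacent μ ν
  Adj-sym (p , q) = sym p , q ∘ sym

  Tri-swap₁₂ : ∀ {I} (l k j : Label I) → Tri l k j → Tri k l j
  Tri-swap₁₂ idₗ      idₗ      j        t = t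
  Tri-swap₁₂ idₗ      (at μ d) j        t = t
  Tri-swap₁₂ (at ν c) idₗ      j        t = t
  Tri-swap₁₂ (at ν c) (at μ d) idₗ      t = sym t
  Tri-swap₁₂ (at ν c) (at μ d) (at ρ e) t d≡c c≡e with t (sym d≡c) (trans d≡c c≡e)
  ... | inj₁ a        = inj₁ (Adj-sym a)
  ... | inj₂ (inj₁ a) = inj₂ (inj₂ a)
  ... | inj₂ (inj₂ a) = inj₂ (inj₁ a)

  Tri-swap₂₃ : ∀ {I} (l k j : Label I) → Tri l k j → Tri l j k
  Tri-swap₂₃ idₗ      k        j        t = sym t
  Tri-swap₂₃ (at ν c) idₗ      idₗ      ()
  Tri-swap₂₃ (at ν c) idₗ      (at ρ e) t = t
  Tri-swap₂₃ (at ν c) (at μ d) idₗ      t = t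
  Tri-swap₂₃ (at ν c) (at μ d) (at ρ e) t c≡e e≡d with t (trans c≡e e≡d) (sym e≡d)
  ... | inj₁ a        = inj₂ (inj₁ a)
  ... | inj₂ (inj₁ a) = inj₁ a
  ... | inj₂ (inj₂ a) = inj₂ (inj₂ (Adj-sym a))

  Tri-idˡ : ∀ {I} (l : Label I) → Tri idₗ l l
  Tri-idˡ l = refl

  Tri-idᵐ : ∀ {I} (l : Label I) → Tri l idₗ l
  Tri-idᵐ l = Tri-swap₁₂ idₗ l l refl

  Tri-idʳ : ∀ {I} (l : Label I) → Tri l l idₗ
  Tri-idʳ l = Tri-swap₂₃ l idₗ l (Tri-idᵐ l)

  Tri-idʳ⁻¹ : ∀ {I} (l k : Label I) → Tri l k idₗ → l ≡ k
  Tri-idʳ⁻¹ idₗ      k        t = sym t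
  Tri-idʳ⁻¹ (at ν c) idₗ      ()
  Tri-idʳ⁻¹ (at ν c) (at μ d) t = t

  Tri-idᵐ⁻¹ : ∀ {I} (l k : Label I) → Tri l idₗ k → l ≡ k
  Tri-idᵐ⁻¹ idₗ      k t = t
  Tri-idᵐ⁻¹ (at ν c) k t = t

  -- The three invariants of a label used to compare configurations; the
  -- identity label has no colour, no vertex, and clique number 0.
  colourOf : ∀ {I} → Label I → Maybe (Fin C)
  colourOf idₗ      = nothing
  colourOf (at ν c) = just c

  node : ∀ {I} → Label I → Maybe (Node I)
  node idₗ      = nothing
  node (at ν c) = just ν

  cliqueOf : ∀ {I} → Label I → ℕ
  cliqueOf idₗ      = 0
  cliqueOf (at ν c) = suc (clique ν)

  label-ext : ∀ {I} (l k : Label I) → node l ≡ node k → colourOf l ≡ colourOf k → l ≡ k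
  label-ext idₗ      idₗ      p q = refl
  label-ext (at ν c) (at μ d) p q = cong₂ at (just-injective p) (just-injective q)

  module _ {I J : Set} where

    -- Match and Compat describe when one label may be replaced by another in a
    -- configuration: they have the same colour and agree on the first K cliques,
    -- and replacing two labels at once keeps equality of vertices and of cliques.
    Match : ℕ → Label I × Label J → Set
    Match K (l , l′) = colourOf l ≡ colourOf l′ ×
      (∀ m p → m < K → (node l ≡ just (fin m p) ⇔ node l′ ≡ just (fin m p)))

    Compat : Label I × Label J → Label I × Label J → Set
    Compat (l , l′) (k , k′) = (cliqueOf l ≡ cliqueOf k ⇔ cliqueOf l′ ≡ cliqueOf k′) ×
        (node l ≡ node k ⇔ node l′ ≡ node k′)

    -- Two families of labels with the same pattern up to the first K cliques.
    Similar : {X : Set} → ℕ → (X → Label I) → (X → Label J) → Set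
    Similar K f g = (∀ x → Match K (f x , g x)) × (∀ x y → Compat (f x , g x) (f y , g y))

    -- The same notion for a finite list of pairs of corresponding labels.
    Linked : ℕ → List (Label I × Label J) → Set
    Linked K L = (∀ {p} → p ∈ L → Match K p) × (∀ {p q} → p ∈ L → q ∈ L → Compat p q)

    Compat-refl : ∀ p → Compat p p
    Compat-refl p = both refl refl , both refl refl

    Compat-sym : ∀ {p q} → Compat p q → Compat q p
    Compat-sym (a , b) = ⇔-≡sym a , ⇔-≡sym b

    Compat-≡ : ∀ {l k l′ k′} → colourOf l ≡ colourOf l′ → colourOf k ≡ colourOf k′ → Compat (l , l′) (k , k′) →
               l ≡ k ⇔ l′ ≡ k′
    Compat-≡ {l} {k} {l′} {k′} cl ck (_ , n) = mk⇔
      (λ e → label-ext l′ k′ (to n (cong node e)) (trans (sym cl) (trans (cong colourOf e) ck)))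
      (λ e → label-ext l k (from n (cong node e)) (trans cl (trans (cong colourOf e) (sym ck))))

    Match-id : ∀ {K l l′} → Match K (l , l′) → l ≡ idₗ → l′ ≡ idₗ
    Match-id {l′ = idₗ}    (p , _) refl = refl
    Match-id {l′ = at _ _} (() , _) refl

    Adjacent-transfer : ∀ {ν ν′ μ μ′ c c′ d d′} → Compat (at ν c , at μ d) (at ν′ c′ , at μ′ d′) →
                        Adjacent ν ν′ → Adjacent μ μ′
    Adjacent-transfer (x , y) (e , ne) =
      ℕₚ.suc-injective (to x (cong suc e)) , λ e′ → ne (just-injective (from y (cong just e′)))

    -- Consistency of a triangle depends only on its pattern.
    Tri-transfer : ∀ {l₁ l₂ l₃ k₁ k₂ k₃} →
      colourOf l₁ ≡ colourOf k₁ → colourOf l₂ ≡ colourOf k₂ → colourOf l₃ ≡ colourOf k₃ →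
      Compat (l₁ , k₁) (l₂ , k₂) → Compat (l₁ , k₁) (l₃ , k₃) → Compat (l₂ , k₂) (l₃ , k₃) →
      Tri l₁ l₂ l₃ → Tri k₁ k₂ k₃
    Tri-transfer {idₗ} {l₂} {l₃} {idₗ} {k₂} {k₃} p q r a b c t = to (Compat-≡ {l₂} {l₃} {k₂} {k₃} q r c) t
    Tri-transfer {at _ _} {idₗ} {l₃} {at _ _} {idₗ} p q r a b c t = to (Compat-≡ p r b) t
    Tri-transfer {at _ _} {at _ _} {idₗ} {at _ _} {at _ _} {idₗ} p q r a b c t = to (Compat-≡ p q a) t
    Tri-transfer {at ν₁ c₁} {at ν₂ c₂} {at ν₃ c₃} {at μ₁ d₁} {at μ₂ d₂} {at μ₃ d₃} refl refl refl a b c t e₁ e₂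
      with t e₁ e₂
    ... | inj₁ x        = inj₁ (Adjacent-transfer {c = c₁} {c₂} {c₁} {c₂} a x)
    ... | inj₂ (inj₁ x) = inj₂ (inj₁ (Adjacent-transfer {c = c₁} {c₃} {c₁} {c₃} b x))
    ... | inj₂ (inj₂ x) = inj₂ (inj₂ (Adjacent-transfer {c = c₂} {c₃} {c₂} {c₃} c x))

  Similar-sym : ∀ {I J} {X : Set} {K} {f : X → Label I} {g : X → Label J} → Similar K f g → Similar K g f
  Similar-sym (m , c) = (λ x → sym (proj₁ (m x)) , λ a p a<K → ⇔-sym (proj₂ (m x) a p a<K)) ,
                     λ x y → ⇔-sym (proj₁ (c x y)) , ⇔-sym (proj₂ (c x y))

  Similar-trans : ∀ {I J H} {X : Set} {K} {f : X → Label I} {g : X → Label J} {h : X → Label H} →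
              Similar K f g → Similar K g h → Similar K f h
  Similar-trans (m , c) (m′ , c′) =
    (λ x → trans (proj₁ (m x)) (proj₁ (m′ x)) ,
        λ a p a<K → ⇔-trans (proj₂ (m x) a p a<K) (proj₂ (m′ x) a p a<K)) ,
    λ x y → ⇔-trans (proj₁ (c x y)) (proj₁ (c′ x y)) , ⇔-trans (proj₂ (c x y)) (proj₂ (c′ x y))

  Similar-mono : ∀ {I J} {X : Set} {K L} {f : X → Label I} {g : X → Label J} → K ≤ℕ L → Similar L f g →
      Similar K f g
  Similar-mono K≤L (m , c) = (λ x → proj₁ (m x) , λ a p a<K → proj₂ (m x) a p (<-≤-trans a<K K≤L)) , c

  Similar-≡ : ∀ {I} {X : Set} {K} {f g : X → Label I} → (∀ x → f x ≡ g x) → Similar K f g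
  Similar-≡ {f = f} {g} e =
      (λ x → cong colourOf (e x) , λ m p _ → mk⇔ (trans (cong node (sym (e x)))) (trans (cong node (e x)))) ,
    λ x y → mk⇔ (λ p → trans (cong cliqueOf (sym (e x))) (trans p (cong cliqueOf (e y))))
        (λ p → trans (cong cliqueOf (e x)) (trans p (cong cliqueOf (sym (e y))))) ,
            mk⇔ (λ p → trans (cong node (sym (e x))) (trans p (cong node (e y))))
                (λ p → trans (cong node (e x)) (trans p (cong node (sym (e y)))))

  -- The inclusion of the original graph into the enlarged one.
  ι : ∀ {I} → Label ⊥ → Label I
  ι idₗ              = idₗ
  ι (at (fin m p) c) = at (fin m p) c

  Similar-ι : ∀ {I} {X : Set} {K} (f : X → Label ⊥) → Similar {I = I} K (λ x → ι (f x)) f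
  Similar-ι {I} f = (λ x → colour-ι (f x) , λ m p _ → node-ι (f x) m p) , λ x y → cliques-ι (f x) (f y) , nodes-ι (f x) (f y)
    where
    colour-ι : ∀ l → colourOf (ι {I} l) ≡ colourOf l
    colour-ι idₗ = refl
    colour-ι (at (fin m p) c) = refl
    node-ι : ∀ l m p → node (ι {I} l) ≡ just (fin m p) ⇔ node l ≡ just (fin m p)
    node-ι idₗ m p = neither (λ ()) (λ ())
    node-ι (at (fin m′ p′) c) m p = mk⇔ (λ { refl → refl }) (λ { refl → refl })
    clique-ι : ∀ l → cliqueOf (ι {I} l) ≡ cliqueOf l
    clique-ι idₗ = refl
    clique-ι (at (fin m p) c) = refl
    cliques-ι : ∀ l k → cliqueOf (ι {I} l) ≡ cliqueOf (ι {I} k) ⇔ cliqueOf l ≡ cliqueOf k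
    cliques-ι l k rewrite clique-ι l | clique-ι k = ⇔-id _
    nodes-ι : ∀ l k → node (ι {I} l) ≡ node (ι {I} k) ⇔ node l ≡ node k
    nodes-ι idₗ idₗ = both refl refl
    nodes-ι idₗ (at (fin m p) c) = neither (λ ()) (λ ())
    nodes-ι (at (fin m p) c) idₗ = neither (λ ()) (λ ())
    nodes-ι (at (fin m p) c) (at (fin m′ p′) c′) = mk⇔ (λ { refl → refl }) (λ { refl → refl })

  Tri-ι : ∀ {I} a b c → Tri a b c → Tri {I} (ι a) (ι b) (ι c)
  Tri-ι {I} a b c = Tri-transfer (sym (colour-ι a)) (sym (colour-ι b)) (sym (colour-ι c)) (compat-ι a b) (compat-ι a c) (compat-ι b c)
    where
    s = Similar-ι {I} {Label ⊥} {0} id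
    colour-ι : ∀ l → colourOf (ι {I} l) ≡ colourOf l
    colour-ι l = proj₁ (proj₁ s l)
    compat-ι : ∀ l k → Compat (l , ι {I} l) (k , ι k)
    compat-ι l k = ⇔-sym (proj₁ (proj₂ s l k)) , ⇔-sym (proj₂ (proj₂ s l k))

  -- Finitely many labels lie in the first K cliques for some K; such labels are
  -- determined by Match (Match-near, Match-fixed).
  near-bound : ∀ {d} (b : Fin d → Label ⊥) → ∃[ K ] ∀ x m p c → b x ≡ at (fin m p) c → m < K
  near-bound {zero}  b = 0 , λ ()
  near-bound {suc d} b with near-bound (b ∘ suc)
  ... | K , f = cliqueOf (b zero) + K , λ
        { zero m p c e → <-≤-trans (subst (λ l → m < cliqueOf l) (sym e) (s≤s (ℕₚ.n≤1+n m))) (m≤m+n _ K)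
        ; (suc x) m p c e → <-≤-trans (f x m p c e) (m≤n+m K _) }

  Match-fin : ∀ {I J K m p c} (b : Label J) → m < K → Match {I} K (at (fin m p) c , b) → b ≡ at (fin m p) c
  Match-fin b m<K (e , f) = label-ext b (at (fin _ _) _) (to (f _ _ m<K) refl) (sym e)

  Match-near : ∀ {I K} (a b : Label ⊥) → (∀ m p c → a ≡ at (fin m p) c → m < K) →
               Match {I} K (ι a , b) → b ≡ a
  Match-near idₗ              b near mt = Match-id mt refl
  Match-near (at (fin m p) c) b near mt = Match-fin b (near m p c refl) mt

  Match-fixed : ∀ {K} (a b : Label ⊥) → (∀ m p c → a ≡ at (fin m p) c → m < K) →
                Match K (a , b) → b ≡ a
  Match-fixed idₗ              b near mt = Match-id mt refl
  Match-fixed (at (fin m p) c) b near mt = Match-fin b (near m p c refl) mt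

-- Copying configurations one label at a time

-- A list shorter than k misses an element of Fin k.
missing : ExcludedMiddle 0ℓ → ∀ {k} (xs : List (Fin k)) → List.length xs < k → ∃[ x ] x ∉ xs
missing em {k} xs l<k with em {∃[ x ] x ∉ xs}
... | yes r = r
... | no ¬r = ⊥-elim (<⇒notInjective {f = λ x → index (∈xs x)} l<k (λ {x} {y} → inj {x} {y}))
  where
  ∈xs : ∀ x → x ∈ xs
  ∈xs x with em {x ∈ xs}
  ... | yes p = p
  ... | no  p = contradiction (x , p) ¬r
  inj : ∀ {x y} → index (∈xs x) ≡ index (∈xs y) → x ≡ y
  inj {x} {y} e = trans (lookup-index (∈xs x)) (trans (cong (List.lookup xs) e) (sym (lookup-index (∈xs y))))

-- The additional clique is empty or inexhaustible.
Fresh : Set → Set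
Fresh J = J → ∀ (xs : List J) → ∃[ x ] x ∉ xs

fresh-⊥ : Fresh ⊥
fresh-⊥ ()

fresh-ℕ : Fresh ℕ
fresh-ℕ _ xs with bound xs
... | M , f = M , λ M∈ → ℕₚ.<-irrefl refl (f M∈)

module Extension (em : ExcludedMiddle 0ℓ) {N₀ C : ℕ} {I J : Set} (freshJ : Fresh J) where
  private
    N = suc N₀
    LI = Label {N} {C} I
    LJ = Label {N} {C} J

  -- Default values are irrelevant: position and infPart only collect the vertices
  -- that a fresh vertex has to avoid.
  position : LJ → Fin N
  position (at (fin m p) c) = p
  position _                = zero

  infPart : J → LJ → J
  infPart r (at (inf q) c) = q
  infPart r _              = r

  -- Any further label a can be matched by some a′, as long as the list is shorter
  -- than the finite cliques.
  extend₁ : ∀ {K} (L : List (LI × LJ)) → List.length L < N → Linked K L →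
            ∀ a → ∃[ a′ ] Linked K ((a , a′) ∷ L)
  extend₁ {K} L l<N (mt , cp) idₗ = idₗ ,
      (λ { (here refl) → refl , λ _ _ _ → neither (λ ()) (λ ()) ; (there p) → mt p }) ,
      λ { (here refl) (here refl) → Compat-refl (idₗ , idₗ)
        ; (here refl) (there q) → new q
        ; (there p) (here refl) → Compat-sym (new p)
        ; (there p) (there q) → cp p q }
    where
    colour : ∀ {b b′} → (b , b′) ∈ L → colourOf b ≡ colourOf b′
    colour b∈ = proj₁ (mt b∈)
    new : ∀ {q} → q ∈ L → Compat (idₗ , idₗ) q
    new {idₗ , idₗ} _ = both refl refl , both refl refl
    new {idₗ , at _ _} q∈ = contradiction (colour q∈) (λ ())
    new {at _ _ , idₗ} q∈ = contradiction (colour q∈) (λ ())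
    new {at _ _ , at _ _} _ = neither (λ ()) (λ ()) , neither (λ ()) (λ ())
  extend₁ {K} L l<N (mt , cp) (at ν c) = result
    where
    colour : ∀ {b b′} → (b , b′) ∈ L → colourOf b ≡ colourOf b′
    colour b∈ = proj₁ (mt b∈)
    -- It suffices to find a vertex of the right kind; the colour is kept.
    finish : (ν′ : Node J) → (∀ m p → m < K → (ν ≡ fin m p ⇔ ν′ ≡ fin m p)) →
             (∀ {μ μ′ d d′} → (at μ d , at μ′ d′) ∈ L →
               (clique ν ≡ clique μ ⇔ clique ν′ ≡ clique μ′) × (ν ≡ μ ⇔ ν′ ≡ μ′)) →
             ∃[ a′ ] Linked K ((at ν c , a′) ∷ L)
    finish ν′ near compat = at ν′ c ,
      (λ { (here refl) → refl , (λ m p m<K → mk⇔ (cong just ∘ to (near m p m<K) ∘ just-injective)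
                                                  (cong just ∘ from (near m p m<K) ∘ just-injective))
         ; (there p) → mt p }) ,
      λ { (here refl) (here refl) → Compat-refl (at ν c , at ν′ c)
        ; (here refl) (there q) → new q
        ; (there p) (here refl) → Compat-sym {p = at ν c , at ν′ c} (new p)
        ; (there p) (there q) → cp p q }
      where
      new : ∀ {q} → q ∈ L → Compat (at ν c , at ν′ c) q
      new {idₗ , idₗ} _ = neither (λ ()) (λ ()) , neither (λ ()) (λ ())
      new {idₗ , at _ _} q∈ = contradiction (colour q∈) (λ ())
      new {at _ _ , idₗ} q∈ = contradiction (colour q∈) (λ ())
      new {at μ d , at μ′ d′} q∈ with compat {d = d} q∈
      ... | a , b = mk⇔ (cong suc ∘ to a ∘ ℕₚ.suc-injective) (cong suc ∘ from a ∘ ℕₚ.suc-injective) ,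
                    mk⇔ (cong just ∘ to b ∘ just-injective) (cong just ∘ from b ∘ just-injective)

    nodes : ∀ {μ μ′ d d′ ρ ρ′ e e′} → (at μ d , at μ′ d′) ∈ L → (at ρ e , at ρ′ e′) ∈ L →
            (clique μ ≡ clique ρ ⇔ clique μ′ ≡ clique ρ′) × (μ ≡ ρ ⇔ μ′ ≡ ρ′)
    nodes p q with cp p q
    ... | a , b = mk⇔ (ℕₚ.suc-injective ∘ to a ∘ cong suc) (ℕₚ.suc-injective ∘ from a ∘ cong suc) ,
                  mk⇔ (just-injective ∘ to b ∘ cong just) (just-injective ∘ from b ∘ cong just)

    nearL : ∀ {μ μ′ d d′} → (at μ d , at μ′ d′) ∈ L → ∀ m p → m < K → (μ ≡ fin m p ⇔ μ′ ≡ fin m p)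
    nearL μ∈ m p m<K with proj₂ (mt μ∈) m p m<K
    ... | b = mk⇔ (just-injective ∘ to b ∘ cong just) (just-injective ∘ from b ∘ cong just)

    Near Used Joined : Set
    Near = ∃[ m ] ∃[ p ] (ν ≡ fin m p × m < K)
    Used = ∃[ d ] ∃[ μ′ ] ∃[ d′ ] (at ν d , at μ′ d′) ∈ L
    Joined = ∃[ μ ] ∃[ d ] ∃[ μ′ ] ∃[ d′ ] (clique ν ≡ clique μ × (at μ d , at μ′ d′) ∈ L)

    -- A vertex in one of the first K cliques is matched by itself, and one that
    -- occurs already by its partner.  A new vertex in a clique that occurs already
    -- goes to an unused position of the partner clique; otherwise a new clique,
    -- beyond the first K, is used.
    near-case : ∀ m p → ν ≡ fin m p → m < K → ∃[ a′ ] Linked K ((at ν c , a′) ∷ L)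
    near-case m p refl m<K = finish (fin m p) (λ m′ p′ _ → mk⇔ (λ { refl → refl }) (λ { refl → refl }))
      λ μ∈ → cl μ∈ , nearL′ μ∈
      where
      nearL′ : ∀ {μ μ′ d d′} → (at μ d , at μ′ d′) ∈ L → (fin m p ≡ μ ⇔ fin m p ≡ μ′)
      nearL′ μ∈ with nearL μ∈ m p m<K
      ... | b = mk⇔ (sym ∘ to b ∘ sym) (sym ∘ from b ∘ sym)
      cl : ∀ {μ μ′ d d′} → (at μ d , at μ′ d′) ∈ L → (suc m ≡ clique μ ⇔ suc m ≡ clique μ′)
      cl {μ} {μ′} μ∈ = mk⇔ forwards backwards
        where
        forwards : suc m ≡ clique μ → suc m ≡ clique μ′
        forwards e with clique-fin μ e
        ... | q , refl = cong clique (sym (to (nearL μ∈ m q m<K) refl))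
        backwards : suc m ≡ clique μ′ → suc m ≡ clique μ
        backwards e with clique-fin μ′ e
        ... | q , refl = cong clique (sym (from (nearL μ∈ m q m<K) refl))

    used-case : ∀ {d μ′ d′} → (at ν d , at μ′ d′) ∈ L → ∃[ a′ ] Linked K ((at ν c , a′) ∷ L)
    used-case {d} {μ′} ν∈ = finish μ′ (nearL ν∈) (nodes ν∈)

    joined-case : ∀ {μ d μ′ d′} → ¬ Near → ¬ Used → clique ν ≡ clique μ → (at μ d , at μ′ d′) ∈ L →
                  ∃[ a′ ] Linked K ((at ν c , a′) ∷ L)
    joined-case {μ} {d} {fin m′ p′} {d′} ¬near ¬used ν~μ μ∈ =
      let q , q∉ = missing em (List.map (position ∘ proj₂) L) (subst (_< N) (sym (Listₚ.length-map (position ∘ proj₂) L)) l<N)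
      in finish (fin m′ q)
           (λ m p m<K → neither (λ e → ¬near (m , p , e , m<K)) λ { refl → far m<K })
           λ ρ∈ → ⇔-trans (mk⇔ (trans (sym ν~μ)) (trans ν~μ)) (proj₁ (nodes μ∈ ρ∈)) ,
                  neither (λ { refl → ¬used (_ , _ , _ , ρ∈) }) λ { refl → q∉ (∈-map⁺ (position ∘ proj₂) ρ∈) }
      where
      far : ¬ (m′ < K)
      far m<K with from (nearL μ∈ m′ p′ m<K) refl
      ... | refl with clique-fin ν (sym ν~μ)
      ... | p , e = ¬near (m′ , p , e , m<K)
    joined-case {μ} {d} {inf r} {d′} ¬near ¬used ν~μ μ∈ =
      let q , q∉ = freshJ r (List.map (infPart r ∘ proj₂) L)
      in finish (inf q)
           (λ m p m<K → neither (λ e → ¬near (m , p , e , m<K)) λ ())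
           λ ρ∈ → ⇔-trans (mk⇔ (trans (sym ν~μ)) (trans ν~μ)) (proj₁ (nodes μ∈ ρ∈)) ,
                  neither (λ { refl → ¬used (_ , _ , _ , ρ∈) }) λ { refl → q∉ (∈-map⁺ (infPart r ∘ proj₂) ρ∈) }

    new-case : ¬ Near → ¬ Joined → ∃[ a′ ] Linked K ((at ν c , a′) ∷ L)
    new-case ¬near ¬joined with bound (List.map (cliqueOf ∘ proj₂) L)
    ... | M , M> = finish (fin (M + K) zero)
        (λ m p m<K → neither (λ e → ¬near (m , p , e , m<K))
            λ { refl → ℕₚ.<-irrefl refl (≤-<-trans (m≤n+m K M) m<K) })
        λ ρ∈ → neither (λ e → ¬joined (_ , _ , _ , _ , e , ρ∈)) (apart ρ∈) ,
               neither (λ { refl → ¬joined (_ , _ , _ , _ , refl , ρ∈) }) (apart ρ∈ ∘ cong clique)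
      where
      apart : ∀ {μ μ′ d d′} → (at μ d , at μ′ d′) ∈ L → suc (M + K) ≢ clique μ′
      apart ρ∈ e with M> (∈-map⁺ (cliqueOf ∘ proj₂) ρ∈)
      ... | lt = ℕₚ.<-irrefl refl
            (<-≤-trans (subst (λ z → suc z < M) (sym e) lt)
            (≤-trans (m≤m+n M K) (ℕₚ.≤-trans (ℕₚ.n≤1+n _) (ℕₚ.n≤1+n _))))

    result : ∃[ a′ ] Linked K ((at ν c , a′) ∷ L)
    result with em {Near} | em {Used} | em {Joined}
    ... | yes (m , p , e , m<K) | _ | _ = near-case m p e m<K
    ... | no _ | yes (_ , _ , _ , ν∈) | _ = used-case ν∈
    ... | no ¬n | no ¬u | yes (_ , _ , _ , _ , e , μ∈) = joined-case ¬n ¬u e μ∈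
    ... | no ¬n | no ¬u | no ¬j = new-case ¬n ¬j

  abstract
    extend : ∀ {K d} (L : List (LI × LJ)) → List.length L + d ≤ℕ N → Linked K L → (t : Fin d → LI) →
             Σ (Fin d → LJ) λ e → ∃[ L′ ] (Linked K L′ × (∀ {p} → p ∈ L → p ∈ L′) × (∀ x → (t x , e x) ∈ L′))
    extend {d = zero}  L l≤ lk t = (λ ()) , L , lk , id , λ ()
    extend {d = suc d} L l≤ lk t with extend₁ L (<-≤-trans (ℕₚ.m<m+n (List.length L) (s≤s z≤n)) l≤) lk (t zero)
    ... | a , lk₁ with extend ((t zero , a) ∷ L) (subst (_≤ℕ N) (ℕₚ.+-suc (List.length L) d) l≤) lk₁ (t ∘ suc)
    ... | e , L′ , lk′ , L⊆ , t∈ = (λ { zero → a ; (suc x) → e x }) , L′ , lk′ , (λ p → L⊆ (there p)) ,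
          λ { zero → L⊆ (here refl) ; (suc x) → t∈ x }

-- The universal model

abstract
  -- An injective pairing that exceeds both components: pair a b is the product of
  -- 2 to the power a with the odd number 2 * b + 1.
  pair : ℕ → ℕ → ℕ
  pair zero    b = suc (2 * b)
  pair (suc a) b = 2 * pair a b

  pair-injective : ∀ a b a′ b′ → pair a b ≡ pair a′ b′ → a ≡ a′ × b ≡ b′
  pair-injective zero    b zero     b′ e = refl , ℕₚ.*-cancelˡ-≡ b b′ 2 (ℕₚ.suc-injective e)
  pair-injective zero    b (suc a′) b′ e = contradiction (sym e) (ℕₚ.even≢odd (pair a′ b′) b)
  pair-injective (suc a) b zero     b′ e = contradiction e (ℕₚ.even≢odd (pair a b) b′)
  pair-injective (suc a) b (suc a′) b′ e with pair-injective a b a′ b′ (ℕₚ.*-cancelˡ-≡ _ _ 2 e)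
  ... | refl , q = refl , q

  <pairˡ : ∀ a b → a < pair a b
  <pairˡ zero    b = s≤s z≤n
  <pairˡ (suc a) b = subst (suc (suc a) ≤ℕ_) (cong (pair a b +_) (sym (ℕₚ.+-identityʳ (pair a b))))
    (ℕₚ.+-mono-≤ (≤-trans (s≤s z≤n) (<pairˡ a b)) (<pairˡ a b))

  <pairʳ : ∀ a b → b < pair a b
  <pairʳ zero    b = s≤s (m≤m+n b _)
  <pairʳ (suc a) b = <-≤-trans (<pairʳ a b) (m≤m+n _ _)

  pair≢0 : ∀ a b → pair a b ≢ 0
  pair≢0 a b e = ℕₚ.n≮0 (subst (a <_) e (<pairˡ a b))

module Model (em : ExcludedMiddle 0ℓ) {N C₀ : ℕ} where

  private
    C = suc C₀
    L = Label {N} {C} ℕ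

  codeLabel : L → ℕ
  codeLabel idₗ              = 0
  codeLabel (at (fin m p) c) = pair 0 (pair m (pair (toℕ p) (toℕ c)))
  codeLabel (at (inf q) c)   = pair 1 (pair q (toℕ c))

  codeLabel-injective : ∀ l k → codeLabel l ≡ codeLabel k → l ≡ k
  codeLabel-injective idₗ idₗ e = refl
  codeLabel-injective idₗ (at (fin m p) c) e = contradiction (sym e) (pair≢0 0 _)
  codeLabel-injective idₗ (at (inf q) c) e = contradiction (sym e) (pair≢0 1 _)
  codeLabel-injective (at (fin m p) c) idₗ e = contradiction e (pair≢0 0 _)
  codeLabel-injective (at (inf q) c) idₗ e = contradiction e (pair≢0 1 _)
  codeLabel-injective (at (fin m p) c) (at (inf q) d) e = contradiction (proj₁ (pair-injective 0 _ 1 _ e)) λ ()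
  codeLabel-injective (at (inf q) d) (at (fin m p) c) e = contradiction (proj₁ (pair-injective 1 _ 0 _ e)) λ ()
  codeLabel-injective (at (inf q) c) (at (inf r) d) e with pair-injective q _ r _
      (proj₂ (pair-injective 1 _ 1 _ e))
  ... | refl , y = cong (at (inf q)) (toℕ-injective y)
  codeLabel-injective (at (fin m p) c) (at (fin m′ p′) c′) e with pair-injective m _ m′ _
      (proj₂ (pair-injective 0 _ 0 _ e))
  ... | refl , y with pair-injective (toℕ p) _ (toℕ p′) _ y
  ... | u , v = cong₂ (λ p c → at (fin m p) c) (toℕ-injective u) (toℕ-injective v)

  -- A point of the model is a request: a colour, used for the default labels of
  -- the point, and the list of the prescribed labels to earlier points, which are
  -- given by their codes.  A request has a larger code than the points it mentions.
  Request : Set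
  Request = Fin C × List (ℕ × L)

  codes : List (ℕ × L) → ℕ
  codes []             = 0
  codes ((k , l) ∷ ps) = pair k (pair (codeLabel l) (codes ps))

  codes-injective : ∀ ps qs → codes ps ≡ codes qs → ps ≡ qs
  codes-injective [] [] e = refl
  codes-injective [] ((k , l) ∷ qs) e = contradiction (sym e) (pair≢0 k _)
  codes-injective ((k , l) ∷ ps) [] e = contradiction e (pair≢0 k _)
  codes-injective ((k , l) ∷ ps) ((k′ , l′) ∷ qs) e with pair-injective k _ k′ _ e
  ... | refl , x with pair-injective (codeLabel l) _ (codeLabel l′) _ x
  ... | y , z with codeLabel-injective l l′ y | codes-injective ps qs z
  ... | refl | refl = refl

  code : Request → ℕ
  code (c , ps) = pair (toℕ c) (codes ps)

  code-injective : ∀ u v → code u ≡ code v → u ≡ v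
  code-injective (c , ps) (d , qs) e with pair-injective (toℕ c) _ (toℕ d) _ e
  ... | x , y = cong₂ _,_ (toℕ-injective x) (codes-injective ps qs y)

  ∈⇒< : ∀ {k l} ps → (k , l) ∈ ps → k < codes ps
  ∈⇒< (_ ∷ ps) (here refl) = <pairˡ _ _
  ∈⇒< ((k′ , l′) ∷ ps) (there p) =
      ℕₚ.<-trans (∈⇒< ps p) (ℕₚ.<-trans (<pairʳ (codeLabel l′) (codes ps)) (<pairʳ k′ _))

  parent< : ∀ {k l} z → (k , l) ∈ proj₂ z → k < code z
  parent< (c , ps) p = ℕₚ.<-trans (∈⇒< ps p) (<pairʳ (toℕ c) _)

  abstract
    -- The label between the request z and the earlier point with code k: a prescribed
    -- label if there is one, and otherwise a vertex of the infinite clique that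
    -- is the default of no other pair of points.
    edge : ℕ → Request → L
    edge k z with em {∃[ l ] (k , l) ∈ proj₂ z}
    ... | yes (l , _) = l
    ... | no  _       = at (inf (pair k (code z))) (proj₁ z)

    edge-view : ∀ k z → (k , edge k z) ∈ proj₂ z ⊎ edge k z ≡ at (inf (pair k (code z))) (proj₁ z)
    edge-view k z with em {∃[ l ] (k , l) ∈ proj₂ z}
    ... | yes (l , p) = inj₁ p
    ... | no  _       = inj₂ refl

    edge-listed : ∀ {k l} z → (k , l) ∈ proj₂ z → (k , edge k z) ∈ proj₂ z
    edge-listed {k} {l} z p with em {∃[ l ] (k , l) ∈ proj₂ z}
    ... | yes (_ , q) = q
    ... | no  ¬q      = contradiction (l , p) ¬q

    -- The label between two requests, decided by the one with the larger code.
    lab : Request → Request → L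
    lab u v with ℕₚ.<-cmp (code u) (code v)
    ... | tri< _ _ _ = edge (code u) v
    ... | tri≈ _ _ _ = idₗ
    ... | tri> _ _ _ = edge (code v) u

    lab-< : ∀ {u v} → code u < code v → lab u v ≡ edge (code u) v
    lab-< {u} {v} lt with ℕₚ.<-cmp (code u) (code v)
    ... | tri< _ _ _ = refl
    ... | tri≈ ¬lt _ _ = contradiction lt ¬lt
    ... | tri> ¬lt _ _ = contradiction lt ¬lt

    lab-> : ∀ {u v} → code v < code u → lab u v ≡ edge (code v) u
    lab-> {u} {v} lt with ℕₚ.<-cmp (code u) (code v)
    ... | tri< _ _ ¬lt = contradiction lt ¬lt
    ... | tri≈ _ _ ¬lt = contradiction lt ¬lt
    ... | tri> _ _ _ = refl

    lab-refl : ∀ u → lab u u ≡ idₗ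
    lab-refl u with ℕₚ.<-cmp (code u) (code u)
    ... | tri< _ ¬e _ = contradiction refl ¬e
    ... | tri≈ _ _ _  = refl
    ... | tri> _ ¬e _ = contradiction refl ¬e

    lab-sym : ∀ u v → lab u v ≡ lab v u
    lab-sym u v with ℕₚ.<-cmp (code u) (code v)
    ... | tri< lt _ _ = sym (lab-> {v} {u} lt)
    ... | tri≈ _ e _ with code-injective u v e
    ...   | refl = sym (lab-refl u)
    lab-sym u v | tri> _ _ lt = sym (lab-< {v} {u} lt)

  -- The requests that are admitted as points: the default colour differs from the
  -- colours of the prescribed labels, and prescribed labels are consistent.
  record Good (z : Request) : Set where
    field
      avoids     : ∀ {k l} → (k , l) ∈ proj₂ z → ∃[ ν ] ∃[ c ] (l ≡ at ν c × c ≢ proj₁ z)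
      consistent : ∀ u w {l l′} → (code u , l) ∈ proj₂ z → (code w , l′) ∈ proj₂ z → Tri (lab u w) l l′
  open Good

  Point : Set
  Point = Σ Request Good

  points : Setoid 0ℓ 0ℓ
  points = record
    { Carrier = Point ; _≈_ = λ u v → proj₁ u ≡ proj₁ v
    ; isEquivalence = record { refl = refl ; sym = sym ; trans = trans } }

  edge≢id : ∀ k (z : Point) → edge k (proj₁ z) ≢ idₗ
  edge≢id k (z , g) e with edge-view k z
  ... | inj₂ e′ = contradiction (trans (sym e) e′) λ ()
  ... | inj₁ p with avoids g p
  ...   | ν , c , e′ , _ = contradiction (trans (sym e) e′) λ ()

  abstract
    lab-id : ∀ (u v : Point) → lab (proj₁ u) (proj₁ v) ≡ idₗ → proj₁ u ≡ proj₁ v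
    lab-id (u , gu) (v , gv) e with ℕₚ.<-cmp (code u) (code v)
    ... | tri< _ _ _ = contradiction e (edge≢id (code u) (v , gv))
    ... | tri≈ _ q _ = code-injective u v q
    ... | tri> _ _ _ = contradiction e (edge≢id (code v) (u , gu))

  Tri-≡ : ∀ {a b c a′ b′ c′ : L} → a ≡ a′ → b ≡ b′ → c ≡ c′ → Tri a b c → Tri a′ b′ c′
  Tri-≡ refl refl refl t = t

  Tri-colour : ∀ {ν μ : Node {N} {C} ℕ} {c d} a → a ≢ idₗ → c ≢ d → Tri a (at ν c) (at μ d)
  Tri-colour idₗ ne c≢d = contradiction refl ne
  Tri-colour (at _ _) ne c≢d _ e = contradiction e c≢d

  Tri-adjacent : ∀ {ν μ : Node {N} {C} ℕ} {c d} a → a ≢ idₗ → Adjacent ν μ → Tri a (at ν c) (at μ d)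
  Tri-adjacent idₗ ne adj = contradiction refl ne
  Tri-adjacent (at _ _) ne adj _ _ = inj₂ (inj₂ adj)

  -- The triangle formed by z and two different points with smaller codes.  Two
  -- prescribed labels are consistent because z is good; a prescribed and a default
  -- label have different colours; two default labels have adjacent vertices.
  Tri-edges : ∀ (u v z : Point) → proj₁ u ≢ proj₁ v →
              Tri (lab (proj₁ u) (proj₁ v)) (edge (code (proj₁ u)) (proj₁ z)) (edge (code (proj₁ v)) (proj₁ z))
  Tri-edges (u , gu) (v , gv) (z , gz) u≢v with edge-view (code u) z | edge-view (code v) z
  ... | inj₁ p | inj₁ q = consistent gz u v p q
  ... | inj₁ p | inj₂ e with avoids gz p
  ...   | ν , c , e′ , c≢ = Tri-≡ refl (sym e′) (sym e)
            (Tri-colour (lab u v) (λ x → u≢v (lab-id (u , gu) (v , gv) x)) c≢)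
  Tri-edges (u , gu) (v , gv) (z , gz) u≢v | inj₂ e | inj₁ p with avoids gz p
  ...   | ν , c , e′ , c≢ = Tri-≡ refl (sym e) (sym e′)
            (Tri-colour (lab u v) (λ x → u≢v (lab-id (u , gu) (v , gv) x)) (c≢ ∘ sym))
  Tri-edges (u , gu) (v , gv) (z , gz) u≢v | inj₂ e | inj₂ e′ = Tri-≡ refl (sym e) (sym e′)
            (Tri-adjacent (lab u v) (λ x → u≢v (lab-id (u , gu) (v , gv) x))
              (refl , λ { eq → u≢v (code-injective u v (proj₁ (pair-injective _ _ _ _ (inf-injective eq)))) }))
    where
    inf-injective : ∀ {q r : ℕ} → _≡_ {A = Node {N} {C} ℕ} (inf q) (inf r) → q ≡ r
    inf-injective refl = refl

  Tri-top : ∀ (u v z : Point) → code (proj₁ u) ≤ℕ code (proj₁ z) → code (proj₁ v) ≤ℕ code (proj₁ z) →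
            Tri (lab (proj₁ u) (proj₁ v)) (lab (proj₁ u) (proj₁ z)) (lab (proj₁ v) (proj₁ z))
  Tri-top U@(u , _) V@(v , _) Z@(z , _) u≤z v≤z with ℕₚ.m≤n⇒m<n∨m≡n u≤z | ℕₚ.m≤n⇒m<n∨m≡n v≤z | em {u ≡ v}
  ... | _ | _ | yes refl = Tri-≡ (sym (lab-refl u)) refl refl (Tri-idˡ (lab u z))
  ... | inj₂ e | _ | no u≢v with code-injective u z e
  ...   | refl = Tri-≡ (lab-sym v u) (sym (lab-refl u)) refl (Tri-idᵐ (lab v u))
  Tri-top U@(u , _) V@(v , _) Z@(z , _) u≤z v≤z | inj₁ _ | inj₂ e | no u≢v with code-injective v z e
  ...   | refl = Tri-≡ refl refl (sym (lab-refl v)) (Tri-idʳ (lab u v))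
  Tri-top U@(u , _) V@(v , _) Z@(z , _) u≤z v≤z | inj₁ a | inj₁ b | no u≢v =
    Tri-≡ refl (sym (lab-< {u} {z} a)) (sym (lab-< {v} {z} b)) (Tri-edges U V Z u≢v)

  -- All triangles of the model are consistent: consider the point of largest code.
  Tri-lab : ∀ (u v w : Point) → Tri (lab (proj₁ u) (proj₁ v)) (lab (proj₁ u) (proj₁ w))
      (lab (proj₁ v) (proj₁ w))
  Tri-lab u v w with ℕₚ.≤-total (code (proj₁ u)) (code (proj₁ v)) | ℕₚ.≤-total (code (proj₁ v))
      (code (proj₁ w)) | ℕₚ.≤-total (code (proj₁ u)) (code (proj₁ w))
  ... | inj₁ u≤v | inj₁ v≤w | _        = Tri-top u v w (≤-trans u≤v v≤w) v≤w
  ... | inj₁ u≤v | inj₂ w≤v | _        = Tri-≡ refl refl (lab-sym (proj₁ w) (proj₁ v))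
          (Tri-swap₁₂ (lab (proj₁ u) (proj₁ w)) _ _ (Tri-top u w v u≤v w≤v))
  ... | inj₂ v≤u | _ | inj₁ u≤w        = Tri-top u v w u≤w (≤-trans v≤u u≤w)
  ... | inj₂ v≤u | _ | inj₂ w≤u        = Tri-≡ (lab-sym (proj₁ v) (proj₁ u)) (lab-sym (proj₁ w) (proj₁ u)) refl
          (Tri-swap₂₃ (lab (proj₁ v) (proj₁ u)) _ _
              (Tri-swap₁₂ (lab (proj₁ v) (proj₁ w)) _ _ (Tri-top v w u v≤u w≤u)))

  colour : L → Fin C
  colour (at _ d) = d
  colour idₗ      = zero

  at-colour : ∀ l → l ≢ idₗ → ∃[ ν ] l ≡ at ν (colour l)
  at-colour idₗ      ne = contradiction refl ne
  at-colour (at ν c) ne = ν , refl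

  abstract
    -- One-point extension: consistent labels from fewer than C given points are
    -- realised by a point of the model.  The bound leaves a default colour free.
    realise : ∀ {d} → d < C → (s : Fin d → Point) (b : Fin d → L) →
              (∀ x y → Tri (lab (proj₁ (s x)) (proj₁ (s y))) (b x) (b y)) →
              Σ Point λ z → ∀ x → lab (proj₁ (s x)) (proj₁ z) ≡ b x
    realise {d} d<C s b tri with em {∃[ x ] b x ≡ idₗ}
    ... | yes (x , e) = s x , λ y → trans (lab-sym (proj₁ (s y)) (proj₁ (s x))) (from-id y)
      where
      from-id : ∀ y → lab (proj₁ (s x)) (proj₁ (s y)) ≡ b y
      from-id y = Tri-idᵐ⁻¹ _ _ (Tri-≡ refl e refl (tri x y))
    ... | no ¬id = z , λ x → trans (lab-< {proj₁ (s x)} {zr} (parent< zr (listed x))) (edge-is x)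
      where
      colours : List (Fin C)
      colours = List.tabulate (colour ∘ b)
      avoided : ∃[ c ] c ∉ colours
      avoided = missing em colours (subst (_< C) (sym (Listₚ.length-tabulate (colour ∘ b))) d<C)
      -- The new request, which is good by av and cons.
      zr : Request
      zr = proj₁ avoided , List.tabulate (λ x → code (proj₁ (s x)) , b x)
      listed : ∀ x → (code (proj₁ (s x)) , b x) ∈ proj₂ zr
      listed x = ∈-tabulate⁺ {f = λ x → code (proj₁ (s x)) , b x} x
      unlist : ∀ {k l} → (k , l) ∈ proj₂ zr → ∃[ x ] (k ≡ code (proj₁ (s x)) × l ≡ b x)
      unlist p with ∈-tabulate⁻ p
      ... | x , e = x , cong proj₁ e , cong proj₂ e
      av : ∀ {k l} → (k , l) ∈ proj₂ zr → ∃[ ν ] ∃[ c ] (l ≡ at ν c × c ≢ proj₁ zr)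
      av p with unlist p
      ... | x , _ , refl with at-colour (b x) (λ e → ¬id (x , e))
      ...   | ν , e = ν , colour (b x) , e ,
              λ c≡ → proj₂ avoided (subst (_∈ colours) c≡ (∈-tabulate⁺ {f = colour ∘ b} x))
      cons : ∀ u w {l l′} → (code u , l) ∈ proj₂ zr → (code w , l′) ∈ proj₂ zr → Tri (lab u w) l l′
      cons u w p q with unlist p | unlist q
      ... | x , e , refl | y , e′ , refl with code-injective u (proj₁ (s x)) e | code-injective w
            (proj₁ (s y)) e′
      ...   | refl | refl = tri x y
      z : Point
      z = zr , record { avoids = av ; consistent = cons }
      edge-is : ∀ x → edge (code (proj₁ (s x))) zr ≡ b x
      edge-is x with unlist (edge-listed zr (listed x))
      ... | y , e , e′ with code-injective (proj₁ (s x)) (proj₁ (s y)) e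
      ...   | q = trans e′ (sym
          (Tri-≡ (trans (cong (λ u → lab u (proj₁ (s y))) q) (lab-refl (proj₁ (s y)))) refl refl (tri x y)))

-- The relation algebra of all sets of labels

true-ext : ∀ {x y : Bool} → (x ≡ true ⇔ y ≡ true) → x ≡ y
true-ext {true}  {true}  e = refl
true-ext {true}  {false} e = sym (to e refl)
true-ext {false} {true}  e = from e refl
true-ext {false} {false} e = refl

∨-true : ∀ {x y} → x ∨ᵇ y ≡ true ⇔ (x ≡ true ⊎ y ≡ true)
∨-true {true}  = mk⇔ inj₁ (λ _ → refl)
∨-true {false} = mk⇔ inj₂ [ (λ ()) , id ]

∧-true : ∀ {x y} → x ∧ᵇ y ≡ true ⇔ (x ≡ true × y ≡ true)
∧-true {true}  = mk⇔ (refl ,_) proj₂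
∧-true {false} = mk⇔ (λ ()) (λ ())

not-true : ∀ {x} → not x ≡ true ⇔ (¬ x ≡ true)
not-true {true}  = mk⇔ (λ ()) (λ f → contradiction refl f)
not-true {false} = mk⇔ (λ _ ()) (λ _ → refl)

module Monk (em : ExcludedMiddle 0ℓ) {N C₀ : ℕ} (2<C : 2 < suc C₀) where

  private
    C = suc C₀

  -- The atoms.
  A : Set
  A = Label {N} {C} ⊥

  abstract
    -- Truth values of propositions, by excluded middle.
    ⌊_⌋ : Set → Bool
    ⌊ P ⌋ = does (em {P})

    ⌊⌋-true : ∀ {P} → ⌊ P ⌋ ≡ true ⇔ P
    ⌊⌋-true {P} with em {P}
    ... | yes p = both refl p
    ... | no ¬p = neither (λ ()) ¬p

  Composes : (A → Bool) → (A → Bool) → A → Set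
  Composes x y a = ∃[ b ] ∃[ c ] (x b ≡ true × y c ≡ true × Tri b c a)

  -- The complex algebra of the labels; subsets are given by characteristic
  -- functions, so that the carrier is small.  Converse is the identity.
  monk : Algebra RAOp 0ℓ 0ℓ
  monk = record
    { Carrier       = A → Bool
    ; _≈_           = λ x y → ∀ a → x a ≡ y a
    ; isEquivalence = record { refl = λ _ → refl ; sym = λ p a → sym (p a) ; trans =
          λ p q a → trans (p a) (q a) }
    ; _∨_           = λ x y a → x a ∨ᵇ y a
    ; _∧_           = λ x y a → x a ∧ᵇ y a
    ; -_            = λ x a → not (x a)
    ; 𝟙             = λ _ → true
    ; 𝟘             = λ _ → false
    ; op            = rel-op
    ; ∨-cong        = λ p q a → cong₂ _∨ᵇ_ (p a) (q a)
    ; ∧-cong        = λ p q a → cong₂ _∧ᵇ_ (p a) (q a)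
    ; -‿cong        = λ p a → cong not (p a)
    ; op-cong       = rel-cong
    }
    module monk-ops where
    rel-op : ∀ {k} → RAOp k → Vec (A → Bool) k → A → Bool
    rel-op ident []           a = ⌊ a ≡ idₗ ⌋
    rel-op conv  (x ∷ [])     a = x a
    rel-op comp  (x ∷ y ∷ []) a = ⌊ Composes x y a ⌋
    rel-cong : ∀ {k} (Ω : RAOp k) {xs ys : Vec (A → Bool) k} →
               Pointwise (λ x y → ∀ a → x a ≡ y a) xs ys → ∀ a → rel-op Ω xs a ≡ rel-op Ω ys a
    rel-cong ident []           a = refl
    rel-cong conv  (p ∷ [])     a = p a
    rel-cong comp  (p ∷ q ∷ []) a = true-ext (⇔-trans ⌊⌋-true (⇔-trans
      (mk⇔ (λ (b , c , u , v , t) → b , c , trans (sym (p b)) u , trans (sym (q c)) v , t)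
           (λ (b , c , u , v , t) → b , c , trans (p b) u , trans (q c) v , t)) (⇔-sym ⌊⌋-true)))

  open Algebra monk public hiding (setoid; refl; sym; trans; op; isEquivalence; op-cong; reflexive)
  open RAOperations monk public

  ≈-intro : ∀ {x y} → (∀ a → x a ≡ true ⇔ y a ≡ true) → x ≈ y
  ≈-intro f a = true-ext (f a)

  ≤⇔ : ∀ {x y} → x ≤ y ⇔ (∀ a → x a ≡ true → y a ≡ true)
  ≤⇔ {x} {y} = mk⇔ (λ e a xa → proj₂ (to ∧-true (trans (e a) xa)))
                   (λ f a → true-ext (mk⇔ (proj₁ ∘ to ∧-true) (λ xa → from ∧-true (xa , f a xa))))

  comp⇔ : ∀ {x y a} → (x ⨾ y) a ≡ true ⇔ Composes x y a
  comp⇔ = ⌊⌋-true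

  ident⇔ : ∀ {a} → 1′ a ≡ true ⇔ a ≡ idₗ
  ident⇔ = ⌊⌋-true

  isBooleanAlgebra : IsBooleanAlgebra _≈_ _∨_ _∧_ -_ 𝟙 𝟘
  isBooleanAlgebra = record
    { isDistributiveLattice = record
      { isLattice = record
        { isEquivalence = Algebra.isEquivalence monk
        ; ∨-comm = λ x y a → Bₚ.∨-comm (x a) (y a)
        ; ∨-assoc = λ x y z a → Bₚ.∨-assoc (x a) (y a) (z a)
        ; ∨-cong = ∨-cong
        ; ∧-comm = λ x y a → Bₚ.∧-comm (x a) (y a)
        ; ∧-assoc = λ x y z a → Bₚ.∧-assoc (x a) (y a) (z a)
        ; ∧-cong = ∧-cong
        ; absorptive = (λ x y a → proj₁ Bₚ.∨-∧-absorptive (x a) (y a)) ,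
              (λ x y a → proj₂ Bₚ.∨-∧-absorptive (x a) (y a))
        }
      ; ∨-distrib-∧ = (λ x y z a → proj₁ Bₚ.∨-distrib-∧ (x a) (y a) (z a)) ,
            (λ x y z a → proj₂ Bₚ.∨-distrib-∧ (x a) (y a) (z a))
      ; ∧-distrib-∨ = (λ x y z a → proj₁ Bₚ.∧-distrib-∨ (x a) (y a) (z a)) ,
            (λ x y z a → proj₂ Bₚ.∧-distrib-∨ (x a) (y a) (z a))
      }
    ; ∨-complement = (λ x a → Bₚ.∨-inverseˡ (x a)) , (λ x a → Bₚ.∨-inverseʳ (x a))
    ; ∧-complement = (λ x a → Bₚ.∧-inverseˡ (x a)) , (λ x a → Bₚ.∧-inverseʳ (x a))
    ; ¬-cong = -‿cong
    }

  private
    colour : A → Fin C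
    colour (at _ c) = c
    colour idₗ      = zero

  -- Associativity on atoms: given a quadrangle with sides a, b, c, d and
  -- diagonal e, the other diagonal e′ exists.  If no side is the identity, any e′ will
  -- do whose colour differs from those of a and b; this needs three colours.
  rotate : ∀ a b c d e → Tri a b e → Tri e c d → ∃[ e′ ] (Tri b c e′ × Tri a e′ d)
  rotate idₗ b c d e t u = d , subst (λ z → Tri z c d) (sym t) u , Tri-idˡ d
  rotate a@(at _ _) idₗ c d e t u = c , Tri-idˡ c , subst (λ z → Tri z c d) (sym (Tri-idᵐ⁻¹ a e t)) u
  rotate a@(at _ _) b@(at _ _) idₗ d e t u = b , Tri-idᵐ b , subst (λ z → Tri a b z) (Tri-idᵐ⁻¹ e d u) t
  rotate a@(at _ _) b@(at _ _) c@(at _ _) idₗ e t u =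
    a , Tri-swap₂₃ b a c (Tri-swap₁₂ a b c (subst (λ z → Tri a b z) (Tri-idʳ⁻¹ e c u) t)) , Tri-idʳ a
  rotate (at α c₁) (at β c₂) (at γ c₃) (at δ c₄) e t u with missing em (c₁ ∷ c₂ ∷ []) 2<C
  ... | f , f∉ = at (fin 0 (pos α)) f ,
      (λ e₁ e₂ → contradiction (there (here (sym (trans e₁ e₂)))) f∉) ,
      (λ e₁ e₂ → contradiction (here (sym e₁)) f∉)
    where
    pos : Node ⊥ → Fin N
    pos (fin m p) = p

  isRelationAlgebra : IsRelationAlgebra monk
  isRelationAlgebra = record
    { isBooleanAlgebra = isBooleanAlgebra
    ; ⨾-assoc     = λ x y z → ≈-intro λ a → mk⇔ (assocʳ x y z a) (assocˡ x y z a)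
    ; ⨾-∨         = λ x y z → ≈-intro λ a → mk⇔
        (λ p → distribute x y z a (to comp⇔ p))
        (λ p → from comp⇔ ([ (λ q → widen (λ _ r → from ∨-true (inj₁ r)) (to comp⇔ q)) ,
            (λ q → widen (λ _ r → from ∨-true (inj₂ r)) (to comp⇔ q)) ] (to (∨-true {(x ⨾ z) a}) p)))
    ; ⨾-identityʳ = λ x → ≈-intro λ a → mk⇔ (identity x a ∘ to comp⇔)
        (λ xa → from comp⇔ (a , idₗ , xa , from ident⇔ refl , Tri-idᵐ a))
    ; ˘-invol     = λ x a → refl
    ; ˘-∨         = λ x y a → refl
    ; ˘-⨾         = λ x y → ≈-intro λ a → mk⇔ (commute x y a) (commute y x a)
    ; ˘-⨾-neg     = λ x y → from ≤⇔ λ a p → from not-true (negate x y a (to comp⇔ p))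
    }
    where
    commute : ∀ x y a → (x ⨾ y) a ≡ true → (y ⨾ x) a ≡ true
    commute x y a p with to comp⇔ p
    ... | b , c , u , v , t = from comp⇔ (c , b , v , u , Tri-swap₁₂ b c a t)
    widen : ∀ {x x′ z : A → Bool} {a} → (∀ b → x b ≡ true → x′ b ≡ true) → Composes x z a → Composes x′ z a
    widen f (b , c , u , v , t) = b , c , f b u , v , t
    distribute : ∀ x y z a → Composes (x ∨ y) z a → ((x ⨾ z) ∨ (y ⨾ z)) a ≡ true
    distribute x y z a (b , c , u , v , t) with to (∨-true {x b}) u
    ... | inj₁ xb = from (∨-true {(x ⨾ z) a}) (inj₁ (from comp⇔ (b , c , xb , v , t)))
    ... | inj₂ yb = from (∨-true {(x ⨾ z) a}) (inj₂ (from comp⇔ (b , c , yb , v , t)))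
    identity : ∀ x a → Composes x 1′ a → x a ≡ true
    identity x a (b , c , u , v , t) with to ident⇔ v
    ... | refl = subst (λ z → x z ≡ true) (Tri-idᵐ⁻¹ b a t) u
    negate : ∀ x y a → Composes x (- (x ⨾ y)) a → ¬ y a ≡ true
    negate x y a (b , c , u , v , t) ya = to not-true v (from comp⇔ (b , a , u , ya , Tri-swap₂₃ b c a t))
    assocʳ : ∀ x y z a → ((x ⨾ y) ⨾ z) a ≡ true → (x ⨾ (y ⨾ z)) a ≡ true
    assocʳ x y z a p with to comp⇔ p
    ... | e , c , u , v , t with to comp⇔ u
    ... | b , d , w , q , r with rotate b d c a e r t
    ... | e′ , i , j = from comp⇔ (b , e′ , w , from comp⇔ (d , c , q , v , i) , j)
    assocˡ : ∀ x y z a → (x ⨾ (y ⨾ z)) a ≡ true → ((x ⨾ y) ⨾ z) a ≡ true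
    assocˡ x y z a p = commute z (x ⨾ y) a (cong-r (assocʳ z y x a (commute x (z ⨾ y) a (cong-r′ p))))
      where
      cong-r : (z ⨾ (y ⨾ x)) a ≡ true → (z ⨾ (x ⨾ y)) a ≡ true
      cong-r q with to comp⇔ q
      ... | b , c , u , v , t = from comp⇔ (b , c , u , commute y x c v , t)
      cong-r′ : (x ⨾ (y ⨾ z)) a ≡ true → (x ⨾ (z ⨾ y)) a ≡ true
      cong-r′ q with to comp⇔ q
      ... | b , c , u , v , t = from comp⇔ (b , c , u , commute y z c v , t)

  -- The atom of the algebra that corresponds to a label.
  ⟨_⟩ : A → A → Bool
  ⟨ a ⟩ b = ⌊ b ≡ a ⌋

  ⟨⟩⇔ : ∀ {a b} → ⟨ a ⟩ b ≡ true ⇔ b ≡ a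
  ⟨⟩⇔ = ⌊⌋-true

  inhabited : ∀ x → ¬ (x ≈ 𝟘) → ∃[ a ] x a ≡ true
  inhabited x ne with em {∃[ a ] x a ≡ true}
  ... | yes r = r
  ... | no ¬r = contradiction (≈-intro λ a → neither (λ p → ¬r (a , p)) (λ ())) ne

  ⟨⟩-atom : ∀ a → IsAtom ⟨ a ⟩
  ⟨⟩-atom a = (λ e → contradiction (trans (sym (e a)) (from ⟨⟩⇔ refl)) λ ()) , minimal
    where
    minimal : ∀ y → y ≤ ⟨ a ⟩ → y ≈ 𝟘 ⊎ y ≈ ⟨ a ⟩
    minimal y y≤ with em {y a ≡ true}
    ... | yes ya = inj₂ (≈-intro λ b → mk⇔ (to ≤⇔ y≤ b) λ p → subst (λ z → y z ≡ true) (sym (to ⟨⟩⇔ p)) ya)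
    ... | no ¬ya = inj₁ (≈-intro λ b →
          neither (λ yb → ¬ya (subst (λ z → y z ≡ true) (to ⟨⟩⇔ (to ≤⇔ y≤ b yb)) yb)) (λ ()))

  abstract
    -- The label that corresponds to an atom of the algebra.
    label : Atom → A
    label (x , nz , _) = proj₁ (inhabited x nz)

    label⇔ : ∀ (x : Atom) {a} → proj₁ x a ≡ true ⇔ a ≡ label x
    label⇔ (x , nz , least) {a} = mk⇔ only (λ { refl → proj₂ (inhabited x nz) })
      where
      b : A
      b = proj₁ (inhabited x nz)
      only : x a ≡ true → a ≡ b
      only xa with least ⟨ b ⟩ (from ≤⇔ λ c p →
          subst (λ z → x z ≡ true) (sym (to ⟨⟩⇔ p)) (proj₂ (inhabited x nz)))
      ... | inj₁ e = contradiction (trans (sym (e b)) (from ⟨⟩⇔ refl)) λ ()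
      ... | inj₂ e = to ⟨⟩⇔ (trans (e a) xa)

  label-⟨⟩ : ∀ a → label (⟨ a ⟩ , ⟨⟩-atom a) ≡ a
  label-⟨⟩ a = sym (to (label⇔ (⟨ a ⟩ , ⟨⟩-atom a)) (from ⟨⟩⇔ refl))

  label-≈ : ∀ (x y : Atom) → (proj₁ x ≈ proj₁ y) ⇔ (label x ≡ label y)
  label-≈ x y = mk⇔ (λ e → to (label⇔ y) (trans (sym (e _)) (from (label⇔ x) refl)))
    λ e → ≈-intro λ a → mk⇔ (λ p → from (label⇔ y) (trans (to (label⇔ x) p) e))
        (λ p → from (label⇔ x) (trans (to (label⇔ y) p) (sym e)))

  isAtomic : IsAtomic
  isAtomic x nz with inhabited x nz
  ... | a , xa = ⟨ a ⟩ , ⟨⟩-atom a , from ≤⇔ λ b p → subst (λ z → x z ≡ true) (sym (to ⟨⟩⇔ p)) xa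

  atom-≤⇔ : ∀ (x : Atom) {y} → proj₁ x ≤ y ⇔ y (label x) ≡ true
  atom-≤⇔ x {y} = mk⇔ (λ p → to ≤⇔ p _ (from (label⇔ x) refl))
    (λ p → from ≤⇔ λ a q → subst (λ z → y z ≡ true) (sym (to (label⇔ x) q)) p)

  atom-comp⇔ : ∀ (x y z : Atom) → proj₁ z ≤ proj₁ x ⨾ proj₁ y ⇔ Tri (label x) (label y) (label z)
  atom-comp⇔ x y z = ⇔-trans (atom-≤⇔ z) (⇔-trans comp⇔ (mk⇔
    (λ (b , c , p , q , t) → subst₂ (λ b c → Tri b c _) (to (label⇔ x) p) (to (label⇔ y) q) t)
    (λ t → _ , _ , from (label⇔ x) refl , from (label⇔ y) refl , t)))

  atom-ident⇔ : ∀ (x : Atom) → proj₁ x ≤ 1′ ⇔ label x ≡ idₗ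
  atom-ident⇔ x = ⇔-trans (atom-≤⇔ x) ident⇔

-- Nets and their extensions

-- Replacing the i-th entry of a tuple.
_[_≔_] : ∀ {X : Set} {n} → (Fin n → X) → Fin n → X → Fin n → X
s [ i ≔ z ] = updateAt s i (const z)

≔-same : ∀ {X : Set} {n} (s : Fin n → X) i {z} → (s [ i ≔ z ]) i ≡ z
≔-same s i = updateAt-updates i s

≔-other : ∀ {X : Set} {n} (s : Fin n → X) i {z} j → j ≢ i → (s [ i ≔ z ]) j ≡ s j
≔-other s i j j≢i = updateAt-minimal j i s j≢i

replace-same : ∀ {n} (i j : Fin n) → [ i ∣ j ] i ≡ j
replace-same i j = updateAt-updates i id

replace-other : ∀ {n} (i j k : Fin n) → k ≢ i → [ i ∣ j ] k ≡ k
replace-other i j k k≢i = updateAt-minimal k i id k≢i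

module _ {N C : ℕ} where

  -- A net is a consistent matrix of labels.  Over the original graph, nets are the
  -- basic matrices, without the detour through atoms of the algebra.
  record IsNet {I : Set} {d} (f : Fin d → Fin d → Label {N} {C} I) : Set where
    field
      net-id  : ∀ x → f x x ≡ idₗ
      net-sym : ∀ x y → f x y ≡ f y x
      net-tri : ∀ x y z → Tri (f x y) (f x z) (f y z)
  open IsNet public

  net-∘ : ∀ {I d d′} {f : Fin d → Fin d → Label {N} {C} I} → IsNet f →
      (σ : Fin d′ → Fin d) → IsNet (λ x y → f (σ x) (σ y))
  net-∘ nf σ = record { net-id = λ x → net-id nf (σ x) ; net-sym = λ x y → net-sym nf (σ x) (σ y)
                      ; net-tri = λ x y z → net-tri nf (σ x) (σ y) (σ z) }

  _~⟨_⟩_ : ∀ {I J : Set} {d} → (Fin d → Fin d → Label {N} {C} I) → ℕ → (Fin d → Fin d → Label {N} {C} J) → Set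
  f ~⟨ K ⟩ g = Similar K (uncurry f) (uncurry g)

  similar-net : ∀ {I J : Set} {d K} {f : Fin d → Fin d → Label {N} {C} I} {g : Fin d → Fin d → Label {N} {C} J}
      →
                f ~⟨ K ⟩ g → IsNet f → IsNet g
  similar-net {K = K} {f} {g} (mt , cp) nf = record
    { net-id  = λ x → Match-id {K = K} (mt (x , x)) (net-id nf x)
    ; net-sym = λ x y → to (Compat-≡ (colour x y) (colour y x) (cp (x , y) (y , x))) (net-sym nf x y)
    ; net-tri = λ x y z → Tri-transfer (colour x y) (colour x z) (colour y z)
        (cp (x , y) (x , z)) (cp (x , y) (y , z)) (cp (x , z) (y , z)) (net-tri nf x y z)
    }
    where
    colour : ∀ x y → colourOf (f x y) ≡ colourOf (g x y)
    colour x y = proj₁ (mt (x , y))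

  ι-net : ∀ {I : Set} {d} {f : Fin d → Fin d → Label ⊥} → IsNet f → IsNet {I = I} (λ x y → ι (f x y))
  ι-net {I} {f = f} nf = record
    { net-id = λ x → cong ι (net-id nf x) ; net-sym = λ x y → cong ι (net-sym nf x y)
    ; net-tri = λ x y z → Tri-ι (f x y) (f x z) (f y z) (net-tri nf x y z) }

module Nets (em : ExcludedMiddle 0ℓ) {N₀ C₀ n : ℕ}
            (fits : n * n + n ≤ℕ suc N₀) (n<C : n < suc C₀) (2<n : 2 < n) where

  private
    N = suc N₀
    C = suc C₀
  open Model em {N} {C₀} public

  Matrix : Set → Set
  Matrix I = Fin n → Fin n → Label {N} {C} I

  third : ∀ (x y : Fin n) → ∃[ w ] (w ≢ x × w ≢ y)
  third x y with missing em (x ∷ y ∷ []) 2<n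
  ... | w , w∉ = w , (λ e → w∉ (here e)) , (λ e → w∉ (there (here e)))

  abstract
    -- The back-and-forth property of similarity, over any two graphs: if s is
    -- similar to f, and t is a net that agrees with s off i, then some g agrees with
    -- f off i and is similar to t.  The n * n entries of s and the n new labels
    -- t x i fit into the finite cliques.
    extend-net : ∀ {I J K} → Fresh J → {s t : Matrix I} {f : Matrix J} → s ~⟨ K ⟩ f → IsNet t →
                 ∀ i → (∀ x y → x ≢ i → y ≢ i → s x y ≡ t x y) →
                 Σ (Matrix J) λ g → IsNet g × (∀ x y → x ≢ i → y ≢ i → f x y ≡ g x y) × t ~⟨ K ⟩ g
    extend-net {I} {J} {K} freshJ {s} {t} {f} (mt , cp) nt i s≡t =
      build (extend L (subst (λ k → k + n ≤ℕ N) (sym (Listₚ.length-tabulate {n = n * n} (F ∘ remQuot n))) fits)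
          linked (λ x → t x i))
      where
      open Extension em {N₀} {C} {I} {J} freshJ
      F : Fin n × Fin n → Label {N} {C} I × Label {N} {C} J
      F (x , y) = s x y , f x y
      L : List (Label {N} {C} I × Label {N} {C} J)
      L = List.tabulate {n = n * n} (F ∘ remQuot n)
      F∈L : ∀ x y → F (x , y) ∈ L
      F∈L x y = subst (λ p → F p ∈ L) (remQuot-combine x y) (∈-tabulate⁺ {f = F ∘ remQuot n} (combine x y))
      F-of : ∀ {p} → p ∈ L → ∃[ q ] p ≡ F q
      F-of p∈ with ∈-tabulate⁻ {f = F ∘ remQuot n} p∈
      ... | k , e = remQuot n k , e
      linked : Linked K L
      linked = match , compat
        where
        match : ∀ {p} → p ∈ L → Match K p
        match p∈ with F-of p∈
        ... | q , refl = mt q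
        compat : ∀ {p q} → p ∈ L → q ∈ L → Compat p q
        compat p∈ q∈ with F-of p∈ | F-of q∈
        ... | p , refl | q , refl = cp p q
      build : (Σ (Fin n → Label {N} {C} J) λ e → Σ (List (Label {N} {C} I × Label {N} {C} J)) λ L′ →
          Linked K L′ ×
                 (∀ {p} → p ∈ L → p ∈ L′) × (∀ x → (t x i , e x) ∈ L′)) →
              Σ (Matrix J) λ g → IsNet g × (∀ x y → x ≢ i → y ≢ i → f x y ≡ g x y) × t ~⟨ K ⟩ g
      build (e , L′ , linked′ , L⊆L′ , e∈) = g , similar-net t~g nt , off , t~g
        where
        g : Matrix J
        g x y with y ≟ i | x ≟ i
        ... | yes _ | _     = e x
        ... | no _  | yes _ = e y
        ... | no _  | no _  = f x y
        off : ∀ x y → x ≢ i → y ≢ i → f x y ≡ g x y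
        off x y x≢i y≢i with y ≟ i | x ≟ i
        ... | yes p | _     = contradiction p y≢i
        ... | no _  | yes p = contradiction p x≢i
        ... | no _  | no _  = refl
        in-L′ : ∀ x y → (t x y , g x y) ∈ L′
        in-L′ x y with y ≟ i | x ≟ i
        ... | yes refl | _     = e∈ x
        ... | no _  | yes refl = subst (λ l → (l , e y) ∈ L′) (net-sym nt y i) (e∈ y)
        ... | no q  | no p  = subst (λ l → (l , f x y) ∈ L′) (s≡t x y p q) (L⊆L′ (F∈L x y))
        t~g : t ~⟨ K ⟩ g
        t~g = (λ (x , y) → proj₁ linked′ (in-L′ x y)) ,
            λ (x , y) (v , w) → proj₂ linked′ (in-L′ x y) (in-L′ v w)

  -- The labels between the points of a tuple.
  netOf : ∀ {d} → (Fin d → Point) → Fin d → Fin d → Label {N} {C} ℕ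
  netOf s x y = lab (proj₁ (s x)) (proj₁ (s y))

  netOf-net : ∀ {d} (s : Fin d → Point) → IsNet (netOf s)
  netOf-net s = record
    { net-id = λ x → lab-refl _ ; net-sym = λ x y → lab-sym _ _ ; net-tri =
          λ x y z → Tri-lab (s x) (s y) (s z) }

  abstract
    -- From nets to tuples of points, and back.
    forth : ∀ {K} {f g : Matrix ⊥} → IsNet g → ∀ i → (∀ x y → x ≢ i → y ≢ i → f x y ≡ g x y) →
            (s : Fin n → Point) → f ~⟨ K ⟩ netOf s →
            Σ Point λ z → g ~⟨ K ⟩ netOf (s [ i ≔ z ])
    forth {K} {f} {g} ng i f≡g s f~s with extend-net fresh-ℕ f~s ng i f≡g | third i i
    ... | T , nT , s≡T , g~T | j , j≢i , _ = z , Similar-trans g~T (Similar-≡ (λ (x , y) → T≡ x y))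
      where
      -- The unwanted coordinate i of s is ignored by copying coordinate j over it.
      σ : Fin n → Fin n
      σ = [ i ∣ j ]
      σ≢i : ∀ x → σ x ≢ i
      σ≢i x with x ≟ i
      ... | yes refl = subst (_≢ i) (sym (replace-same i j)) j≢i
      ... | no x≢i  = subst (_≢ i) (sym (replace-other i j x x≢i)) x≢i
      point : Σ Point λ z → ∀ x → lab (proj₁ (s (σ x))) (proj₁ z) ≡ T (σ x) i
      point = realise n<C (s ∘ σ) (λ x → T (σ x) i)
        (λ x y → Tri-≡ (sym (s≡T (σ x) (σ y) (σ≢i x) (σ≢i y))) refl refl (net-tri nT (σ x) (σ y) i))
      z : Point
      z = proj₁ point
      t : Fin n → Point
      t = s [ i ≔ z ]
      T-i : ∀ x → x ≢ i → lab (proj₁ (s x)) (proj₁ z) ≡ T x i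
      T-i x x≢i = subst (λ w → lab (proj₁ (s w)) (proj₁ z) ≡ T w i) (replace-other i j x x≢i) (proj₂ point x)
      T≡ : ∀ x y → T x y ≡ netOf t x y
      T≡ x y with x ≟ i | y ≟ i
      ... | yes refl | yes refl = trans (net-id nT x) (sym (lab-refl (proj₁ (t x))))
      ... | no p | yes refl = trans (sym (T-i x p))
            (cong₂ (λ u v → lab (proj₁ u) (proj₁ v)) (sym (≔-other s i x p)) (sym (≔-same s i)))
      ... | yes refl | no q = trans (net-sym nT x y) (trans (sym (T-i y q)) (trans (lab-sym _ _)
              (cong₂ (λ u v → lab (proj₁ u) (proj₁ v)) (sym (≔-same s i)) (sym (≔-other s i y q)))))
      ... | no p | no q = trans (sym (s≡T x y p q))
            (cong₂ (λ u v → lab (proj₁ u) (proj₁ v)) (sym (≔-other s i x p)) (sym (≔-other s i y q)))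

    back : ∀ {K} {f : Matrix ⊥} (s t : Fin n → Point) i → (∀ x → x ≢ i → proj₁ (s x) ≡ proj₁ (t x)) →
           netOf s ~⟨ K ⟩ f → Σ (Matrix ⊥) λ g → IsNet g × (∀ x y → x ≢ i → y ≢ i → f x y ≡ g x y) ×
               netOf t ~⟨ K ⟩ g
    back s t i s≡t s~f = extend-net fresh-⊥ s~f (netOf-net t) i λ x y x≢i y≢i →
        cong₂ lab (s≡t x x≢i) (s≡t y y≢i)

    -- Every net is realised by a tuple of points.
    realise-net : ∀ {d} → d < C → {f : Fin d → Fin d → Label {N} {C} ℕ} → IsNet f →
                  Σ (Fin d → Point) λ s → ∀ x y → netOf s x y ≡ f x y
    realise-net {zero}  _   nf = (λ ()) , λ ()
    realise-net {suc d} d<C {f} nf with realise-net {d} (<⇒≤ d<C) (net-∘ nf suc)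
    ... | s , s≡ with realise (<⇒≤ d<C) s (λ x → f (suc x) zero)
                       (λ x y → Tri-≡ (sym (s≡ x y)) refl refl (net-tri nf (suc x) (suc y) zero))
    ... | z , z≡ = (λ { zero → z ; (suc x) → s x }) , λ
      { zero zero → trans (lab-refl (proj₁ z)) (sym (net-id nf zero))
      ; zero (suc y) → trans (lab-sym _ _) (trans (z≡ y) (net-sym nf (suc y) zero))
      ; (suc x) zero → z≡ x
      ; (suc x) (suc y) → s≡ x y }

    -- A point z added to a tuple that realises f is pulled back to an extension g of
    -- f.  Taking K beyond the prescribed labels b keeps those among them that z has.
    pull : {f : Matrix ⊥} (s : Fin n → Point) → (∀ x y → netOf s x y ≡ ι (f x y)) →
           ∀ i (z : Point) (b : Fin n → Label {N} {C} ⊥) →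
           Σ (Matrix ⊥) λ g → IsNet g × (∀ x y → x ≢ i → y ≢ i → f x y ≡ g x y) ×
             (∀ x → x ≢ i → lab (proj₁ (s x)) (proj₁ z) ≡ ι (b x) → g x i ≡ b x)
    pull {f} s s≡ i z b with near-bound b
    ... | K , near with back {K} {f} s (s [ i ≔ z ]) i
                          (λ x x≢i → cong proj₁ (sym (≔-other s i x x≢i)))
                          (Similar-trans (Similar-≡ (λ (x , y) → s≡ x y)) (Similar-ι (uncurry f)))
    ... | g , ng , f≡g , t~g = g , ng , f≡g , λ x x≢i e →
      Match-near (b x) (g x i) (near x)
        (subst (λ l → Match K (l , g x i))
          (trans (cong₂ (λ u v → lab (proj₁ u) (proj₁ v)) (≔-other s i x x≢i) (≔-same s i)) e)
          (proj₁ t~g (x , i)))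

    net-witness : {f : Matrix ⊥} → IsNet f → ∀ a b x y z → z ≢ x → z ≢ y → Tri a b (f x y) →
                  Σ (Matrix ⊥) λ g → IsNet g × (∀ v w → v ≢ z → w ≢ z → f v w ≡ g v w) × g x z ≡ a × g z y ≡ b
    net-witness {f} nf a b x y z z≢x z≢y t = glue (pull s (proj₂ s-net) z q c)
      where
      s-net : Σ (Fin n → Point) λ s → ∀ x y → netOf s x y ≡ ι (f x y)
      s-net = realise-net n<C (ι-net nf)
      s : Fin n → Point
      s = proj₁ s-net
      xy : Fin 2 → Fin n
      xy zero       = x
      xy (suc zero) = y
      ab : Fin 2 → Label {N} {C} ⊥
      ab zero       = a
      ab (suc zero) = b
      ab-tri : ∀ u v → Tri (f (xy u) (xy v)) (ab u) (ab v)
      ab-tri zero zero = Tri-≡⊥ (sym (net-id nf x)) (Tri-idˡ a)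
        where
        Tri-≡⊥ : ∀ {l l′ : Label {N} {C} ⊥} → l ≡ l′ → Tri l a a → Tri l′ a a
        Tri-≡⊥ refl t = t
      ab-tri (suc zero) (suc zero) = subst (λ l → Tri l b b) (sym (net-id nf y)) (Tri-idˡ b)
      ab-tri zero (suc zero) = Tri-swap₁₂ a (f x y) b (Tri-swap₂₃ a b (f x y) t)
      ab-tri (suc zero) zero = subst (λ l → Tri l b a) (net-sym nf x y)
        (Tri-swap₂₃ (f x y) a b (Tri-swap₁₂ a (f x y) b (Tri-swap₂₃ a b (f x y) t)))
      point : Σ Point λ q → ∀ u → lab (proj₁ (s (xy u))) (proj₁ q) ≡ ι (ab u)
      point = realise (≤-trans 2<n (<⇒≤ n<C)) (s ∘ xy) (λ u → ι (ab u)) (λ u v →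
        Tri-≡ (sym (proj₂ s-net (xy u) (xy v))) refl refl (Tri-ι (f (xy u) (xy v)) (ab u) (ab v) (ab-tri u v)))
      q : Point
      q = proj₁ point
      c : Fin n → Label {N} {C} ⊥
      c w with w ≟ x
      ... | yes _ = a
      ... | no _  = b
      cx : c x ≡ a
      cx with x ≟ x
      ... | yes _ = refl
      ... | no p  = contradiction refl p
      cy : c y ≡ b
      cy with y ≟ x
      ... | yes refl = Tri-idʳ⁻¹ a b (subst (Tri a b) (net-id nf x) t)
      ... | no p  = refl
      glue : (Σ (Matrix ⊥) λ g → IsNet g × (∀ v w → v ≢ z → w ≢ z → f v w ≡ g v w) ×
                (∀ w → w ≢ z → lab (proj₁ (s w)) (proj₁ q) ≡ ι (c w) → g w z ≡ c w)) →
             Σ (Matrix ⊥) λ g → IsNet g × (∀ v w → v ≢ z → w ≢ z → f v w ≡ g v w) × g x z ≡ a × g z y ≡ b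
      glue (g , ng , f≡g , g-pulled) = g , ng , f≡g ,
        trans (g-pulled x (z≢x ∘ sym) (trans (proj₂ point zero) (cong ι (sym cx)))) cx ,
        trans (net-sym ng z y) (trans
            (g-pulled y (z≢y ∘ sym) (trans (proj₂ point (suc zero)) (cong ι (sym cy)))) cy)

    net-amalgam : {f g : Matrix ⊥} → IsNet f → IsNet g → ∀ x y →
                  (∀ v w → v ≢ x → v ≢ y → w ≢ x → w ≢ y → f v w ≡ g v w) →
                  Σ (Matrix ⊥) λ h → IsNet h × (∀ v w → v ≢ x → w ≢ x → f v w ≡ h v w) ×
                                               (∀ v w → v ≢ y → w ≢ y → g v w ≡ h v w)
    net-amalgam {f} {g} nf ng x y f≡g with x ≟ y
    ... | yes refl = f , nf , (λ _ _ _ _ → refl) , λ v w p q → sym (f≡g v w p p q q)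
    ... | no x≢y = glue (pull s (proj₂ s-net) x (proj₁ point) (λ w → g w x))
      where
      s-net : Σ (Fin n → Point) λ s → ∀ x y → netOf s x y ≡ ι (f x y)
      s-net = realise-net n<C (ι-net nf)
      s : Fin n → Point
      s = proj₁ s-net
      w₀ : Fin n
      w₀ = proj₁ (third x y)
      -- Both coordinates x and y are ignored: they become copies of a third one.  Then
      -- the labels of g to x are consistent with f on the remaining coordinates.
      σ : Fin n → Fin n
      σ w with w ≟ x | w ≟ y
      ... | no _ | no _ = w
      ... | _    | _    = w₀
      σ≢ : ∀ w → σ w ≢ x × σ w ≢ y
      σ≢ w with w ≟ x | w ≟ y
      ... | no p | no q = p , q
      ... | no p | yes _ = proj₂ (third x y)
      ... | yes _ | no _ = proj₂ (third x y)
      ... | yes _ | yes _ = proj₂ (third x y)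
      σ-id : ∀ w → w ≢ x → w ≢ y → σ w ≡ w
      σ-id w p q with w ≟ x | w ≟ y
      ... | no _ | no _ = refl
      ... | yes e | _ = contradiction e p
      ... | no _ | yes e = contradiction e q
      point : Σ Point λ q → ∀ w → lab (proj₁ (s (σ w))) (proj₁ q) ≡ ι (g (σ w) x)
      point = realise n<C (s ∘ σ) (λ w → ι (g (σ w) x)) (λ v w → Tri-≡
        (trans (cong ι (sym (f≡g (σ v) (σ w) (proj₁ (σ≢ v)) (proj₂ (σ≢ v)) (proj₁ (σ≢ w)) (proj₂ (σ≢ w)))))
            (sym (proj₂ s-net (σ v) (σ w))))
        refl refl (Tri-ι (g (σ v) (σ w)) (g (σ v) x) (g (σ w) x) (net-tri ng (σ v) (σ w) x)))
      glue : (Σ (Matrix ⊥) λ h → IsNet h × (∀ v w → v ≢ x → w ≢ x → f v w ≡ h v w) ×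
                (∀ w → w ≢ x → lab (proj₁ (s w)) (proj₁ (proj₁ point)) ≡ ι (g w x) → h w x ≡ g w x)) →
             Σ (Matrix ⊥) λ h → IsNet h × (∀ v w → v ≢ x → w ≢ x → f v w ≡ h v w) ×
                                          (∀ v w → v ≢ y → w ≢ y → g v w ≡ h v w)
      glue (h , nh , f≡h , h-pulled) = h , nh , f≡h , g≡h
        where
        hx : ∀ w → w ≢ x → w ≢ y → h w x ≡ g w x
        hx w p q = h-pulled w p
          (subst (λ v → lab (proj₁ (s v)) (proj₁ (proj₁ point)) ≡ ι (g v x)) (σ-id w p q) (proj₂ point w))
        g≡h : ∀ v w → v ≢ y → w ≢ y → g v w ≡ h v w
        g≡h v w p q with v ≟ x | w ≟ x
        ... | yes refl | yes refl = trans (net-id ng v) (sym (net-id nh v))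
        ... | no a | yes refl = sym (hx v a p)
        ... | yes refl | no b = trans (net-sym ng v w) (trans (sym (hx w b q)) (net-sym nh w v))
        ... | no a | no b = trans (sym (f≡g v w a p b q)) (f≡h v w a b)

-- Power set algebras and complex algebras

module Powerset {ℓ} (em : ExcludedMiddle ℓ) where

  module _ {F : ℕ → Set} (S : Setoid ℓ ℓ)
           (op : ∀ {n} → F n → Vec (Subset S) n → Subset S)
           (op-cong : ∀ {n} (Ω : F n) {Xs Ys : Vec (Subset S) n} →
                      Pointwise (_≐ₛ_ {S = S}) Xs Ys → _≐ₛ_ {S = S} (op Ω Xs) (op Ω Ys)) where
    private
      P = powersetAlgebra S op op-cong
    open Algebra P using (_≈_; _∨_; _∧_; -_; 𝟙; 𝟘)

    powerset-isBooleanAlgebra : IsBooleanAlgebra _≈_ _∨_ _∧_ -_ 𝟙 𝟘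
    powerset-isBooleanAlgebra = record
      { isDistributiveLattice = record
        { isLattice = record
          { isEquivalence = Algebra.isEquivalence P
          ; ∨-comm = λ X Y → ∪-comm (proj₁ X) (proj₁ Y)
          ; ∨-assoc = λ X Y Z → ∪-assoc (proj₁ X) (proj₁ Y) (proj₁ Z)
          ; ∨-cong = λ {X} {X′} {Y} {Y′} → Algebra.∨-cong P {X} {X′} {Y} {Y′}
          ; ∧-comm = λ X Y → ∩-comm (proj₁ X) (proj₁ Y)
          ; ∧-assoc = λ X Y Z → ∩-assoc (proj₁ X) (proj₁ Y) (proj₁ Z)
          ; ∧-cong = λ {X} {X′} {Y} {Y′} → Algebra.∧-cong P {X} {X′} {Y} {Y′}
          ; absorptive = (λ X Y → proj₁ ∪-∩-absorptive (proj₁ X) (proj₁ Y)) ,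
                (λ X Y → proj₂ ∪-∩-absorptive (proj₁ X) (proj₁ Y))
          }
        ; ∨-distrib-∧ = (λ X Y Z → proj₁ ∪-distrib-∩ (proj₁ X) (proj₁ Y) (proj₁ Z)) ,
              (λ X Y Z → proj₂ ∪-distrib-∩ (proj₁ X) (proj₁ Y) (proj₁ Z))
        ; ∧-distrib-∨ = (λ X Y Z → proj₁ ∩-distrib-∪ (proj₁ X) (proj₁ Y) (proj₁ Z)) ,
              (λ X Y Z → proj₂ ∩-distrib-∪ (proj₁ X) (proj₁ Y) (proj₁ Z))
        }
      ; ∨-complement = (λ X → (λ _ → Unitₚ.tt) , λ _ → excluded-left X) ,
            (λ X → (λ _ → Unitₚ.tt) , λ _ → excluded X)
      ; ∧-complement = (λ X → (λ (p , q) → contradiction q p) , λ ()) ,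
            (λ X → (λ (p , q) → contradiction p q) , λ ())
      ; ¬-cong = λ {X} {Y} → Algebra.-‿cong P {X} {Y}
      }
      where
      excluded : ∀ (X : Subset S) {x} → proj₁ (X ∨ (- X)) x
      excluded X {x} with em {proj₁ X x}
      ... | yes p = inj₁ p
      ... | no ¬p = inj₂ ¬p
      excluded-left : ∀ (X : Subset S) {x} → proj₁ ((- X) ∨ X) x
      excluded-left X {x} with em {proj₁ X x}
      ... | yes p = inj₂ p
      ... | no ¬p = inj₁ ¬p

  module ComplexAlgebra {F : ℕ → Set} (S : AtomStructure F ℓ ℓ ℓ) where
    open AtomStructure S renaming (refl to ≈-refl; sym to ≈-sym; trans to ≈-trans)
    private
      module Cm = Algebra (Cm S)

    unary⇔ : ∀ (Ω : F 1) (X : Subset setoid) {x} →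
             proj₁ (Cm.op Ω (X ∷ [])) x ⇔ (∃[ y ] proj₁ X y × R Ω x (y ∷ []))
    unary⇔ Ω X = mk⇔ (λ { (y ∷ [] , y∈ , r) → y , y∈ zero , r })
                     (λ { (y , y∈ , r) → y ∷ [] , (λ { zero → y∈ }) , r })

    constant⇔ : ∀ (Ω : F 0) {x} → proj₁ (Cm.op Ω []) x ⇔ R Ω x []
    constant⇔ Ω = mk⇔ (λ { ([] , _ , r) → r }) (λ r → [] , (λ ()) , r)

    -- The singletons are exactly the atoms of the complex algebra.
    ｛_｝ : Carrier → Subset setoid
    ｛ x ｝ = (_≈ x) , λ y≈z y≈x → ≈-trans (≈-sym y≈z) y≈x

    singleton-atom : ∀ x → Cm.IsAtom ｛ x ｝
    singleton-atom x = (λ e → case-⊥ {x} (proj₁ e {x} ≈-refl)) , least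
      where
      case-⊥ : ∀ {w} → proj₁ Cm.𝟘 w → ⊥
      case-⊥ ()
      least : ∀ Y → Y Cm.≤ ｛ x ｝ → Y Cm.≈ Cm.𝟘 ⊎ Y Cm.≈ ｛ x ｝
      least Y Y≤ with em {proj₁ Y x}
      ... | yes Yx = inj₂ ((λ y∈ → proj₂ (proj₂ Y≤ y∈)) , λ y≈x → proj₂ Y (≈-sym y≈x) Yx)
      ... | no ¬Yx = inj₁ ((λ y∈ → contradiction (proj₂ Y (proj₂ (proj₂ Y≤ y∈)) y∈) ¬Yx) , λ ())

    element : ∀ X → ¬ (X Cm.≈ Cm.𝟘) → ∃[ x ] proj₁ X x
    element X ne with em {∃[ x ] proj₁ X x}
    ... | yes r = r
    ... | no ¬r = ⊥-elim (ne ((λ p → contradiction (_ , p) ¬r) , λ ()))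

    Cm-isAtomic : Cm.IsAtomic
    Cm-isAtomic X nz with element X nz
    ... | x , x∈ = ｛ x ｝ , singleton-atom x , proj₁ , λ y≈x → y≈x , proj₂ X (≈-sym y≈x) x∈

    point : Cm.Atom → Carrier
    point (X , nz , _) = proj₁ (element X nz)

    point∈ : ∀ (X : Cm.Atom) → proj₁ (proj₁ X) (point X)
    point∈ (X , nz , _) = proj₂ (element X nz)

    point-unique : ∀ (X : Cm.Atom) {y} → proj₁ (proj₁ X) y → y ≈ point X
    point-unique (X , nz , least) y∈ with least ｛ proj₁ (element X nz) ｝
      (proj₁ , λ e → e , proj₂ X (≈-sym e) (proj₂ (element X nz)))
    ... | inj₁ e = contradiction (proj₁ e ≈-refl) λ ()
    ... | inj₂ e = proj₂ e y∈

    At-Cm : At (Cm S) ≅ᵃ S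
    At-Cm = record
      { bijection = record
        { to = point
        ; cong = λ {X} {Y} → pcong X Y
        ; bijective = (λ {X} {Y} e → (λ p → proj₂ (proj₁ Y) (≈-sym (≈-trans (point-unique X p) e)) (point∈ Y)) ,
                                     (λ p → proj₂ (proj₁ X) (≈-sym (≈-trans (point-unique Y p) (≈-sym e)))
                                         (point∈ X)))
                    , λ y → (｛ y ｝ , singleton-atom y) , λ {Z} e → proj₁ e (point∈ Z)
        }
      ; R-iff = λ Ω X Xs → mk⇔ (fwd Ω X Xs) (bwd Ω X Xs)
      }
      where
      pcong : ∀ (X Y : Cm.Atom) → proj₁ X Cm.≈ proj₁ Y → point X ≈ point Y
      pcong X Y e = point-unique Y (proj₁ e (point∈ X))
      fwd : ∀ {k} (Ω : F k) (X : Cm.Atom) (Xs : Vec Cm.Atom k) →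
            proj₁ X Cm.≤ Cm.op Ω (map proj₁ Xs) → R Ω (point X) (map point Xs)
      fwd Ω X Xs X≤ with proj₂ (proj₂ X≤ (point∈ X))
      ... | ys , ys∈ , r = R-resp Ω ≈-refl (extensional⇒inductive (ext λ k →
              subst (lookup ys k ≈_) (sym (lookup-map k point Xs))
                (point-unique (lookup Xs k)
                    (subst (λ Z → proj₁ Z (lookup ys k)) (lookup-map k proj₁ Xs) (ys∈ k))))) r
      bwd : ∀ {k} (Ω : F k) (X : Cm.Atom) (Xs : Vec Cm.Atom k) →
            R Ω (point X) (map point Xs) → proj₁ X Cm.≤ Cm.op Ω (map proj₁ Xs)
      bwd Ω X Xs r = proj₁ , λ x∈ → x∈ , map point Xs ,
        (λ k → subst₂ (λ Z y → proj₁ Z y) (sym (lookup-map k proj₁ Xs)) (sym (lookup-map k point Xs))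
            (point∈ (lookup Xs k))) ,
        R-resp Ω (≈-sym (point-unique X x∈)) (Pw.refl ≈-refl) r

-- Transpositions and replacements

transpose-left : ∀ {n} (i j : Fin n) → transpose i j i ≡ j
transpose-left i j with i ≟ i
... | yes _ = refl
... | no p  = contradiction refl p

transpose-right : ∀ {n} (i j : Fin n) → transpose i j j ≡ i
transpose-right i j with j ≟ i
... | yes e = e
... | no _ with j ≟ j
...   | yes _ = refl
...   | no p  = contradiction refl p

transpose-other : ∀ {n} (i j k : Fin n) → k ≢ i → k ≢ j → transpose i j k ≡ k
transpose-other i j k k≢i k≢j with k ≟ i
... | yes e = contradiction e k≢i
... | no _ with k ≟ j
...   | yes e = contradiction e k≢j
...   | no _  = refl

transpose-refl : ∀ {n} (i k : Fin n) → transpose i i k ≡ k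
transpose-refl i k with k ≟ i
... | yes e = sym e
... | no k≢i with k ≟ i
...   | yes e = contradiction e k≢i
...   | no _ = refl

transpose-sym : ∀ {n} (i j k : Fin n) → transpose i j k ≡ transpose j i k
transpose-sym i j k = lemma (k ≟ i) (k ≟ j)
  where
  lemma : Dec (k ≡ i) → Dec (k ≡ j) → transpose i j k ≡ transpose j i k
  lemma (yes refl) _ = trans (transpose-left i j) (sym (transpose-right j i))
  lemma (no _) (yes refl) = trans (transpose-right i j) (sym (transpose-left j i))
  lemma (no p) (no q) = trans (transpose-other i j k p q) (sym (transpose-other j i k q p))

transpose-transpose : ∀ {n} (i j k x : Fin n) → i ≢ j → i ≢ k → j ≢ k →
                      transpose i j (transpose i k x) ≡ transpose j k (transpose i j x)
transpose-transpose i j k x i≢j i≢k j≢k = lemma (x ≟ i) (x ≟ j) (x ≟ k)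
  where
  lemma : Dec (x ≡ i) → Dec (x ≡ j) → Dec (x ≡ k) →
          transpose i j (transpose i k x) ≡ transpose j k (transpose i j x)
  lemma (yes refl) _ _ = trans
      (trans (cong (transpose i j) (transpose-left i k)) (transpose-other i j k (i≢k ∘ sym) (j≢k ∘ sym)))
                               (sym (trans (cong (transpose j k) (transpose-left i j)) (transpose-left j k)))
  lemma (no _) (yes refl) _ =
      trans (trans (cong (transpose i j) (transpose-other i k x (i≢j ∘ sym) j≢k)) (transpose-right i x))
                                    (sym (trans (cong (transpose j k) (transpose-right i j))
                                        (transpose-other j k i i≢j i≢k)))
  lemma (no _) (no _) (yes refl) =
      trans (trans (cong (transpose i j) (transpose-right i k)) (transpose-left i j))
                                    (sym (trans (cong (transpose j k)
                                        (transpose-other i j k (i≢k ∘ sym) (j≢k ∘ sym))) (transpose-right j k)))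
  lemma (no a) (no b) (no c) =
      trans (trans (cong (transpose i j) (transpose-other i k x a c)) (transpose-other i j x a b))
                                    (sym (trans (cong (transpose j k) (transpose-other i j x a b))
                                        (transpose-other j k x b c)))

replace-refl : ∀ {n} (i k : Fin n) → [ i ∣ i ] k ≡ k
replace-refl i k with k ≟ i
... | yes refl = replace-same i i
... | no p = replace-other i i k p

transpose-replace : ∀ {n} (i j k : Fin n) → transpose i j ([ j ∣ i ] k) ≡ [ i ∣ j ] k
transpose-replace i j k = lemma (k ≟ i) (k ≟ j)
  where
  lemma : Dec (k ≡ i) → Dec (k ≡ j) → transpose i j ([ j ∣ i ] k) ≡ [ i ∣ j ] k
  lemma (yes refl) (yes refl) = trans (transpose-refl i _) refl
  lemma (yes refl) (no p) = trans (cong (transpose i j) (replace-other j i i p))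
      (trans (transpose-left i j) (sym (replace-same i j)))
  lemma (no p) (yes refl) =
      trans (cong (transpose i j) (replace-same j i)) (trans (transpose-left i j) (sym (replace-other i j j p)))
  lemma (no p) (no q) = trans (cong (transpose i j) (replace-other j i k q))
      (trans (transpose-other i j k p q) (sym (replace-other i j k p)))

-- The atom structure of basic matrices

module Matrices (em : ExcludedMiddle 0ℓ) {N₀ C₀ n : ℕ}
                (fits : n * n + n ≤ℕ suc N₀) (n<C : n < suc C₀) (2<n : 2 < n) where

  open Nets em {N₀} {C₀} {n} fits n<C 2<n public
  2<C : 2 < suc C₀
  2<C = ℕₚ.<-trans 2<n n<C
  module 𝔑 = Monk em {suc N₀} {C₀} 2<C
  open 𝔑 using (monk; ⟨_⟩; ⟨⟩-atom; label; label-⟨⟩; label-≈; atom-comp⇔; atom-ident⇔; comp⇔)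
  open BasicMatrix

  -- Basic matrices over the relation algebra, and the nets that describe them.
  BM : Set
  BM = BasicMatrix n monk

  𝐀𝐭 : AtomStructure (CylOp PEA n) 0ℓ 0ℓ 0ℓ
  𝐀𝐭 = Mat n monk

  infix 4 _≋_
  _≋_ : BM → BM → Set
  _≋_ = _≈ₘ_ n monk

  net : BM → Matrix ⊥
  net f x y = label (atom f x y)

  ≋⇔ : ∀ {f g} → f ≋ g ⇔ (∀ x y → net f x y ≡ net g x y)
  ≋⇔ {f} {g} = mk⇔ (λ e x y → to (label-≈ (atom f x y) (atom g x y)) (e x y))
                   (λ e x y → from (label-≈ (atom f x y) (atom g x y)) (e x y))

  entry⇔ : ∀ f g x y v w → 𝔑._≈_ (entry f x y) (entry g v w) ⇔ net f x y ≡ net g v w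
  entry⇔ f g x y v w = label-≈ (atom f x y) (atom g v w)

  net-isNet : ∀ f → IsNet (net f)
  net-isNet f = record
    { net-id  = λ x → to (atom-ident⇔ (atom f x x)) (entry-diag f x)
    ; net-sym = λ x y → to (entry⇔ f f x y y x) (entry-conv f y x)
    ; net-tri = λ x y z → Tri-swap₂₃ (net f x y) (net f y z) (net f x z)
        (to (atom-comp⇔ (atom f x y) (atom f y z) (atom f x z)) (entry-comp f x y z))
    }

  matrix : (g : Matrix ⊥) → IsNet g → BM
  matrix g ng = record
    { atom       = atoms
    ; entry-diag = λ x → from (atom-ident⇔ (atoms x x)) (trans (label-⟨⟩ _) (net-id ng x))
    ; entry-conv = λ x y → from (label-≈ (atoms y x) (atoms x y))
          (trans (label-⟨⟩ _) (trans (net-sym ng y x) (sym (label-⟨⟩ _))))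
    ; entry-comp = λ x y z → from (atom-comp⇔ (atoms x y) (atoms y z) (atoms x z))
        (subst id (sym (cong₂ (λ a bc → Tri a (proj₁ bc) (proj₂ bc)) (label-⟨⟩ (g x y))
            (cong₂ _,_ (label-⟨⟩ (g y z)) (label-⟨⟩ (g x z)))))
          (Tri-swap₂₃ (g x y) (g x z) (g y z) (net-tri ng x y z)))
    }
    where
    atoms : Fin n → Fin n → 𝔑.Atom
    atoms x y = ⟨ g x y ⟩ , ⟨⟩-atom (g x y)

  net-matrix : ∀ g (ng : IsNet g) x y → net (matrix g ng) x y ≡ g x y
  net-matrix g ng x y = label-⟨⟩ (g x y)

  1<n : 1 < n
  1<n = <⇒≤ 2<n

  -- Three different coordinates.
  i₀ i₁ i₂ : Fin n
  i₀ = fromℕ< (<⇒≤ 1<n)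
  i₁ = fromℕ< 1<n
  i₂ = fromℕ< 2<n

  i₀≢i₁ : i₀ ≢ i₁
  i₀≢i₁ e = contradiction (trans (sym (toℕ-fromℕ< (<⇒≤ 1<n))) (trans (cong toℕ e) (toℕ-fromℕ< 1<n))) λ ()

  i₀≢i₂ : i₀ ≢ i₂
  i₀≢i₂ e = contradiction (trans (sym (toℕ-fromℕ< (<⇒≤ 1<n))) (trans (cong toℕ e) (toℕ-fromℕ< 2<n))) λ ()

  i₁≢i₂ : i₁ ≢ i₂
  i₁≢i₂ e = contradiction (trans (sym (toℕ-fromℕ< 1<n)) (trans (cong toℕ e) (toℕ-fromℕ< 2<n))) λ ()

  agree : ∀ {f g : Matrix ⊥} (ng : IsNet g) h i → (∀ x y → x ≢ i → y ≢ i → f x y ≡ g x y) →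
          (∀ x y → f x y ≡ net h x y) → _≡[_]_ n monk h i (matrix g ng)
  agree {f} {g} ng h i e e′ x y p q =
    from (entry⇔ h (matrix g ng) x y x y) (trans (sym (e′ x y)) (trans (e x y p q) (sym (net-matrix g ng x y))))

  id-net : IsNet {suc N₀} {suc C₀} {⊥} {n} (λ _ _ → idₗ)
  id-net = record { net-id = λ _ → refl ; net-sym = λ _ _ → refl ; net-tri = λ _ _ _ → refl }

  abstract
    matrix-witness : ∀ f (a b : 𝔑.Atom) x y z → z ≢ x → z ≢ y → Tri (label a) (label b) (net f x y) →
                     ∃[ g ] (_≡[_]_ n monk f z g × 𝔑._≈_ (entry g x z) (proj₁ a) ×
                         𝔑._≈_ (entry g z y) (proj₁ b))
    matrix-witness f a b x y z z≢x z≢y t with net-witness (net-isNet f) (label a) (label b) x y z z≢x z≢y t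
    ... | g , ng , f≡g , gxz , gzy = matrix g ng , agree ng f z f≡g (λ _ _ → refl) ,
          from (label-≈ (atom (matrix g ng) x z) a) (trans (net-matrix g ng x z) gxz) ,
          from (label-≈ (atom (matrix g ng) z y) b) (trans (net-matrix g ng z y) gzy)

    matrix-amalgam : ∀ f g x y →
      (∀ v w → v ≢ x → v ≢ y → w ≢ x → w ≢ y → 𝔑._≈_ (entry f v w) (entry g v w)) →
      ∃[ h ] (_≡[_]_ n monk f x h × _≡[_]_ n monk g y h)
    matrix-amalgam f g x y f≈g with net-amalgam (net-isNet f) (net-isNet g) x y
                                      (λ v w p q r s → to (entry⇔ f g v w v w) (f≈g v w p q r s))
    ... | h , nh , f≡h , g≡h = matrix h nh , agree nh f x f≡h (λ _ _ → refl) , agree nh g y g≡h (λ _ _ → refl)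

  isPolyadicEqualityBasis : IsPolyadicEqualityBasis n monk 1<n U
  isPolyadicEqualityBasis = record
    { isCylindricBasis = record
      { atoms   = every-atom
      ; witness = λ f _ a b x y z z≢x z≢y p →
          let g , f≡g , gxz , gzy = matrix-witness f a b x y z z≢x z≢y (to (atom-comp⇔ a b (atom f x y)) p)
          in g , tt , f≡g , gxz , gzy
      ; amalgam = λ f g _ _ x y f≈g → let h , p , q = matrix-amalgam f g x y f≈g in h , tt , p , q
      }
    ; ∘-closed = λ _ _ _ → tt
    }
    where
    every-atom : ∀ (a : 𝔑.Atom) → ∃[ f ] U f × 𝔑._≈_ (entry f i₀ i₁) (proj₁ a)
    every-atom a with matrix-witness (matrix (λ _ _ → idₗ) id-net) a a i₀ i₀ i₁ (i₀≢i₁ ∘ sym) (i₀≢i₁ ∘ sym)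
                        (subst (Tri (label a) (label a)) (sym (net-matrix _ id-net i₀ i₀)) (Tri-idʳ (label a)))
    ... | f , _ , e , _ = f , tt , e

  module ℭ = Algebra (Cm 𝐀𝐭)
  open Powerset {0ℓ} em
  open ComplexAlgebra 𝐀𝐭 public using (unary⇔; constant⇔; ｛_｝; At-Cm; Cm-isAtomic)

  -- The elements of the complex algebra, and the accessibility relations on basic
  -- matrices.
  Sub : Set₁
  Sub = Subset (AtomStructure.setoid 𝐀𝐭)

  infixl 9 _⊙_
  _⊙_ : BM → (Fin n → Fin n) → BM
  _⊙_ = _∘ₘ_ n monk

  infix 4 _⟪_⟫_
  _⟪_⟫_ : BM → Fin n → BM → Set
  f ⟪ i ⟫ g = _≡[_]_ n monk f i g

  cyl⇔ : ∀ i (X : Sub) {f} → proj₁ (ℭ.op (cyl i) (X ∷ [])) f ⇔ (∃[ g ] proj₁ X g × f ⟪ i ⟫ g)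
  cyl⇔ i X = unary⇔ (cyl i) X

  diag⇔ : ∀ i j {f} → proj₁ (ℭ.op (diag _ i j) []) f ⇔ net f i j ≡ idₗ
  diag⇔ i j {f} = ⇔-trans (constant⇔ (diag _ i j)) (atom-ident⇔ (atom f i j))

  ≋-refl : ∀ {f} → f ≋ f
  ≋-refl x y a = refl

  repl⇔ : ∀ i j (X : Sub) {f} → proj₁ (ℭ.op (repl _ i j) (X ∷ [])) f ⇔ proj₁ X (f ⊙ [ i ∣ j ])
  repl⇔ i j X {f} = ⇔-trans (unary⇔ (repl _ i j) X)
    (mk⇔ (λ (g , Xg , e) → proj₂ X (λ x y a → sym (e x y a)) Xg) (λ Xf → f ⊙ [ i ∣ j ] , Xf ,
        ≋-refl {f ⊙ [ i ∣ j ]}))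

  tran⇔ : ∀ i j (X : Sub) {f} → proj₁ (ℭ.op (tran _ i j) (X ∷ [])) f ⇔ proj₁ X (f ⊙ [ i ,, j ])
  tran⇔ i j X {f} = ⇔-trans (unary⇔ (tran _ i j) X)
    (mk⇔ (λ (g , Xg , e) → proj₂ X (λ x y a → sym (e x y a)) Xg) (λ Xf → f ⊙ [ i ,, j ] , Xf ,
        ≋-refl {f ⊙ [ i ,, j ]}))

  ⊙-cong : ∀ f {σ τ : Fin n → Fin n} → (∀ x → σ x ≡ τ x) → f ⊙ σ ≋ f ⊙ τ
  ⊙-cong f e x y a = cong₂ (λ v w → entry f v w a) (e x) (e y)

  resp-⇔ : ∀ (X : Sub) {f g} → f ≋ g → proj₁ X f ⇔ proj₁ X g
  resp-⇔ X e = mk⇔ (proj₂ X e) (proj₂ X (λ x y a → sym (e x y a)))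

  ≈-⇔ : ∀ {X Y : BM → Set} → (∀ f → X f ⇔ Y f) → X ≐ Y
  ≈-⇔ e = (λ {f} → to (e f)) , (λ {f} → from (e f))

  -- If f has the identity at i and j, then replacing i by j does not change f.
  ⊙-replace-diag : ∀ f i j → net f i j ≡ idₗ → f ⊙ [ i ∣ j ] ≋ f
  ⊙-replace-diag f i j e = from (≋⇔ {f ⊙ [ i ∣ j ]} {f}) λ x y →
      trans (move x ([ i ∣ j ] y)) (trans (net-sym nf x _) (trans (move y x) (net-sym nf y x)))
    where
    nf = net-isNet f
    move : ∀ x y → net f ([ i ∣ j ] x) y ≡ net f x y
    move x y with x ≟ i
    ... | yes refl = trans (cong (λ z → net f z y) (replace-same i j))
                       (sym (subst (λ l → Tri l (net f i y) (net f j y)) e (net-tri nf i j y)))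
    ... | no p = cong (λ z → net f z y) (replace-other i j x p)

  -- Most axioms are computations with substitutions.  The commutation of the
  -- replacement of i by j with the k-th cylindrifier rests on amalgamation.
  Cm-isPEA : IsPEA (Cm 𝐀𝐭)
  Cm-isPEA = record
    { isBooleanAlgebra = powerset-isBooleanAlgebra (AtomStructure.setoid 𝐀𝐭) ℭ.op ℭ.op-cong
    ; s-refl  = λ i X → ≈-⇔ λ f → ⇔-trans (repl⇔ i i X) (resp-⇔ X (⊙-cong f (replace-refl i)))
    ; p-refl  = λ i X → ≈-⇔ λ f → ⇔-trans (tran⇔ i i X) (resp-⇔ X (⊙-cong f (transpose-refl i)))
    ; p-sym   = λ i j X → ≈-⇔ λ f →
          ⇔-trans (tran⇔ i j X) (⇔-trans (resp-⇔ X (⊙-cong f (transpose-sym i j))) (⇔-sym (tran⇔ j i X)))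
    ; c-incr  = λ i X → proj₁ , λ {f} Xf → Xf , from (cyl⇔ i X) (f , Xf , λ x y _ _ a → refl)
    ; c-∨     = λ i X Y → ≈-⇔ λ f → mk⇔ (c-join i X Y f ∘ to (cyl⇔ i (X ℭ.∨ Y))) (c-split i X Y f)
    ; s-c     = λ i j X → ≈-⇔ λ f →
          ⇔-trans (repl⇔ i j (ℭ.op (cyl i) (X ∷ []))) (⇔-trans (cyl⇔ i X) (⇔-trans (mk⇔
        (λ (g , Xg , e) → g , Xg , λ x y p q a → trans (sym (off i j f x y p q a)) (e x y p q a))
        (λ (g , Xg , e) → g , Xg , λ x y p q a → trans (off i j f x y p q a) (e x y p q a)))
            (⇔-sym (cyl⇔ i X))))
    ; c-s     = λ i j X i≢j → ≈-⇔ λ f → mk⇔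
        (λ c → from (repl⇔ i j X) (c-s-⊆ i j X i≢j f (to (cyl⇔ i (ℭ.op (repl _ i j) (X ∷ []))) c)))
        (λ Xf → from (cyl⇔ i (ℭ.op (repl _ i j) (X ∷ []))) (f , Xf , λ x y _ _ a → refl))
    ; s-c-≢   = λ i j k X k≢i k≢j → ≈-⇔ λ f → mk⇔
        (λ c → from (cyl⇔ k (ℭ.op (repl _ i j) (X ∷ [])))
            (s-c-⊆ i j k X k≢i k≢j f (to (cyl⇔ k X) (to (repl⇔ i j (ℭ.op (cyl k) (X ∷ []))) c))))
        (λ c → from (repl⇔ i j (ℭ.op (cyl k) (X ∷ [])))
            (from (cyl⇔ k X) (s-c-⊇ i j k X k≢i k≢j f (to (cyl⇔ k (ℭ.op (repl _ i j) (X ∷ []))) c))))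
    ; s-∨     = λ i j X Y → ≈-⇔ λ f → ⇔-trans (repl⇔ i j (X ℭ.∨ Y)) (mk⇔
        (⊎-map (from (repl⇔ i j X)) (from (repl⇔ i j Y))) (⊎-map (to (repl⇔ i j X)) (to (repl⇔ i j Y))))
    ; s-neg   = λ i j X → ≈-⇔ λ f →
          ⇔-trans (repl⇔ i j (ℭ.- X))
          (mk⇔ (λ ne p → ne (to (repl⇔ i j X) p)) (λ ne p → ne (from (repl⇔ i j X) p)))
    ; p-∨     = λ i j X Y → ≈-⇔ λ f → ⇔-trans (tran⇔ i j (X ℭ.∨ Y)) (mk⇔
        (⊎-map (from (tran⇔ i j X)) (from (tran⇔ i j Y))) (⊎-map (to (tran⇔ i j X)) (to (tran⇔ i j Y))))
    ; p-neg   = λ i j X → ≈-⇔ λ f →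
          ⇔-trans (tran⇔ i j (ℭ.- X))
          (mk⇔ (λ ne p → ne (to (tran⇔ i j X) p)) (λ ne p → ne (from (tran⇔ i j X) p)))
    ; p-invol = λ i j X → ≈-⇔ λ f → ⇔-trans (tran⇔ i j (ℭ.op (tran _ i j) (X ∷ []))) (⇔-trans (tran⇔ i j X)
        (resp-⇔ X (⊙-cong f (λ x → trans (transpose-sym i j (transpose i j x)) (transpose-inverse j i)))))
    ; p-p     = λ i j k X i≢j i≢k j≢k → ≈-⇔ λ f → ⇔-trans (tran⇔ i j (ℭ.op (tran _ i k) (X ∷ [])))
          (⇔-trans (tran⇔ i k X)
        (⇔-trans (resp-⇔ X (⊙-cong f (λ x → transpose-transpose i j k x i≢j i≢k j≢k)))
        (⇔-sym (⇔-trans (tran⇔ j k (ℭ.op (tran _ i j) (X ∷ []))) (tran⇔ i j X)))))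
    ; p-s     = λ i j X → ≈-⇔ λ f → ⇔-trans (tran⇔ i j (ℭ.op (repl _ j i) (X ∷ []))) (⇔-trans (repl⇔ j i X)
        (⇔-trans (resp-⇔ X (⊙-cong f (transpose-replace i j))) (⇔-sym (repl⇔ i j X))))
    ; s-d     = λ i j → (λ _ → Unitₚ.tt) ,
          λ {f} _ → from (repl⇔ i j (ℭ.op (diag _ i j) [])) (from (diag⇔ i j {f ⊙ [ i ∣ j ]})
        (trans (cong (net f ([ i ∣ j ] i)) (trans (fixed i j) (sym (replace-same i j))))
            (net-id (net-isNet f) ([ i ∣ j ] i))))
    ; d-s     = λ i j X → proj₁ , λ {f} (Xf , d) → (Xf , d) , from (repl⇔ i j X)
        (proj₂ X (λ x y a → sym (⊙-replace-diag f i j (to (diag⇔ i j {f}) d) x y a)) Xf)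
    }
    where
    fixed : ∀ (i j : Fin n) → [ i ∣ j ] j ≡ j
    fixed i j with j ≟ i
    ... | yes refl = replace-same i j
    ... | no p = replace-other i j j p
    off : ∀ i j f x y → x ≢ i → y ≢ i → ∀ a → entry (f ⊙ [ i ∣ j ]) x y a ≡ entry f x y a
    off i j f x y p q a = cong₂ (λ v w → entry f v w a) (replace-other i j x p) (replace-other i j y q)
    c-join : ∀ i X Y f → (∃[ g ] proj₁ (X ℭ.∨ Y) g × f ⟪ i ⟫ g) →
        proj₁ (ℭ.op (cyl i) (X ∷ []) ℭ.∨ ℭ.op (cyl i) (Y ∷ [])) f
    c-join i X Y f (g , inj₁ p , e) = inj₁ (from (cyl⇔ i X) (g , p , e))
    c-join i X Y f (g , inj₂ p , e) = inj₂ (from (cyl⇔ i Y) (g , p , e))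
    c-split : ∀ i X Y f → proj₁ (ℭ.op (cyl i) (X ∷ []) ℭ.∨ ℭ.op (cyl i) (Y ∷ [])) f →
        proj₁ (ℭ.op (cyl i) (X ℭ.∨ Y ∷ [])) f
    c-split i X Y f (inj₁ p) = let g , q , e = to (cyl⇔ i X) p in from (cyl⇔ i (X ℭ.∨ Y)) (g , inj₁ q , e)
    c-split i X Y f (inj₂ p) = let g , q , e = to (cyl⇔ i Y) p in from (cyl⇔ i (X ℭ.∨ Y)) (g , inj₂ q , e)
    never : ∀ i j → i ≢ j → ∀ x → [ i ∣ j ] x ≢ i
    never i j i≢j x with x ≟ i
    ... | yes refl = λ e → i≢j (sym (trans (sym (replace-same i j)) e))
    ... | no p = λ e → p (trans (sym (replace-other i j x p)) e)
    c-s-⊆ : ∀ i j X → i ≢ j → ∀ f → (∃[ g ] proj₁ (ℭ.op (repl _ i j) (X ∷ [])) g × f ⟪ i ⟫ g) →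
        proj₁ X (f ⊙ [ i ∣ j ])
    c-s-⊆ i j X i≢j f (g , p , e) = proj₂ X
      (λ x y a → sym (e ([ i ∣ j ] x) ([ i ∣ j ] y) (never i j i≢j x) (never i j i≢j y) a)) (to (repl⇔ i j X) p)
    replace-avoid : ∀ i j k x → k ≢ j → x ≢ k → [ i ∣ j ] x ≢ k
    replace-avoid i j k x k≢j x≢k with x ≟ i
    ... | yes refl = λ e → k≢j (sym (trans (sym (replace-same i j)) e))
    ... | no p = λ e → x≢k (trans (sym (replace-other i j x p)) e)
    s-c-⊇ : ∀ i j k X → k ≢ i → k ≢ j → ∀ f → (∃[ g ] proj₁ (ℭ.op (repl _ i j) (X ∷ [])) g × f ⟪ k ⟫ g) →
            ∃[ g ] proj₁ X g × f ⊙ [ i ∣ j ] ⟪ k ⟫ g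
    s-c-⊇ i j k X k≢i k≢j f (g , p , e) = g ⊙ [ i ∣ j ] , to (repl⇔ i j X) p ,
      λ x y x≢k y≢k a → e _ _ (replace-avoid i j k x k≢j x≢k) (replace-avoid i j k y k≢j y≢k) a
    s-c-⊆ : ∀ i j k X → k ≢ i → k ≢ j → ∀ f → (∃[ g ] proj₁ X g × f ⊙ [ i ∣ j ] ⟪ k ⟫ g) →
            ∃[ g ] proj₁ (ℭ.op (repl _ i j) (X ∷ [])) g × f ⟪ k ⟫ g
    s-c-⊆ i j k X k≢i k≢j f (g , p , e) with i ≟ j
    ... | yes refl = g , from (repl⇔ i i X) (proj₂ X (λ x y a → sym (⊙-cong g (replace-refl i) x y a)) p) ,
          λ x y x≢k y≢k a → trans (sym (⊙-cong f (replace-refl i) x y a)) (e x y x≢k y≢k a)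
    ... | no i≢j with matrix-amalgam f g k i (λ v w v≢k v≢i w≢k w≢i a →
          trans (sym (off i j f v w v≢i w≢i a)) (e v w v≢k w≢k a))
    ...   | h , f≡h , g≡h = h , from (repl⇔ i j X) (proj₂ X
              (λ x y a → trans (sym (⊙-replace-diag g i j gij x y a))
                  (g≡h _ _ (never i j i≢j x) (never i j i≢j y) a)) p) , f≡h
      where
      gij : net g i j ≡ idₗ
      gij = trans (sym (to (entry⇔ (f ⊙ [ i ∣ j ]) g i j i j) (e i j (k≢i ∘ sym) (k≢j ∘ sym))))
        (trans (cong (net f ([ i ∣ j ] i)) (trans (fixed i j) (sym (replace-same i j))))
            (net-id (net-isNet f) ([ i ∣ j ] i)))

-- Representations from embeddings

-- Homomorphisms; embedding-representable turns an injective one into a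
-- representation with a single factor.
record Homomorphism {F : ℕ → Set} {a e b e′ : Level} (A : Algebra F a e) (B : Algebra F b e′) : Set (a ⊔ℓ e ⊔ℓ b ⊔ℓ e′) where
  private
    module A = Algebra A
    module B = Algebra B
  field
    h         : A.Carrier → B.Carrier
    cong-h    : ∀ {x y} → x A.≈ y → h x B.≈ h y
    ∨-homo    : ∀ x y → h (x A.∨ y) B.≈ h x B.∨ h y
    ∧-homo    : ∀ x y → h (x A.∧ y) B.≈ h x B.∧ h y
    -‿homo    : ∀ x → h (A.- x) B.≈ B.- h x
    𝟙-homo    : h A.𝟙 B.≈ B.𝟙
    𝟘-homo    : h A.𝟘 B.≈ B.𝟘
    op-homo   : ∀ {n} (Ω : F n) (xs : Vec A.Carrier n) → h (A.op Ω xs) B.≈ B.op Ω (map h xs)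

embedding-representable : ∀ {ℓ} {F : ℕ → Set} (full : Setoid ℓ ℓ → Algebra F (lsuc ℓ) ℓ)
    {A : Algebra F (lsuc ℓ) ℓ} (U : Setoid ℓ ℓ) →
                          (E : Homomorphism A (full U)) →
                          (∀ {x y} → Algebra._≈_ (full U) (Homomorphism.h E x) (Homomorphism.h E y) →
                              Algebra._≈_ A x y) →
                          RepresentableBy ℓ full A
embedding-representable {ℓ} {F} full {A} U E injective = Unitₚ.⊤ , const U , image , record
  { bijection = record
    { to        = λ a → (λ _ → h a) , (a , λ _ → B.refl)
    ; cong      = λ x≈y _ → cong-h x≈y
    ; bijective = (λ e → injective (e Unitₚ.tt)) , λ (x , a , e) → a , λ z≈a i → B.trans (cong-h z≈a) (e i)
    }
  ; ∨-homo  = λ x y _ → ∨-homo x y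
  ; ∧-homo  = λ x y _ → ∧-homo x y
  ; -‿homo  = λ x _ → -‿homo x
  ; 𝟙-homo  = λ _ → 𝟙-homo
  ; 𝟘-homo  = λ _ → 𝟘-homo
  ; op-homo = λ Ω xs i → subst (λ v → h (A.op Ω xs) B.≈ B.op Ω v)
                (trans (map-∘ (λ x → x i) (λ a _ → h a) xs) (cong (map (λ x → x i)) (map-∘ proj₁ _ xs)))
                    (op-homo Ω xs)
  }
  where
  module A = Algebra A
  module B = Algebra (full U)
  open Homomorphism E
  Member : (Unitₚ.⊤ {ℓ} → B.Carrier) → Set (lsuc ℓ)
  Member x = Σ A.Carrier λ a → ∀ i → h a B.≈ x i
  preimages : ∀ {n} {xs : Vec (Unitₚ.⊤ {ℓ} → B.Carrier) n} → All Member xs →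
              Σ (Vec A.Carrier n) λ as → ∀ i → Pointwise B._≈_ (map h as) (map (λ x → x i) xs)
  preimages All.[] = [] , λ _ → []
  preimages ((a , e) All.∷ ps) = let as , es = preimages ps in a ∷ as , λ i → e i ∷ es i
  image : Subuniverse (∏ {I = Unitₚ.⊤ {ℓ}} (λ _ → full U)) (lsuc ℓ)
  image = record
    { member    = Member
    ; resp      = λ x≈y (a , e) → a , λ i → B.trans (e i) (x≈y i)
    ; ∨-closed  = λ (a , e) (b , e′) → a A.∨ b , λ i → B.trans (∨-homo a b) (B.∨-cong (e i) (e′ i))
    ; ∧-closed  = λ (a , e) (b , e′) → a A.∧ b , λ i → B.trans (∧-homo a b) (B.∧-cong (e i) (e′ i))
    ; -‿closed  = λ (a , e) → A.- a , λ i → B.trans (-‿homo a) (B.-‿cong (e i))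
    ; 𝟙-closed  = A.𝟙 , λ _ → 𝟙-homo
    ; 𝟘-closed  = A.𝟘 , λ _ → 𝟘-homo
    ; op-closed = λ Ω ps → let as , es = preimages ps in A.op Ω as , λ i → B.trans (op-homo Ω as) (B.op-cong Ω (es i))
    }

-- The term algebra is representable

module TermAlgebra (em : ExcludedMiddle 0ℓ) {N₀ C₀ n : ℕ}
                   (fits : n * n + n ≤ℕ suc N₀) (n<C : n < suc C₀) (2<n : 2 < n) where
  open Matrices em {N₀} {C₀} {n} fits n<C 2<n

  -- Sets of basic matrices that do not distinguish matrices similar up to the first
  -- K cliques.
  Closed : ℕ → (BM → Set) → Set
  Closed K X = ∀ f g → net f ~⟨ K ⟩ net g → X f → X g

  closed-mono : ∀ {K L X} → K ≤ℕ L → Closed K X → Closed L X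
  closed-mono K≤L cl f g f~g = cl f g (Similar-mono K≤L f~g)

  similar-∘ : ∀ {I J : Set} {K} {f : Matrix I} {g : Matrix J} (τ : Fin n → Fin n) → f ~⟨ K ⟩ g →
              (λ x y → f (τ x) (τ y)) ~⟨ K ⟩ (λ x y → g (τ x) (τ y))
  similar-∘ τ (m , c) = (λ (x , y) → m (τ x , τ y)) , λ (x , y) (v , w) → c (τ x , τ y) (τ v , τ w)

  ~-matrix : ∀ {I : Set} {K} {f : Matrix I} {g : Matrix ⊥} (ng : IsNet g) → f ~⟨ K ⟩ g →
      f ~⟨ K ⟩ net (matrix g ng)
  ~-matrix {g = g} ng f~g = Similar-trans f~g (Similar-≡ (λ (x , y) → sym (net-matrix g ng x y)))

  step : ∀ {K f f′ g i} → net f ~⟨ K ⟩ net f′ → f ⟪ i ⟫ g → ∃[ g′ ] (f′ ⟪ i ⟫ g′ × net g ~⟨ K ⟩ net g′)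
  step {K} {f} {f′} {g} {i} f~f′ f≡g
    with extend-net fresh-⊥ f~f′ (net-isNet g) i (λ x y p q → to (entry⇔ f g x y x y) (f≡g x y p q))
  ... | g′ , ng′ , f′≡g′ , g~g′ = matrix g′ ng′ , agree ng′ f′ i f′≡g′ (λ _ _ → refl) , ~-matrix ng′ g~g′

  singleton-closed : ∀ f → ∃[ K ] Closed K (_≋ f)
  singleton-closed f with near-bound (λ k → uncurry (net f) (remQuot {n} n k))
  ... | K , near = K , λ g h g~h g≋f → from (≋⇔ {h} {f}) λ x y → trans
        (Match-fixed {K = K} (net g x y) (net h x y)
            (λ m p c e → near′ x y m p c (trans (sym (to (≋⇔ {g} {f}) g≋f x y)) e)) (proj₁ g~h (x , y)))
        (to (≋⇔ {g} {f}) g≋f x y)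
    where
    near′ : ∀ x y m p c → net f x y ≡ at (fin m p) c → m < K
    near′ x y m p c e = near (combine x y) m p c (trans (cong (uncurry (net f)) (remQuot-combine x y)) e)

  closed-cyl : ∀ {K} i (X : Sub) → Closed K (proj₁ X) → Closed K (proj₁ (ℭ.op (cyl i) (X ∷ [])))
  closed-cyl {K} i X cl f f′ f~f′ c with to (cyl⇔ i X) c
  ... | g , Xg , f≡g with step {K} {f} {f′} {g} f~f′ f≡g
  ...   | g′ , f′≡g′ , g~g′ = from (cyl⇔ i X) (g′ , cl g g′ g~g′ Xg , f′≡g′)

  -- Every element of the term algebra is closed for some K.
  tame : ∀ {X : Sub} → Generated (Cm 𝐀𝐭) (isSingleton 𝐀𝐭) X → ∃[ K ] Closed K (proj₁ X)
  tame (gen (f , X⊆ , ⊆X)) with singleton-closed f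
  ... | K , cl = K , λ g h g~h Xg → ⊆X (cl g h g~h (X⊆ Xg))
  tame (resp (X⊆Y , Y⊆X) p) with tame p
  ... | K , cl = K , λ f g f~g Yf → X⊆Y (cl f g f~g (Y⊆X Yf))
  tame (join p q) with tame p | tame q
  ... | K , cl | L , cl′ = K ⊔ L ,
        λ f g f~g → ⊎-map (closed-mono (ℕₚ.m≤m⊔n K L) cl f g f~g) (closed-mono (ℕₚ.m≤n⊔m K L) cl′ f g f~g)
  tame (meet p q) with tame p | tame q
  ... | K , cl | L , cl′ = K ⊔ L , λ f g f~g (Xf , Yf) → closed-mono (ℕₚ.m≤m⊔n K L) cl f g f~g Xf ,
        closed-mono (ℕₚ.m≤n⊔m K L) cl′ f g f~g Yf
  tame (neg p) with tame p
  ... | K , cl = K , λ f g f~g ¬Xf Xg → ¬Xf (cl g f (Similar-sym f~g) Xg)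
  tame one = 0 , λ _ _ _ _ → Unitₚ.tt
  tame zero = 0 , λ _ _ _ ()
  tame (oper (cyl i) {X ∷ []} (p All.∷ All.[])) with tame p
  ... | K , cl = K , closed-cyl i X cl
  tame (oper (diag _ i j) {[]} All.[]) = 0 ,
      λ f g f~g c → from (diag⇔ i j {g}) (Match-id {K = 0} (proj₁ f~g (i , j)) (to (diag⇔ i j {f}) c))
  tame (oper (repl _ i j) {X ∷ []} (p All.∷ All.[])) with tame p
  ... | K , cl = K , λ f g f~g c →
        from (repl⇔ i j X) (cl (f ⊙ [ i ∣ j ]) (g ⊙ [ i ∣ j ]) (similar-∘ [ i ∣ j ] f~g) (to (repl⇔ i j X) c))
  tame (oper (tran _ i j) {X ∷ []} (p All.∷ All.[])) with tame p
  ... | K , cl = K , λ f g f~g c →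
        from (tran⇔ i j X) (cl (f ⊙ [ i ,, j ]) (g ⊙ [ i ,, j ]) (similar-∘ [ i ,, j ] f~g) (to (tran⇔ i j X) c))

  Tuple : Set
  Tuple = Fin n → Point

  -- Every tuple of points is similar to some basic matrix, for every K.
  approximate : ∀ K (s : Tuple) → ∃[ f ] net f ~⟨ K ⟩ netOf s
  approximate K s = build (extend {K} [] (ℕₚ.≤-trans (ℕₚ.m≤m+n (n * n) n) fits) ((λ ()) ,
      λ ()) (λ k → uncurry (netOf s) (remQuot {n} n k)))
    where
    open Extension em {N₀} {suc C₀} {ℕ} {⊥} fresh-⊥
    build : (Σ (Fin (n * n) → Label ⊥) λ e → ∃[ L ] (Linked K L × (∀ {p} → p ∈ [] → p ∈ L) ×
              (∀ k → (uncurry (netOf s) (remQuot {n} n k) , e k) ∈ L))) → ∃[ f ] net f ~⟨ K ⟩ netOf s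
    build (e , L , (mt , cp) , _ , e∈) = matrix g (similar-net s~g (netOf-net s)) ,
        Similar-sym (~-matrix (similar-net s~g (netOf-net s)) s~g)
      where
      g : Matrix ⊥
      g x y = e (combine x y)
      in-L : ∀ x y → (netOf s x y , g x y) ∈ L
      in-L x y = subst (λ p → (uncurry (netOf s) p , g x y) ∈ L) (remQuot-combine x y) (e∈ (combine x y))
      s~g : netOf s ~⟨ K ⟩ g
      s~g = (λ (x , y) → mt (in-L x y)) , λ (x , y) (v , w) → cp (in-L x y) (in-L v w)

  infix 4 _⊩_
  -- The tuple s belongs to the image of X.  For closed X this can be tested on any
  -- similar basic matrix, by the next lemma.
  record _⊩_ (s : Tuple) (X : BM → Set) : Set where
    constructor forces
    field
      support   : ℕ
      supported : Closed support X
      witness   : BM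
      inside    : X witness
      similar   : net witness ~⟨ support ⟩ netOf s

  ⊩⇔ : ∀ {K X f s} → Closed K X → net f ~⟨ K ⟩ netOf s → s ⊩ X ⇔ X f
  ⊩⇔ {K} {X} {f} {s} cl f~s = mk⇔ forced (λ Xf → forces K cl f Xf f~s)
    where
    forced : s ⊩ X → X f
    forced (forces K′ cl′ g Xg g~s) with approximate (K ⊔ K′) s
    ... | h , h~s = cl h f (Similar-trans (Similar-mono (ℕₚ.m≤m⊔n K K′) h~s) (Similar-sym f~s))
                      (cl′ g h (Similar-trans g~s (Similar-sym (Similar-mono (ℕₚ.m≤n⊔m K K′) h~s))) Xg)

  ⊩-resp : ∀ {X} {s t : Tuple} → (∀ x → proj₁ (s x) ≡ proj₁ (t x)) → s ⊩ X → t ⊩ X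
  ⊩-resp e (forces K cl f Xf f~s) =
      forces K cl f Xf (Similar-trans f~s (Similar-≡ λ (x , y) → cong₂ lab (e x) (e y)))

  module Set-algebra = Algebra (setAlgebra PEA n points)
  module 𝔗 = Algebra (Tm 𝐀𝐭)

  extension : 𝔗.Carrier → Set-algebra.Carrier
  extension ((X , _) , _) = (λ s → s ⊩ X) , ⊩-resp

  ⊩-∪ : ∀ {X Y : BM → Set} {s} → ∃[ K ] Closed K X → ∃[ K ] Closed K Y → s ⊩ (λ f → X f ⊎ Y f) ⇔ (s ⊩ X ⊎ s ⊩ Y)
  ⊩-∪ {X} {Y} {s} (K , cl) (L , cl′) with approximate (K ⊔ L) s
  ... | f , f~s = ⇔-trans (⊩⇔ {f = f} (λ g h g~h → ⊎-map (clX g h g~h) (clY g h g~h)) f~s)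
        (mk⇔ (⊎-map (from (⊩⇔ clX f~s)) (from (⊩⇔ clY f~s))) (⊎-map (to (⊩⇔ clX f~s)) (to (⊩⇔ clY f~s))))
    where
    clX : Closed (K ⊔ L) X
    clX = closed-mono (ℕₚ.m≤m⊔n K L) cl
    clY : Closed (K ⊔ L) Y
    clY = closed-mono (ℕₚ.m≤n⊔m K L) cl′

  ⊩-∩ : ∀ {X Y : BM → Set} {s} → ∃[ K ] Closed K X → ∃[ K ] Closed K Y → s ⊩ (λ f → X f × Y f) ⇔ (s ⊩ X × s ⊩ Y)
  ⊩-∩ {X} {Y} {s} (K , cl) (L , cl′) with approximate (K ⊔ L) s
  ... | f , f~s = ⇔-trans (⊩⇔ {f = f} (λ g h g~h (p , q) → clX g h g~h p , clY g h g~h q) f~s)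
        (mk⇔ (λ (p , q) → from (⊩⇔ clX f~s) p , from (⊩⇔ clY f~s) q) (λ (p , q) → to (⊩⇔ clX f~s) p ,
            to (⊩⇔ clY f~s) q))
    where
    clX : Closed (K ⊔ L) X
    clX = closed-mono (ℕₚ.m≤m⊔n K L) cl
    clY : Closed (K ⊔ L) Y
    clY = closed-mono (ℕₚ.m≤n⊔m K L) cl′

  ⊩-∁ : ∀ {X : BM → Set} {s} → ∃[ K ] Closed K X → s ⊩ (λ f → ¬ X f) ⇔ (¬ s ⊩ X)
  ⊩-∁ {X} {s} (K , cl) with approximate K s
  ... | f , f~s = ⇔-trans (⊩⇔ {f = f} (λ g h g~h ¬Xg Xh → ¬Xg (cl h g (Similar-sym g~h) Xh)) f~s)
        (mk⇔ (λ ¬Xf p → ¬Xf (to (⊩⇔ {f = f} cl f~s) p)) (λ ¬p Xf → ¬p (from (⊩⇔ {f = f} cl f~s) Xf)))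

  ⊩-cyl : ∀ i (X : Sub) {s} → ∃[ K ] Closed K (proj₁ X) →
          s ⊩ proj₁ (ℭ.op (cyl i) (X ∷ [])) ⇔ (Σ Tuple λ t → t ⊩ proj₁ X ×
              (∀ j → j ≢ i → proj₁ (t j) ≡ proj₁ (s j)))
  ⊩-cyl i X {s} (K , cl) with approximate K s
  ... | f , f~s = ⇔-trans (⊩⇔ {f = f} (closed-cyl i X cl) f~s) (⇔-trans (cyl⇔ i X) (mk⇔ ascend descend))
    where
    ascend : ∃[ g ] proj₁ X g × f ⟪ i ⟫ g → Σ Tuple λ t → t ⊩ proj₁ X ×
        (∀ j → j ≢ i → proj₁ (t j) ≡ proj₁ (s j))
    ascend (g , Xg , f≡g) with forth (net-isNet g) i (λ x y p q → to (entry⇔ f g x y x y) (f≡g x y p q)) s f~s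
    ... | z , g~t = s [ i ≔ z ] , forces K cl g Xg g~t , λ j j≢i → cong proj₁ (≔-other s i j j≢i)
    descend : (Σ Tuple λ t → t ⊩ proj₁ X × (∀ j → j ≢ i → proj₁ (t j) ≡ proj₁ (s j))) → ∃[ g ] proj₁ X g ×
        f ⟪ i ⟫ g
    descend (t , t⊩ , t≡s) with back s t i (λ x x≢i → sym (t≡s x x≢i)) (Similar-sym f~s)
    ... | g , ng , f≡g , t~g = matrix g ng , to (⊩⇔ cl (Similar-sym (~-matrix ng t~g))) t⊩ ,
          agree ng f i f≡g (λ _ _ → refl)

  ⊩-sub : ∀ {X Y : BM → Set} τ {s} → ∃[ K ] Closed K X → (∀ {f} → Y f ⇔ X (f ⊙ τ)) → s ⊩ Y ⇔ (s ∘ τ) ⊩ X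
  ⊩-sub {X} {Y} τ {s} (K , cl) Y⇔ with approximate K s
  ... | f , f~s = ⇔-trans (⊩⇔ {K} {f = f}
        (λ g h g~h Yg → from Y⇔ (cl (g ⊙ τ) (h ⊙ τ) (similar-∘ τ g~h) (to Y⇔ Yg))) f~s)
                    (⇔-trans Y⇔ (⇔-sym (⊩⇔ cl (similar-∘ τ f~s))))

  ⊩-diag : ∀ i j {s} → s ⊩ proj₁ (ℭ.op (diag _ i j) []) ⇔ proj₁ (s i) ≡ proj₁ (s j)
  ⊩-diag i j {s} with approximate 0 s
  ... | f , f~s = ⇔-trans (⊩⇔ {0} closed-diag f~s) (⇔-trans (diag⇔ i j {f}) (mk⇔
        (λ e → lab-id (s i) (s j) (Match-id {K = 0} (proj₁ f~s (i , j)) e))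
        (λ e → Match-id {K = 0} (proj₁ (Similar-sym f~s) (i , j))
            (trans (cong (λ u → lab u (proj₁ (s j))) e) (lab-refl (proj₁ (s j)))))))
    where
    closed-diag : Closed 0 (proj₁ (ℭ.op (diag _ i j) []))
    closed-diag f g f~g c = from (diag⇔ i j {g}) (Match-id {K = 0} (proj₁ f~g (i , j)) (to (diag⇔ i j {f}) c))

  ⊩-realised : ∀ f → Σ Tuple λ s → ∀ {K} → net f ~⟨ K ⟩ netOf s
  ⊩-realised f with realise-net n<C (ι-net (net-isNet f))
  ... | s , e = s , λ {K} →
        Similar-sym (Similar-trans (Similar-≡ (λ (x , y) → e x y)) (Similar-ι (uncurry (net f))))

  Tm-homomorphism : Homomorphism (Tm 𝐀𝐭) (setAlgebra PEA n points)
  Tm-homomorphism = record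
    { h         = extension
    ; cong-h    = λ {x} {y} → extension-cong x y
    ; ∨-homo    = λ (_ , p) (_ , q) → to (⊩-∪ (tame p) (tame q)) , from (⊩-∪ (tame p) (tame q))
    ; ∧-homo    = λ (_ , p) (_ , q) → to (⊩-∩ (tame p) (tame q)) , from (⊩-∩ (tame p) (tame q))
    ; -‿homo    = λ (_ , p) → to (⊩-∁ (tame p)) , from (⊩-∁ (tame p))
    ; 𝟙-homo    = (λ _ → Unitₚ.tt) , λ {s} _ → let f , f~s = approximate 0 s in forces 0 (λ _ _ _ _ → Unitₚ.tt) f Unitₚ.tt f~s
    ; 𝟘-homo    = (λ { (forces _ _ _ () _) }) , λ ()
    ; op-homo   = extension-op
    }
    where
    extension-cong : ∀ x y → x 𝔗.≈ y → extension x Set-algebra.≈ extension y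
    extension-cong x y (X⊆Y , Y⊆X) =
      (λ (forces K cl f Xf f~s) → forces K (λ g h g~h → X⊆Y ∘ cl g h g~h ∘ Y⊆X) f (X⊆Y Xf) f~s) ,
      (λ (forces K cl f Yf f~s) → forces K (λ g h g~h → Y⊆X ∘ cl g h g~h ∘ X⊆Y) f (Y⊆X Yf) f~s)
    extension-op : ∀ {k} (Ω : CylOp PEA n k) (xs : Vec 𝔗.Carrier k) →
                   extension (𝔗.op Ω xs) Set-algebra.≈ Set-algebra.op Ω (map extension xs)
    extension-op (cyl i)      ((X , p) ∷ []) = to (⊩-cyl i X (tame p)) , from (⊩-cyl i X (tame p))
    extension-op (diag _ i j) []             = to (⊩-diag i j) , from (⊩-diag i j)
    extension-op (repl _ i j) ((X , p) ∷ []) = (λ {s} → to (⊩-sub [ i ∣ j ] {s} (tame p) (repl⇔ i j X))) ,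
        λ {s} → from (⊩-sub [ i ∣ j ] {s} (tame p) (repl⇔ i j X))
    extension-op (tran _ i j) ((X , p) ∷ []) = (λ {s} → to (⊩-sub [ i ,, j ] {s} (tame p) (tran⇔ i j X))) ,
        λ {s} → from (⊩-sub [ i ,, j ] {s} (tame p) (tran⇔ i j X))

  extension-reflects-⊆ : ∀ (x y : 𝔗.Carrier) → (∀ {s} → s ⊩ proj₁ (proj₁ x) → s ⊩ proj₁ (proj₁ y)) → ∀ {f} →
      proj₁ (proj₁ x) f → proj₁ (proj₁ y) f
  extension-reflects-⊆ (X , p) (Y , q) X⊆Y {f} Xf with ⊩-realised f
  ... | s , f~s = to (⊩⇔ {proj₁ (tame q)} {proj₁ Y} {f} {s} (proj₂ (tame q)) f~s)
        (X⊆Y (forces (proj₁ (tame p)) (proj₂ (tame p)) f Xf f~s))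

  Tm-representable : Representable 0ℓ (Tm 𝐀𝐭)
  Tm-representable = embedding-representable (setAlgebra PEA n) points Tm-homomorphism
    λ {x} {y} (p , q) → extension-reflects-⊆ x y p , extension-reflects-⊆ y x q

-- Ramsey's theorem for triangles

¬∀⇒∃¬ : ∀ {a b} (ema : ExcludedMiddle (a ⊔ℓ b)) (emb : ExcludedMiddle b) {A : Set a} {B : A → Set b} →
        ¬ (∀ x → B x) → ∃[ x ] ¬ B x
¬∀⇒∃¬ ema emb {A} {B} ¬∀ with ema {∃[ x ] ¬ B x}
... | yes r = r
... | no ¬r = contradiction all ¬∀
  where
  all : ∀ x → B x
  all x with emb {B x}
  ... | yes b = b
  ... | no ¬b = contradiction (x , ¬b) ¬r

module Ramsey {ℓ : Level} (em : ExcludedMiddle ℓ) where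

  -- Infinite sets of natural numbers.
  Unbounded : (ℕ → Set ℓ) → Set ℓ
  Unbounded S = ∀ b → ∃[ k ] (b < k × S k)

  infinite-pigeonhole : ∀ {J} {S : ℕ → Set ℓ} (P : ℕ → Fin J → Set ℓ) → Unbounded S →
                        (∀ k → S k → ∃[ j ] P k j) → ∃[ j ] Unbounded (λ k → S k × P k j)
  infinite-pigeonhole {J} {S} P unb total with em {∃[ j ] Unbounded (λ k → S k × P k j)}
  ... | yes r = r
  ... | no ¬r = ⊥-elim (proj₂ (limit j) k (ℕₚ.<-trans (M> (∈-tabulate⁺ {f = proj₁ ∘ limit} j)) M<k) (Sk , Pkj))
    where
    limit : ∀ j → ∃[ b ] (∀ k → b < k → ¬ (S k × P k j))
    limit j with ¬∀⇒∃¬ em em (λ unb′ → ¬r (j , unb′))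
    ... | b , ¬b = b , λ k b<k p → ¬b (k , b<k , p)
    M = proj₁ (bound (List.tabulate (proj₁ ∘ limit)))
    M> = proj₂ (bound (List.tabulate (proj₁ ∘ limit)))
    k = proj₁ (unb M)
    M<k = proj₁ (proj₂ (unb M))
    Sk = proj₂ (proj₂ (unb M))
    j = proj₁ (total k Sk)
    Pkj = proj₂ (total k Sk)

  module _ {J : ℕ} (E : ℕ → ℕ → Fin J → Set ℓ) (total : ∀ k l → k < l → ∃[ j ] E k l j) where

    -- A sequence of d vertices in S in which the colour of an edge depends only on its
    -- first end point, with an infinite set of common continuations.
    record EndHomogeneous (d : ℕ) (S : ℕ → Set ℓ) : Set (lsuc ℓ) where
      field
        vertex    : Fin d → ℕ
        colour    : Fin d → Fin J
        rest      : ℕ → Set ℓ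
        unbounded : Unbounded rest
        rest⊆     : ∀ {l} → rest l → S l
        vertex∈   : ∀ x → S (vertex x)
        inner     : ∀ x y → x <ᶠ y → vertex x < vertex y × E (vertex x) (vertex y) (colour x)
        outer     : ∀ x {l} → rest l → vertex x < l × E (vertex x) l (colour x)

    end-homogeneous : ∀ d {S} → Unbounded S → EndHomogeneous d S
    end-homogeneous zero {S} unb = record
      { vertex = λ () ; colour = λ () ; rest = S ; unbounded = unb ; rest⊆ = id ; vertex∈ = λ () ; inner =
            λ () ; outer = λ () }
    end-homogeneous (suc d) {S} unb = record
      { vertex    = λ { zero → k ; (suc x) → vertex x }
      ; colour    = λ { zero → j ; (suc x) → colour x }
      ; rest      = rest
      ; unbounded = unbounded
      ; rest⊆     = λ r → proj₁ (proj₁ (rest⊆ r))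
      ; vertex∈   = λ { zero → Sk ; (suc x) → proj₁ (proj₁ (vertex∈ x)) }
      ; inner     = λ { zero (suc y) _ → proj₂ (proj₁ (vertex∈ y)) ,
            proj₂ (vertex∈ y) ; (suc x) (suc y) (s≤s x<y) → inner x y x<y }
      ; outer     = λ { zero r → proj₂ (proj₁ (rest⊆ r)) , proj₂ (rest⊆ r) ; (suc x) r → outer x r }
      }
      where
      k = proj₁ (unb 0)
      Sk = proj₂ (proj₂ (unb 0))
      above : Unbounded (λ l → S l × Level.Lift ℓ (k < l))
      above b with unb (b + k)
      ... | l , b+k<l , Sl = l , ℕₚ.≤-<-trans (ℕₚ.m≤m+n b k) b+k<l , Sl ,
            Level.lift (ℕₚ.≤-<-trans (ℕₚ.m≤n+m k b) b+k<l)
      split = infinite-pigeonhole (λ l j → E k l j) above (λ l (_ , Level.lift k<l) → total k l k<l)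
      j = proj₁ split
      S′ : ℕ → Set ℓ
      S′ l = (S l × k < l) × E k l j
      unb′ : Unbounded S′
      unb′ b with proj₂ split b
      ... | l , b<l , (Sl , Level.lift k<l) , e = l , b<l , (Sl , k<l) , e
      open EndHomogeneous (end-homogeneous d unb′)

    -- Among J + 1 vertices of an end-homogeneous sequence two have the same colour;
    -- with any common continuation they form a monochromatic triangle.
    monochromatic-triangle : ∃[ k ] ∃[ l ] ∃[ m ] ∃[ j ] (k < l × l < m × E k l j × E k m j × E l m j)
    monochromatic-triangle with end-homogeneous (suc J) {λ _ → Unitₚ.⊤} (λ b → suc b , ℕₚ.≤-refl , Unitₚ.tt)
    ... | eh with pigeonhole (ℕₚ.n<1+n J) (EndHomogeneous.colour eh) | EndHomogeneous.unbounded eh 0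
    ...   | x , y , x<y , e | m , _ , r = vertex x , vertex y , m , colour x ,
              proj₁ (inner x y x<y) , proj₁ (outer y r) , proj₂ (inner x y x<y) , proj₂ (outer x r) ,
              subst (E (vertex y) m) (sym e) (proj₂ (outer y r))
      where open EndHomogeneous eh

-- Finite joins and nontrivial factors

module _ {F : ℕ → Set} {a e : Level} (A : Algebra F a e) where
  open Algebra A

  ⋁ : ∀ {d} → (Fin d → Carrier) → Carrier
  ⋁ {zero}  X = 𝟘
  ⋁ {suc d} X = X zero ∨ ⋁ (X ∘ suc)

  -- A point that splits binary joins splits finite joins.
  ⋁-prime : ∀ {p} (H : Carrier → Set p) → (∀ x y → H (x ∨ y) → H x ⊎ H y) → ¬ H 𝟘 →
            ∀ {d} (X : Fin d → Carrier) → H (⋁ X) → ∃[ j ] H (X j)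
  ⋁-prime H H-∨ H-𝟘 {zero}  X p = contradiction p H-𝟘
  ⋁-prime H H-∨ H-𝟘 {suc d} X p with H-∨ _ _ p
  ... | inj₁ q = zero , q
  ... | inj₂ q with ⋁-prime H H-∨ H-𝟘 (X ∘ suc) q
  ...   | j , r = suc j , r

module _ {F : ℕ → Set} {a e ℓ : Level} (em : ∀ ℓ → ExcludedMiddle ℓ) {full : Setoid ℓ ℓ → Algebra F (lsuc ℓ) ℓ} {A : Algebra F a e} where

  -- A representation of a nontrivial algebra has a factor with different 𝟘 and 𝟙.
  nontrivial-factor : RepresentableBy ℓ full A → ¬ Algebra._≈_ A (Algebra.𝟙 A) (Algebra.𝟘 A) →
    Σ (Setoid ℓ ℓ) λ V → Homomorphism A (full V) ×
        ¬ Algebra._≈_ (full V) (Algebra.𝟙 (full V)) (Algebra.𝟘 (full V))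
  nontrivial-factor (I , U , B , iso) 𝟙≉𝟘 with ¬∀⇒∃¬ (em ℓ) (em ℓ) trivial
    where
    open _≅_ iso using (∨-homo; ∧-homo; -‿homo; 𝟙-homo; 𝟘-homo; op-homo)
    trivial : ¬ (∀ i → Algebra._≈_ (full (U i)) (Algebra.𝟙 (full (U i))) (Algebra.𝟘 (full (U i))))
    trivial all = 𝟙≉𝟘 (_≅_.injective iso (λ i → Algebra.trans (full (U i)) (𝟙-homo i)
      (Algebra.trans (full (U i)) (all i) (Algebra.sym (full (U i)) (𝟘-homo i)))))
  ... | i , ne = U i , record
    { h = λ x → proj₁ (_≅_.to iso x) i
    ; cong-h = λ x≈y → _≅_.cong iso x≈y i
    ; ∨-homo = λ x y → ∨-homo x y i
    ; ∧-homo = λ x y → ∧-homo x y i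
    ; -‿homo = λ x → -‿homo x i
    ; 𝟙-homo = 𝟙-homo i
    ; 𝟘-homo = 𝟘-homo i
    ; op-homo = λ Ω xs → subst (λ v → Algebra._≈_ (full (U i)) (proj₁ (_≅_.to iso (Algebra.op A Ω xs)) i)
          (Algebra.op (full (U i)) Ω v))
        (trans (cong (map (λ x → x i)) (sym (map-∘ proj₁ (_≅_.to iso) xs)))
            (sym (map-∘ (λ x → x i) (λ x → proj₁ (_≅_.to iso x)) xs)))
        (op-homo Ω xs i)
    } , ne
    where open _≅_ iso using (∨-homo; ∧-homo; -‿homo; 𝟙-homo; 𝟘-homo; op-homo)

-- The complex algebra is not representable

module _ {N C : ℕ} where

  -- The class of a label: its position in the clique together with its colour.
  Class : Fin (N * C) → Label {N} {C} ⊥ → Set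
  Class j l = ∃[ m ] ∃[ p ] ∃[ c ] (l ≡ at (fin m p) c × combine p c ≡ j)

  class : ∀ l → l ≢ idₗ → ∃[ j ] Class j l
  class idₗ              ne = contradiction refl ne
  class (at (fin m p) c) ne = combine p c , m , p , c , refl , refl

  no-class-triangle : ∀ j {a b c} → Class j a → Class j b → Class j c → ¬ Tri a b c
  no-class-triangle j (m , p , c , refl , refl) (m′ , p′ , c′ , refl , e′) (m″ , p″ , c″ , refl , e″) t
    with combine-injective p′ c′ p c e′ | combine-injective p″ c″ p c e″
  ... | refl , refl | refl , refl with t refl refl
  ...   | inj₁ (refl , ne)        = ne refl
  ...   | inj₂ (inj₁ (refl , ne)) = ne refl
  ...   | inj₂ (inj₂ (refl , ne)) = ne refl

module Nonrepresentable (em : ∀ ℓ → ExcludedMiddle ℓ) {N₀ C₀ n : ℕ}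
                        (fits : n * n + n ≤ℕ suc N₀) (n<C : n < suc C₀) (2<n : 2 < n) where
  open Matrices (em 0ℓ) {N₀} {C₀} {n} fits n<C 2<n

  open 𝔑 using (⟨_⟩; ⟨⟩-atom; label-⟨⟩; label-≈)

  -- The set of basic matrices whose entry at i and j has the property P.
  coordinate : Fin n → Fin n → (Label {suc N₀} {suc C₀} ⊥ → Set) → Sub
  coordinate i j P = (λ f → P (net f i j)) , λ {f} {g} f≋g → subst P (to (≋⇔ {f} {g}) f≋g i j)

  -- What a representation in any of the signatures provides: an interpretation H of
  -- the sets of basic matrices by sets of n-tuples that respects Boolean
  -- operations and cylindrifiers, together with one tuple.
  record CylindricHom {ℓ} (V : Setoid ℓ ℓ) : Set (lsuc (lsuc 0ℓ) ⊔ℓ lsuc ℓ) where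
    private module V = Setoid V
    field
      H      : Sub → (Fin n → V.Carrier) → Set ℓ
      H-resp : ∀ X {s t} → (∀ j → s j V.≈ t j) → H X s → H X t
      H-cong : ∀ X Y {s} → X ℭ.≈ Y → H X s → H Y s
      H-∪    : ∀ X Y {s} → H (X ℭ.∨ Y) s → H X s ⊎ H Y s
      H-∩    : ∀ X Y {s} → H X s → H Y s → H (X ℭ.∧ Y) s
      H-∁    : ∀ X {s} → ¬ H X s → H (ℭ.- X) s
      H-∅    : ∀ {s} → ¬ H ℭ.𝟘 s
      H-𝟙    : ∀ {s} → H ℭ.𝟙 s
      H-cyl  : ∀ i X {s} → H (ℭ.op (cyl i) (X ∷ [])) s → ∃[ t ] H X t × (∀ j → j ≢ i → t j V.≈ s j)
      H-cyl⁻ : ∀ i X {s} → (∃[ t ] H X t × (∀ j → j ≢ i → t j V.≈ s j)) → H (ℭ.op (cyl i) (X ∷ [])) s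
      base   : Fin n → V.Carrier

  module _ {ℓ} {V : Setoid ℓ ℓ} (𝓗 : CylindricHom V) where
    open CylindricHom 𝓗
    open Setoid V using () renaming (Carrier to Base; _≈_ to _≈ᵥ_; refl to ≈ᵥ-refl)

    H-mono : ∀ X Y {s} → (∀ {f} → proj₁ X f → proj₁ Y f) → H X s → H Y s
    H-mono X Y {s} X⊆Y p with em ℓ {H Y s}
    ... | yes q = q
    ... | no ¬q = ⊥-elim (H-∅ (H-cong (X ℭ.∧ (ℭ.- Y)) ℭ.𝟘 ((λ (x , ¬y) → contradiction (X⊆Y x) ¬y) ,
          λ ()) (H-∩ X (ℭ.- Y) p (H-∁ Y ¬q))))

    -- Tuples that differ from the base tuple at most at the coordinates i₀, i₁, i₂.
    -- The lemmas move witness a cylindrifier by changing one coordinate; the lemmas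
    -- free change a coordinate on which a set does not depend.
    tup : Base → Base → Base → Fin n → Base
    tup a b c j with j ≟ i₀ | j ≟ i₁ | j ≟ i₂
    ... | yes _ | _     | _     = a
    ... | no _  | yes _ | _     = b
    ... | no _  | no _  | yes _ = c
    ... | no _  | no _  | no _  = base j

    move₀ : ∀ X {a b c} → H (ℭ.op (cyl i₀) (X ∷ [])) (tup a b c) → ∃[ a′ ] H X (tup a′ b c)
    move₀ X {a} {b} {c} p with H-cyl i₀ X p
    ... | t , q , t≈ = t i₀ , H-resp X same q
      where
      same : ∀ j → t j ≈ᵥ tup (t i₀) b c j
      same j with j ≟ i₀ | t≈ j
      ... | yes refl | _ = ≈ᵥ-refl
      ... | no j≢ | e with j ≟ i₁ | j ≟ i₂
      ...   | yes _ | _     = e j≢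
      ...   | no _  | yes _ = e j≢
      ...   | no _  | no _  = e j≢

    move₁ : ∀ X {a b c} → H (ℭ.op (cyl i₁) (X ∷ [])) (tup a b c) → ∃[ b′ ] H X (tup a b′ c)
    move₁ X {a} {b} {c} p with H-cyl i₁ X p
    ... | t , q , t≈ = t i₁ , H-resp X same q
      where
      same : ∀ j → t j ≈ᵥ tup a (t i₁) c j
      same j with j ≟ i₀ | j ≟ i₁ | t≈ j
      ... | yes refl | _        | e = e i₀≢i₁
      ... | no _     | yes refl | _ = ≈ᵥ-refl
      ... | no _     | no j≢    | e with j ≟ i₂
      ...   | yes _ = e j≢
      ...   | no _  = e j≢

    move₂ : ∀ X {a b c} → H (ℭ.op (cyl i₂) (X ∷ [])) (tup a b c) → ∃[ c′ ] H X (tup a b c′)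
    move₂ X {a} {b} {c} p with H-cyl i₂ X p
    ... | t , q , t≈ = t i₂ , H-resp X same q
      where
      same : ∀ j → t j ≈ᵥ tup a b (t i₂) j
      same j with j ≟ i₀ | j ≟ i₁ | j ≟ i₂ | t≈ j
      ... | yes refl | _        | _        | e = e i₀≢i₂
      ... | no _     | yes refl | _        | e = e i₁≢i₂
      ... | no _     | no _     | yes refl | _ = ≈ᵥ-refl
      ... | no _     | no _     | no j≢    | e = e j≢

    -- Sets that do not depend on the i-th coordinate.
    Free : Fin n → Sub → Set
    Free i X = ∀ f g → f ⟪ i ⟫ g → proj₁ X g → proj₁ X f

    coordinate-free : ∀ i j k P → i ≢ k → j ≢ k → Free k (coordinate i j P)
    coordinate-free i j k P i≢k j≢k f g e = subst P (sym (to (entry⇔ f g i j i j) (e i j i≢k j≢k)))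

    free : ∀ i X {s t} → Free i X → (∀ j → j ≢ i → s j ≈ᵥ t j) → H X s → H X t
    free i X fr s≈t p = H-mono (ℭ.op (cyl i) (X ∷ [])) X
      (λ {f} c → let g , Xg , e = to (cyl⇔ i X) c in fr f g e Xg) (H-cyl⁻ i X (_ , p , s≈t))

    free₀ : ∀ P {a a′ b c} → H (coordinate i₁ i₂ P) (tup a b c) → H (coordinate i₁ i₂ P) (tup a′ b c)
    free₀ P {a} {a′} {b} {c} =
        free i₀ (coordinate i₁ i₂ P) (coordinate-free i₁ i₂ i₀ P (i₀≢i₁ ∘ sym) (i₀≢i₂ ∘ sym)) same
      where
      same : ∀ j → j ≢ i₀ → tup a b c j ≈ᵥ tup a′ b c j
      same j j≢ with j ≟ i₀ | j ≟ i₁ | j ≟ i₂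
      ... | yes e | _     | _     = contradiction e j≢
      ... | no _  | yes _ | _     = ≈ᵥ-refl
      ... | no _  | no _  | yes _ = ≈ᵥ-refl
      ... | no _  | no _  | no _  = ≈ᵥ-refl

    free₁ : ∀ P {a b b′ c} → H (coordinate i₀ i₂ P) (tup a b c) → H (coordinate i₀ i₂ P) (tup a b′ c)
    free₁ P {a} {b} {b′} {c} =
        free i₁ (coordinate i₀ i₂ P) (coordinate-free i₀ i₂ i₁ P i₀≢i₁ (i₁≢i₂ ∘ sym)) same
      where
      same : ∀ j → j ≢ i₁ → tup a b c j ≈ᵥ tup a b′ c j
      same j j≢ with j ≟ i₀ | j ≟ i₁ | j ≟ i₂
      ... | yes _ | _     | _     = ≈ᵥ-refl
      ... | no _  | yes e | _     = contradiction e j≢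
      ... | no _  | no _  | yes _ = ≈ᵥ-refl
      ... | no _  | no _  | no _  = ≈ᵥ-refl

    free₂ : ∀ P {a b c c′} → H (coordinate i₀ i₁ P) (tup a b c) → H (coordinate i₀ i₁ P) (tup a b c′)
    free₂ P {a} {b} {c} {c′} = free i₂ (coordinate i₀ i₁ P) (coordinate-free i₀ i₁ i₂ P i₀≢i₂ i₁≢i₂) same
      where
      same : ∀ j → j ≢ i₂ → tup a b c j ≈ᵥ tup a b c′ j
      same j j≢ with j ≟ i₀ | j ≟ i₁ | j ≟ i₂
      ... | yes _ | _     | _     = ≈ᵥ-refl
      ... | no _  | yes _ | _     = ≈ᵥ-refl
      ... | no _  | no _  | yes e = contradiction e j≢
      ... | no _  | no _  | no _  = ≈ᵥ-refl

    -- The diagonal elements.  No operation of the signature needs to name them, and H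
    -- need not interpret them as equality.
    D : Fin n → Fin n → Sub
    D i j = coordinate i j (_≡ idₗ)

    -- Infinitely many different labels.
    spokeLabel : ℕ → Label {suc N₀} {suc C₀} ⊥
    spokeLabel k = at (fin k zero) zero

    always : ∀ X {s} → (∀ f → proj₁ X f) → H X s
    always X all = H-mono ℭ.𝟙 X (λ {f} _ → all f) H-𝟙

    abstract
      -- Every label occurs at i and j after changing coordinate j.
      reach : ∀ i j l → i ≢ j → ∀ f → ∃[ g ] net g i j ≡ l × f ⟪ j ⟫ g
      reach i j l i≢j f with matrix-witness f (⟨ l ⟩ , ⟨⟩-atom l) (⟨ l ⟩ , ⟨⟩-atom l) i i j (i≢j ∘ sym)
          (i≢j ∘ sym)
                               (subst₂ (λ a b → Tri a a b) (sym (label-⟨⟩ l)) (sym (net-id (net-isNet f) i))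
                                   (Tri-idʳ l))
      ... | g , f≡g , e , _ = g , trans (to (label-≈ (BasicMatrix.atom g i j) (⟨ l ⟩ , ⟨⟩-atom l)) e)
            (label-⟨⟩ l) , f≡g

    -- The hub u carries a point v k in coordinate i₁ for each spoke label; w k is a
    -- copy of v k in coordinate i₂, and u′ k one in coordinate i₀.
    u z : Base
    u = base i₀
    z = base i₂

    pick-v : ∀ k → ∃[ v ] H (coordinate i₀ i₁ (_≡ spokeLabel k)) (tup u v z)
    pick-v k = move₁ (coordinate i₀ i₁ (_≡ spokeLabel k)) {u} {base i₁} {z}
        (always (ℭ.op (cyl i₁) (coordinate i₀ i₁ (_≡ spokeLabel k) ∷ [])) λ f →
        from (cyl⇔ i₁ (coordinate i₀ i₁ (_≡ spokeLabel k))) (reach i₀ i₁ (spokeLabel k) i₀≢i₁ f))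

    v : ℕ → Base
    v k = proj₁ (pick-v k)

    pick-w : ∀ k → ∃[ w ] H (D i₁ i₂) (tup u (v k) w)
    pick-w k = move₂ (D i₁ i₂) {u} {v k} {z} (always (ℭ.op (cyl i₂) (D i₁ i₂ ∷ [])) λ f →
        from (cyl⇔ i₂ (D i₁ i₂)) (reach i₁ i₂ idₗ i₁≢i₂ f))

    w : ℕ → Base
    w k = proj₁ (pick-w k)

    pick-u : ∀ k → ∃[ u′ ] H (D i₀ i₁) (tup u′ (v k) (w k))
    pick-u k = move₀ (D i₀ i₁) {u} {v k} {w k} (always (ℭ.op (cyl i₀) (D i₀ i₁ ∷ [])) λ f →
        from (cyl⇔ i₀ (D i₀ i₁)) (back-reach f))
      where
      back-reach : ∀ f → ∃[ g ] net g i₀ i₁ ≡ idₗ × f ⟪ i₀ ⟫ g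
      back-reach f with reach i₁ i₀ idₗ (i₀≢i₁ ∘ sym) f
      ... | g , e , f≡g = g , trans (net-sym (net-isNet g) i₀ i₁) e , f≡g

    u′ : ℕ → Base
    u′ k = proj₁ (pick-u k)

    D₁₂ : ∀ {a} k → H (D i₁ i₂) (tup a (v k) (w k))
    D₁₂ k = free₀ (_≡ idₗ) (proj₂ (pick-w k))

    D₀₁ : ∀ {c} k → H (D i₀ i₁) (tup (u′ k) (v k) c)
    D₀₁ k = free₂ (_≡ idₗ) (proj₂ (pick-u k))

    -- Substitution along the diagonal elements.
    along₁₂ : ∀ P {s} → H (D i₁ i₂) s → H (coordinate i₀ i₁ P) s → H (coordinate i₀ i₂ P) s
    along₁₂ P d q = H-mono (D i₁ i₂ ℭ.∧ coordinate i₀ i₁ P) (coordinate i₀ i₂ P)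
      (λ {f} (d , p) → subst P (Tri-idʳ⁻¹ _ _ (subst (Tri _ _) d (net-tri (net-isNet f) i₀ i₁ i₂))) p)
          (H-∩ (D i₁ i₂) (coordinate i₀ i₁ P) d q)

    along₂₁ : ∀ P {s} → H (D i₁ i₂) s → H (coordinate i₀ i₂ P) s → H (coordinate i₀ i₁ P) s
    along₂₁ P d q = H-mono (D i₁ i₂ ℭ.∧ coordinate i₀ i₂ P) (coordinate i₀ i₁ P)
      (λ {f} (d , p) → subst P (sym (Tri-idʳ⁻¹ _ _ (subst (Tri _ _) d (net-tri (net-isNet f) i₀ i₁ i₂)))) p)
          (H-∩ (D i₁ i₂) (coordinate i₀ i₂ P) d q)

    along₁₀ : ∀ P {s} → H (D i₀ i₁) s → H (coordinate i₁ i₂ P) s → H (coordinate i₀ i₂ P) s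
    along₁₀ P d q = H-mono (D i₀ i₁ ℭ.∧ coordinate i₁ i₂ P) (coordinate i₀ i₂ P)
      (λ {f} (d , p) → subst P (sym
          (subst (λ l → Tri l (net f i₀ i₂) (net f i₁ i₂)) d (net-tri (net-isNet f) i₀ i₁ i₂))) p)
          (H-∩ (D i₀ i₁) (coordinate i₁ i₂ P) d q)

    -- Different points cannot be copies of each other: their labels to u differ.
    distinct : ∀ k l → k < l → ¬ H (D i₁ i₂) (tup u (v k) (w l))
    distinct k l k<l d = H-∅ (H-mono (coordinate i₀ i₂ (_≡ spokeLabel k) ℭ.∧ coordinate i₀ i₂ (_≡ spokeLabel l))
        ℭ.𝟘 (λ {f} → clash {f})
      (H-∩ (coordinate i₀ i₂ (_≡ spokeLabel k)) (coordinate i₀ i₂ (_≡ spokeLabel l))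
        (along₁₂ (_≡ spokeLabel k) d (free₂ (_≡ spokeLabel k) (proj₂ (pick-v k))))
        (free₁ (_≡ spokeLabel l) (along₁₂ (_≡ spokeLabel l) (D₁₂ l)
            (free₂ (_≡ spokeLabel l) (proj₂ (pick-v l)))))))
      where
      clash : ∀ {f} → net f i₀ i₂ ≡ spokeLabel k × net f i₀ i₂ ≡ spokeLabel l → proj₁ ℭ.𝟘 f
      clash (e , e′) with trans (sym e) e′
      ... | refl = contradiction k<l (ℕₚ.<-irrefl refl)

    -- The class of the edge between the k-th and the l-th point.
    E : ℕ → ℕ → Fin (suc N₀ * suc C₀) → Set ℓ
    E k l j = H (coordinate i₁ i₂ (Class j)) (tup u (v k) (w l))

    E-total : ∀ k l → k < l → ∃[ j ] E k l j
    E-total k l k<l = ⋁-prime (Cm 𝐀𝐭) (λ X → H X (tup u (v k) (w l))) (λ X Y → H-∪ X Y) H-∅ classes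
      (H-mono (ℭ.- D i₁ i₂) (⋁ (Cm 𝐀𝐭) classes) covered (H-∁ (D i₁ i₂) (distinct k l k<l)))
      where
      classes : Fin (suc N₀ * suc C₀) → Sub
      classes j = coordinate i₁ i₂ (Class j)
      ∈-⋁ : ∀ {d} (X : Fin d → Sub) j {f} → proj₁ (X j) f → proj₁ (⋁ (Cm 𝐀𝐭) X) f
      ∈-⋁ X zero    p = inj₁ p
      ∈-⋁ X (suc j) p = inj₂ (∈-⋁ (X ∘ suc) j p)
      covered : ∀ {f} → ¬ net f i₁ i₂ ≡ idₗ → proj₁ (⋁ (Cm 𝐀𝐭) classes) f
      covered {f} ne with class (net f i₁ i₂) ne
      ... | j , c = ∈-⋁ classes j c

    -- If the k-th, l-th and m-th points span a triangle in one class, the tuple with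
    -- their copies in coordinates i₀, i₁, i₂ is labelled inconsistently.
    collapse : ⊥
    collapse = absurd (Ramsey.monochromatic-triangle (em ℓ) E E-total)
      where
      triangle : ∀ {k l m j} → E k l j → E k m j → E l m j → ⊥
      triangle {k} {l} {m} {j} kl km lm =
          H-∅ (H-mono ((coordinate i₀ i₁ P ℭ.∧ coordinate i₀ i₂ P) ℭ.∧ coordinate i₁ i₂ P) ℭ.𝟘
          (λ {f} ((p , q) , r) → contradiction (net-tri (net-isNet f) i₀ i₁ i₂) (no-class-triangle j p q r))
          (H-∩ (coordinate i₀ i₁ P ℭ.∧ coordinate i₀ i₂ P) (coordinate i₁ i₂ P)
            (H-∩ (coordinate i₀ i₁ P) (coordinate i₀ i₂ P) side₀₁ side₀₂) side₁₂))
        where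
        P : Label {suc N₀} {suc C₀} ⊥ → Set
        P = Class j
        side₁₂ : H (coordinate i₁ i₂ P) (tup (u′ k) (v l) (w m))
        side₁₂ = free₀ P lm
        side₀₂ : H (coordinate i₀ i₂ P) (tup (u′ k) (v l) (w m))
        side₀₂ = free₁ P (along₁₀ P (D₀₁ k) (free₀ P km))
        side₀₁ : H (coordinate i₀ i₁ P) (tup (u′ k) (v l) (w m))
        side₀₁ = free₂ P (along₂₁ P (D₁₂ l) (free₁ P (along₁₀ P (D₀₁ k) (free₀ P kl))))
      absurd : (∃[ k ] ∃[ l ] ∃[ m ] ∃[ j ] (k < l × l < m × E k l j × E k m j × E l m j)) → ⊥
      absurd (k , l , m , j , _ , _ , kl , km , lm) = triangle kl km lm

  𝟙≉𝟘 : ¬ ℭ.𝟙 ℭ.≈ ℭ.𝟘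
  𝟙≉𝟘 e with proj₁ e {matrix (λ _ _ → idₗ) id-net} Unitₚ.tt
  ... | ()

inhabitant : ∀ {ℓ} → ExcludedMiddle ℓ → {X : Set ℓ} →
             ¬ (_≐_ {A = X} (const (Unitₚ.⊤ {ℓ})) (const (⊥ₚ {ℓ}))) → X
inhabitant em {X} ne with em {X}
... | yes x = x
... | no ¬x = ⊥-elim (ne ((λ {x} _ → contradiction x ¬x) , λ _ → Unitₚ.tt))

-- Excluding all signatures between Df and PEA

module CmNonrepresentable (em : ∀ ℓ → ExcludedMiddle ℓ) {N₀ C₀ n : ℕ}
                          (fits : n * n + n ≤ℕ suc N₀) (n<C : n < suc C₀) (2<n : 2 < n) where
  open Matrices (em 0ℓ) {N₀} {C₀} {n} fits n<C 2<n
  open Nonrepresentable em {N₀} {C₀} {n} fits n<C 2<n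

  module _ {ℓ : Level} {t : Signature} where

    reduct-collapse : ∀ {V : Setoid ℓ ℓ} → Homomorphism (reduct (toPEA {t}) (Cm 𝐀𝐭)) (setAlgebra t n V) →
      ¬ Algebra._≈_ (setAlgebra t n V) (Algebra.𝟙 (setAlgebra t n V)) (Algebra.𝟘 (setAlgebra t n V)) → ⊥
    reduct-collapse {V} φ ne = collapse {ℓ} {V} record
      { H      = λ X → proj₁ (h X)
      ; H-resp = λ X → proj₂ (h X)
      ; H-cong = λ X Y e → proj₁ (cong-h {X} {Y} e)
      ; H-∪    = λ X Y → proj₁ (∨-homo X Y)
      ; H-∩    = λ X Y p q → proj₂ (∧-homo X Y) (p , q)
      ; H-∁    = λ X → proj₂ (-‿homo X)
      ; H-∅    = λ {s} p → ¬-empty {s} (proj₁ 𝟘-homo p)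
      ; H-𝟙    = proj₂ 𝟙-homo Unitₚ.tt
      ; H-cyl  = λ i X → proj₁ (op-homo (cyl i) (X ∷ []))
      ; H-cyl⁻ = λ i X → proj₂ (op-homo (cyl i) (X ∷ []))
      ; base   = inhabitant (em ℓ) ne
      }
      where
      open Homomorphism φ
      ¬-empty : ∀ {s} → ¬ proj₁ (Algebra.𝟘 (setAlgebra t n V)) s
      ¬-empty ()

    reduct-nonrepresentable : ¬ Representable ℓ (reduct (toPEA {t}) (Cm 𝐀𝐭))
    reduct-nonrepresentable rep =
      let V , φ , ne = nontrivial-factor em {full = setAlgebra t n} rep 𝟙≉𝟘 in reduct-collapse φ ne

  Cm-nonrepresentable : ∀ {ℓ} → ¬ Representable ℓ (Cm 𝐀𝐭)
  Cm-nonrepresentable {ℓ} rep =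
    let V , φ , ne = nontrivial-factor em {full = setAlgebra PEA n} rep 𝟙≉𝟘 in reduct-collapse {t = PEA} (self φ) ne
    where
    self : ∀ {V : Setoid ℓ ℓ} → Homomorphism (Cm 𝐀𝐭) (setAlgebra PEA n V) →
        Homomorphism (reduct (toPEA {PEA}) (Cm 𝐀𝐭)) (setAlgebra PEA n V)
    self φ = record
      { h = h ; cong-h = λ {x} {y} → cong-h {x} {y} ; ∨-homo = ∨-homo ; ∧-homo = ∧-homo ; -‿homo =
            -‿homo ; 𝟙-homo = 𝟙-homo ; 𝟘-homo = 𝟘-homo
      ; op-homo = λ { (cyl i) → op-homo (cyl i) ; (diag _ i j) → op-homo (diag _ i j)
                    ; (repl _ i j) → op-homo (repl _ i j) ; (tran _ i j) → op-homo (tran _ i j) }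
      }
      where open Homomorphism φ

-- Subalgebras with the same atoms

module _ {a ℓ m : Level} {A : Algebra RAOp a ℓ} (B : Subuniverse A m) where

  sub-isRelationAlgebra : IsRelationAlgebra A → IsRelationAlgebra (Subalgebra A B)
  sub-isRelationAlgebra ra = record
    { isBooleanAlgebra = record
      { isDistributiveLattice = record
        { isLattice = record
          { isEquivalence = Algebra.isEquivalence (Subalgebra A B)
          ; ∨-comm = λ x y → BA.∨-comm (proj₁ x) (proj₁ y)
          ; ∨-assoc = λ x y z → BA.∨-assoc (proj₁ x) (proj₁ y) (proj₁ z)
          ; ∨-cong = BA.∨-cong
          ; ∧-comm = λ x y → BA.∧-comm (proj₁ x) (proj₁ y)
          ; ∧-assoc = λ x y z → BA.∧-assoc (proj₁ x) (proj₁ y) (proj₁ z)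
          ; ∧-cong = BA.∧-cong
          ; absorptive = (λ x y → proj₁ BA.absorptive (proj₁ x) (proj₁ y)) ,
                (λ x y → proj₂ BA.absorptive (proj₁ x) (proj₁ y))
          }
        ; ∨-distrib-∧ = (λ x y z → proj₁ BA.∨-distrib-∧ (proj₁ x) (proj₁ y) (proj₁ z)) ,
              (λ x y z → proj₂ BA.∨-distrib-∧ (proj₁ x) (proj₁ y) (proj₁ z))
        ; ∧-distrib-∨ = (λ x y z → proj₁ BA.∧-distrib-∨ (proj₁ x) (proj₁ y) (proj₁ z)) ,
              (λ x y z → proj₂ BA.∧-distrib-∨ (proj₁ x) (proj₁ y) (proj₁ z))
        }
      ; ∨-complement = (λ x → proj₁ BA.∨-complement (proj₁ x)) , (λ x → proj₂ BA.∨-complement (proj₁ x))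
      ; ∧-complement = (λ x → proj₁ BA.∧-complement (proj₁ x)) , (λ x → proj₂ BA.∧-complement (proj₁ x))
      ; ¬-cong = BA.¬-cong
      }
    ; ⨾-assoc     = λ x y z → RA.⨾-assoc (proj₁ x) (proj₁ y) (proj₁ z)
    ; ⨾-∨         = λ x y z → RA.⨾-∨ (proj₁ x) (proj₁ y) (proj₁ z)
    ; ⨾-identityʳ = λ x → RA.⨾-identityʳ (proj₁ x)
    ; ˘-invol     = λ x → RA.˘-invol (proj₁ x)
    ; ˘-∨         = λ x y → RA.˘-∨ (proj₁ x) (proj₁ y)
    ; ˘-⨾         = λ x y → RA.˘-⨾ (proj₁ x) (proj₁ y)
    ; ˘-⨾-neg     = λ x y → RA.˘-⨾-neg (proj₁ x) (proj₁ y)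
    }
    where
    module RA = IsRelationAlgebra ra
    module BA = IsBooleanAlgebra RA.isBooleanAlgebra

module _ {a ℓ m : Level} {F : ℕ → Set} {A : Algebra F a ℓ} (B : Subuniverse A m) where
  private
    module A = Algebra A
    module S = Algebra (Subalgebra A B)
    open Subuniverse B

  module _ (em : ExcludedMiddle ℓ) (ba : IsBooleanAlgebra A._≈_ A._∨_ A._∧_ A.-_ A.𝟙 A.𝟘)
           (atomic : A.IsAtomic) (atoms⊆ : ∀ {x} → A.IsAtom x → member x) where
    private
      module BA = IsBooleanAlgebra ba

    sub-atomic : S.IsAtomic
    sub-atomic (x , _) nz with atomic x nz
    ... | y , (ynz , least) , y≤x = (y , atoms⊆ (ynz , least)) , (ynz , λ z → least (proj₁ z)) , y≤x

    -- An atom of a subalgebra that contains all atoms of A is an atom of A.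
    from-sub-atom : ∀ x → S.IsAtom x → A.IsAtom (proj₁ x)
    from-sub-atom (x , x∈) (nz , least) = nz , least′
      where
      least′ : ∀ y → y A.≤ x → y A.≈ A.𝟘 ⊎ y A.≈ x
      least′ y y≤x with em {y A.≈ A.𝟘}
      ... | yes e = inj₁ e
      ... | no ynz with atomic y ynz
      ...   | b , b-atom , b≤y with least (b , atoms⊆ b-atom)
                (A.trans (A.∧-cong (A.sym b≤y) A.refl)
                    (A.trans (BA.∧-assoc b y x) (A.trans (A.∧-cong A.refl y≤x) b≤y)))
      ...     | inj₁ e = contradiction e (proj₁ b-atom)
      ...     | inj₂ e = inj₂ (A.trans (A.sym y≤x) (A.trans (A.∧-cong A.refl (A.sym e))
                  (A.trans (BA.∧-comm y b) (A.trans b≤y e))))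

    At-sub : At (Subalgebra A B) ≅ᵃ At A
    At-sub = record
      { bijection = record
        { to = λ (x , p) → proj₁ x , from-sub-atom x p
        ; cong = id
        ; bijective = id , λ (x , p) → ((x , atoms⊆ p) , proj₁ p , λ z → proj₂ p (proj₁ z)) , id
        }
      ; R-iff = λ Ω x xs → let e = trans (sym (map-∘ proj₁ proj₁ xs)) (map-∘ proj₁ (λ (x , p) → proj₁ x , from-sub-atom x p) xs) in
          mk⇔ (subst (λ v → proj₁ (proj₁ x) A.≤ A.op Ω v) e)
              (subst (λ v → proj₁ (proj₁ x) A.≤ A.op Ω v) (sym e))
      }

-- The relation algebra is weakly but not strongly representable

module RelationAlgebras (em : ∀ ℓ → ExcludedMiddle ℓ) {N₀ C₀ : ℕ} (2<C : 2 < suc C₀) (3≤N : 3 ≤ℕ suc N₀) where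
  private
    N = suc N₀
    C = suc C₀
  open Monk (em 0ℓ) {N} {C₀} 2<C
  open Model (em 0ℓ) {N} {C₀}

  -- A consistent triangle can be copied onto any label that matches one of its sides.
  extend-triangle : ∀ {I J K} → Fresh J → ∀ {a b c : Label {N} {C} I} {a′ : Label {N} {C} J} →
      Match K (a , a′) → Tri b c a →
                    ∃[ b′ ] ∃[ c′ ] (Match K (b , b′) × Match K (c , c′) × Tri b′ c′ a′)
  extend-triangle {I} {J} {K} freshJ {a} {b} {c} {a′} mt t =
    finish (extend ((a , a′) ∷ []) 3≤N ((λ { (here refl) → mt }) ,
        λ { (here refl) (here refl) → Compat-refl (a , a′) }) bc)
    where
    open Extension (em 0ℓ) {N₀} {C} {I} {J} freshJ
    bc : Fin 2 → Label I
    bc zero       = b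
    bc (suc zero) = c
    finish : (Σ (Fin 2 → Label J) λ e → ∃[ L ] (Linked K L × (∀ {p} → p ∈ ((a , a′) ∷ []) → p ∈ L) ×
                (∀ x → (bc x , e x) ∈ L))) →
             ∃[ b′ ] ∃[ c′ ] (Match K (b , b′) × Match K (c , c′) × Tri b′ c′ a′)
    finish (e , L , (mt′ , cp) , L⊆ , e∈) = e zero , e (suc zero) , mt′ (e∈ zero) , mt′ (e∈ (suc zero)) ,
      Tri-transfer (proj₁ (mt′ (e∈ zero))) (proj₁ (mt′ (e∈ (suc zero)))) (proj₁ mt)
        (cp (e∈ zero) (e∈ (suc zero))) (cp (e∈ zero) (L⊆ (here refl))) (cp (e∈ (suc zero)) (L⊆ (here refl))) t

  Match-sym : ∀ {I J : Set} {K} {a : Label {N} {C} I} {b : Label {N} {C} J} → Match K (a , b) → Match K (b , a)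
  Match-sym (e , f) = sym e , λ m p m<K → ⇔-sym (f m p m<K)

  Match-trans : ∀ {I J H : Set} {K} {a : Label {N} {C} I} {b : Label {N} {C} J} {c : Label {N} {C} H} →
                Match K (a , b) → Match K (b , c) → Match K (a , c)
  Match-trans (e , f) (e′ , f′) = trans e e′ , λ m p m<K → ⇔-trans (f m p m<K) (f′ m p m<K)

  Match-mono : ∀ {I J : Set} {K K′} {a : Label {N} {C} I} {b : Label {N} {C} J} → K ≤ℕ K′ → Match K′ (a , b) →
      Match K (a , b)
  Match-mono K≤K′ (e , f) = e , λ m p m<K → f m p (ℕₚ.<-≤-trans m<K K≤K′)

  approximate : ∀ K (l : Label {N} {C} ℕ) → ∃[ a ] Match K (a , l)
  approximate K l with extend-triangle {K = K} fresh-⊥ {a = idₗ} {b = l} {c = l} {a′ = idₗ}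
                         (refl , λ _ _ _ → neither (λ ()) (λ ())) (Tri-idʳ l)
  ... | a , _ , mt , _ = a , Match-sym mt

  -- Sets of labels that do not distinguish labels matching up to the first K
  -- cliques, and those for which this holds for some K.
  Closed : ℕ → (A → Bool) → Set
  Closed K x = ∀ a b → Match K (a , b) → x a ≡ true → x b ≡ true

  Tame : (A → Bool) → Set
  Tame x = ∃[ K ] Closed K x

  closed-mono : ∀ {K K′ x} → K ≤ℕ K′ → Closed K x → Closed K′ x
  closed-mono K≤K′ cl a b mt = cl a b (Match-mono K≤K′ mt)

  closed-∨ : ∀ {K} x y → Closed K x → Closed K y → Closed K (x ∨ y)
  closed-∨ x y clx cly a b mt p = from (∨-true {x b}) (⊎-map (clx a b mt) (cly a b mt) (to (∨-true {x a}) p))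

  closed-∧ : ∀ {K} x y → Closed K x → Closed K y → Closed K (x ∧ y)
  closed-∧ x y clx cly a b mt p = let xa , ya = to (∧-true {x a}) p in from (∧-true {x b}) (clx a b mt xa , cly a b mt ya)

  closed-∁ : ∀ {K} x → Closed K x → Closed K (- x)
  closed-∁ x clx a b mt p = from not-true (λ xb → to not-true p (clx b a (Match-sym mt) xb))

  closed-⨾ : ∀ {K} x y → Closed K x → Closed K y → Closed K (x ⨾ y)
  closed-⨾ x y clx cly a a′ mt p =
    let b , c , xb , yc , t = to comp⇔ p
        b′ , c′ , mb , mc , t′ = extend-triangle fresh-⊥ mt t
    in from comp⇔ (b′ , c′ , clx b b′ mb xb , cly c c′ mc yc , t′)

  closed-1′ : Closed 0 1′
  closed-1′ a b mt p = from ident⇔ (Match-id {K = 0} mt (to ident⇔ p))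

  joint : ∀ x y → Tame x → Tame y → ∃[ K ] (Closed K x × Closed K y)
  joint x y (K , clx) (K′ , cly) = K ⊔ K′ , closed-mono {x = x} (ℕₚ.m≤m⊔n K K′) clx ,
      closed-mono {x = y} (ℕₚ.m≤n⊔m K K′) cly

  tame-subuniverse : Subuniverse monk (lsuc 0ℓ)
  tame-subuniverse = record
    { member    = λ x → Lift _ (Tame x)
    ; resp      = λ x≈y (lift (K , cl)) →
          lift (K , λ a b mt ya → trans (sym (x≈y b)) (cl a b mt (trans (x≈y a) ya)))
    ; ∨-closed  = λ {x} {y} (lift p) (lift q) → let K , clx , cly = joint x y p q in lift (K , closed-∨ x y clx cly)
    ; ∧-closed  = λ {x} {y} (lift p) (lift q) → let K , clx , cly = joint x y p q in lift (K , closed-∧ x y clx cly)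
    ; -‿closed  = λ {x} (lift (K , cl)) → lift (K , closed-∁ x cl)
    ; 𝟙-closed  = lift (0 , λ _ _ _ _ → refl)
    ; 𝟘-closed  = lift (0 , λ _ _ _ ())
    ; op-closed = λ { ident All.[] → lift (0 , closed-1′)
                    ; conv (lift (K , cl) All.∷ All.[]) → lift (K , cl)
                    ; comp {x ∷ y ∷ []} (lift p All.∷ lift q All.∷ All.[]) → let K , clx , cly = joint x y p q in lift (K , closed-⨾ x y clx cly) }
    }

  atom-tame : ∀ {x} → IsAtom x → Tame x
  atom-tame {x} p with near-bound {d = 1} (λ _ → label (x , p))
  ... | K , near = K , λ a b mt xa → from (label⇔ (x , p))
        (trans (Match-fixed {K = K} a b (λ m q c e → near zero m q c (trans (sym (to (label⇔ (x , p)) xa)) e))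
            mt) (to (label⇔ (x , p)) xa))

  full-subuniverse : Subuniverse monk (lsuc 0ℓ)
  full-subuniverse = record
    { member = λ _ → Unitₚ.⊤ ; resp = λ _ _ → Unitₚ.tt ; ∨-closed = λ _ _ → Unitₚ.tt ; ∧-closed =
          λ _ _ → Unitₚ.tt
    ; -‿closed = λ _ → Unitₚ.tt ; 𝟙-closed = Unitₚ.tt ; 𝟘-closed = Unitₚ.tt ; op-closed = λ _ _ → Unitₚ.tt }

  -- The tame elements form a representable algebra with the same atoms; all elements
  -- form one that is not representable.
  𝔗 𝔉 : Algebra RAOp (lsuc 0ℓ) 0ℓ
  𝔗 = Subalgebra monk tame-subuniverse
  𝔉 = Subalgebra monk full-subuniverse

  𝔗-atomicWith : AtomicWith IsRelationAlgebra (At monk) 𝔗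
  𝔗-atomicWith = sub-isRelationAlgebra tame-subuniverse isRelationAlgebra ,
    sub-atomic tame-subuniverse (em 0ℓ) isBooleanAlgebra isAtomic (lift ∘ atom-tame) ,
    At-sub tame-subuniverse (em 0ℓ) isBooleanAlgebra isAtomic (lift ∘ atom-tame)

  𝔉-atomicWith : AtomicWith IsRelationAlgebra (At monk) 𝔉
  𝔉-atomicWith = sub-isRelationAlgebra full-subuniverse isRelationAlgebra ,
    sub-atomic full-subuniverse (em 0ℓ) isBooleanAlgebra isAtomic (λ _ → Unitₚ.tt) ,
    At-sub full-subuniverse (em 0ℓ) isBooleanAlgebra isAtomic (λ _ → Unitₚ.tt)

  infix 4 _⊩_
  -- The pair of points belongs to the image of x.
  record _⊩_ (uv : Point × Point) (x : A → Bool) : Set where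
    constructor forces
    field
      support   : ℕ
      supported : Closed support x
      witness   : A
      inside    : x witness ≡ true
      similar   : Match support (witness , lab (proj₁ (proj₁ uv)) (proj₁ (proj₂ uv)))

  labᵖ : Point × Point → Label {N} {C} ℕ
  labᵖ (u , v) = lab (proj₁ u) (proj₁ v)

  ⊩⇔ : ∀ {K x a uv} → Closed K x → Match K (a , labᵖ uv) → uv ⊩ x ⇔ x a ≡ true
  ⊩⇔ {K} {x} {a} {uv} cl a~ = mk⇔ forced (λ xa → forces K cl a xa a~)
    where
    forced : uv ⊩ x → x a ≡ true
    forced (forces K′ cl′ b xb b~) with approximate (K ⊔ K′) (labᵖ uv)
    ... | c , c~ = cl c a (Match-trans (Match-mono (ℕₚ.m≤m⊔n K K′) c~) (Match-sym a~))
                     (cl′ b c (Match-trans b~ (Match-sym (Match-mono (ℕₚ.m≤n⊔m K K′) c~))) xb)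

  ⊩-resp : ∀ {x u u′ v v′} → proj₁ u ≡ proj₁ u′ → proj₁ v ≡ proj₁ v′ → (u , v) ⊩ x → (u′ , v′) ⊩ x
  ⊩-resp {u = u} {v = v} e e′ (forces K cl a xa a~) =
      forces K cl a xa (subst (λ l → Match K (a , l)) (cong₂ lab e e′) a~)

  ⊩-∨ : ∀ x y {uv} → Tame x → Tame y → uv ⊩ (x ∨ y) ⇔ (uv ⊩ x ⊎ uv ⊩ y)
  ⊩-∨ x y {uv} p q = 
    let K , clx , cly = joint x y p q
        a , a~ = approximate K (labᵖ uv)
        fx = ⊩⇔ {K} {x} {a} {uv} clx a~
        fy = ⊩⇔ {K} {y} {a} {uv} cly a~
    in ⇔-trans (⊩⇔ {K} {x ∨ y} {a} {uv} (closed-∨ x y clx cly) a~) (⇔-trans (∨-true {x a})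
         (mk⇔ (⊎-map (from fx) (from fy)) (⊎-map (to fx) (to fy))))

  ⊩-∧ : ∀ x y {uv} → Tame x → Tame y → uv ⊩ (x ∧ y) ⇔ (uv ⊩ x × uv ⊩ y)
  ⊩-∧ x y {uv} p q =
    let K , clx , cly = joint x y p q
        a , a~ = approximate K (labᵖ uv)
        fx = ⊩⇔ {K} {x} {a} {uv} clx a~
        fy = ⊩⇔ {K} {y} {a} {uv} cly a~
    in ⇔-trans (⊩⇔ {K} {x ∧ y} {a} {uv} (closed-∧ x y clx cly) a~) (⇔-trans (∧-true {x a})
         (mk⇔ (λ (s , t) → from fx s , from fy t) (λ (s , t) → to fx s , to fy t)))

  ⊩-∁ : ∀ x {uv} → Tame x → uv ⊩ (- x) ⇔ (¬ uv ⊩ x)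
  ⊩-∁ x {uv} (K , cl) =
    let a , a~ = approximate K (labᵖ uv)
        fx = ⊩⇔ {K} {x} {a} {uv} cl a~
    in ⇔-trans (⊩⇔ {K} {(- x)} {a} {uv} (closed-∁ x cl) a~)
        (⇔-trans not-true (mk⇔ (λ ne p → ne (to fx p)) (λ ne p → ne (from fx p))))

  ⊩-1′ : ∀ {uv} → uv ⊩ 1′ ⇔ proj₁ (proj₁ uv) ≡ proj₁ (proj₂ uv)
  ⊩-1′ {uv@(u , v)} =
    let a , a~ = approximate 0 (labᵖ uv)
    in ⇔-trans (⊩⇔ {0} {1′} {a} {uv} closed-1′ a~)
        (⇔-trans ident⇔ (mk⇔ (λ e → lab-id u v (Match-id {K = 0} a~ e))
         (λ e → Match-id {K = 0} (Match-sym a~) (trans (cong (λ w → lab w (proj₁ v)) e) (lab-refl (proj₁ v))))))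

  ⊩-⨾ : ∀ x y {uv} → Tame x → Tame y →
        uv ⊩ (x ⨾ y) ⇔ (Σ Point λ w → (proj₁ uv , w) ⊩ x × (w , proj₂ uv) ⊩ y)
  ⊩-⨾ x y {uv@(u , v)} p q =
    let K , clx , cly = joint x y p q
        a , a~ = approximate K (labᵖ uv)
    in ⇔-trans (⊩⇔ {K} {x ⨾ y} {a} {uv} (closed-⨾ x y clx cly) a~)
        (⇔-trans comp⇔ (mk⇔ (ascend clx cly a~) (descend clx cly a~)))
    where
    ascend : ∀ {K a} → Closed K x → Closed K y → Match K (a , labᵖ uv) → Composes x y a →
             Σ Point λ w → (u , w) ⊩ x × (w , v) ⊩ y
    ascend {K} clx cly a~ (b , c , xb , yc , t) with extend-triangle fresh-ℕ a~ t
    ... | b′ , c′ , mb , mc , t′ = w ,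
          forces K clx b xb (subst (λ l → Match K (b , l)) (sym (proj₂ point zero)) mb) ,
            forces K cly c yc (subst (λ l → Match K (c , l))
                (trans (sym (proj₂ point (suc zero))) (lab-sym (proj₁ v) (proj₁ w))) mc)
      where
      s : Fin 2 → Point
      s zero       = u
      s (suc zero) = v
      l : Fin 2 → Label {N} {C} ℕ
      l zero       = b′
      l (suc zero) = c′
      rotated : Tri (labᵖ uv) b′ c′
      rotated = Tri-swap₁₂ b′ (labᵖ uv) c′ (Tri-swap₂₃ b′ c′ (labᵖ uv) t′)
      tri : ∀ i j → Tri (lab (proj₁ (s i)) (proj₁ (s j))) (l i) (l j)
      tri zero       zero       = Tri-≡ (sym (lab-refl (proj₁ u))) refl refl (Tri-idˡ b′)
      tri zero       (suc zero) = rotated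
      tri (suc zero) zero       =
          Tri-≡ (lab-sym (proj₁ u) (proj₁ v)) refl refl (Tri-swap₂₃ (labᵖ uv) b′ c′ rotated)
      tri (suc zero) (suc zero) = Tri-≡ (sym (lab-refl (proj₁ v))) refl refl (Tri-idˡ c′)
      point : Σ Point λ w → ∀ i → lab (proj₁ (s i)) (proj₁ w) ≡ l i
      point = realise 2<C s l tri
      w : Point
      w = proj₁ point
    descend : ∀ {K a} → Closed K x → Closed K y → Match K (a , labᵖ uv) →
              (Σ Point λ w → (u , w) ⊩ x × (w , v) ⊩ y) → Composes x y a
    descend {K} {a} clx cly a~ (w , xw , wy) =
      let b , c , mb , mc , t = extend-triangle fresh-⊥ {b = labᵖ (u , w)} {labᵖ (w , v)} (Match-sym a~)
            (Tri-≡ refl (lab-sym (proj₁ v) (proj₁ w)) refl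
              (Tri-swap₂₃ (labᵖ (u , w)) (labᵖ uv) (lab (proj₁ v) (proj₁ w))
                  (Tri-swap₁₂ (labᵖ uv) (labᵖ (u , w)) (lab (proj₁ v) (proj₁ w)) (Tri-lab u v w))))
      in b , c , to (⊩⇔ {K} {x} {b} {u , w} clx (Match-sym mb)) xw ,
          to (⊩⇔ {K} {y} {c} {w , v} cly (Match-sym mc)) wy , t

  ⊩-˘ : ∀ {x u v} → (u , v) ⊩ x → (v , u) ⊩ x
  ⊩-˘ {x} {u} {v} (forces K cl a xa a~) =
      forces K cl a xa (subst (λ l → Match K (a , l)) (lab-sym (proj₁ u) (proj₁ v)) a~)

  realised : ∀ a → Σ (Point × Point) λ uv → labᵖ uv ≡ ι a
  realised a = (u , proj₁ v) , proj₂ v zero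
    where
    u : Point
    u = proj₁ (realise {0} (s≤s z≤n) (λ ()) (λ ()) (λ ()))
    v : Σ Point λ v → ∀ (x : Fin 1) → lab (proj₁ u) (proj₁ v) ≡ ι a
    v = realise {1} (ℕₚ.<-trans (s≤s (s≤s z≤n)) 2<C) (λ _ → u) (λ _ → ι a)
          (λ _ _ → Tri-≡ (sym (lab-refl (proj₁ u))) refl refl (Tri-idˡ (ι a)))

  module 𝔗 = Algebra 𝔗
  module ℜ = Algebra (relationSetAlgebra points)

  𝔗-homomorphism : Homomorphism 𝔗 (relationSetAlgebra points)
  𝔗-homomorphism = record
    { h       = rel
    ; cong-h  = λ {x} {y} e → transport (proj₁ x) (proj₁ y) e , transport (proj₁ y) (proj₁ x) (λ a → sym (e a))
    ; ∨-homo  = λ (x , lift p) (y , lift q) → to (⊩-∨ x y p q) , from (⊩-∨ x y p q)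
    ; ∧-homo  = λ (x , lift p) (y , lift q) → to (⊩-∧ x y p q) , from (⊩-∧ x y p q)
    ; -‿homo  = λ (x , lift p) → to (⊩-∁ x p) , from (⊩-∁ x p)
    ; 𝟙-homo  = (λ _ → Unitₚ.tt) , λ {uv} _ → let a , a~ = approximate 0 (labᵖ uv) in forces 0 (λ _ _ _ _ → refl) a refl a~
    ; 𝟘-homo  = (λ { (forces _ _ _ () _) }) , λ ()
    ; op-homo = rel-op
    }
    where
    rel : 𝔗.Carrier → ℜ.Carrier
    rel (x , _) = (λ uv → uv ⊩ x) , λ (e , e′) → ⊩-resp e e′
    transport : ∀ x y → x ≈ y → ∀ {uv} → uv ⊩ x → uv ⊩ y
    transport x y e (forces K cl a xa a~) =
        forces K (λ b c mt yb → trans (sym (e c)) (cl b c mt (trans (e b) yb))) a (trans (sym (e a)) xa) a~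
    rel-op : ∀ {k} (Ω : RAOp k) (xs : Vec 𝔗.Carrier k) → rel (𝔗.op Ω xs) ℜ.≈ ℜ.op Ω (map rel xs)
    rel-op ident []                              = to ⊩-1′ , from ⊩-1′
    rel-op conv  (x ∷ [])                        = ⊩-˘ , ⊩-˘
    rel-op comp  ((x , lift p) ∷ (y , lift q) ∷ []) = to (⊩-⨾ x y p q) , from (⊩-⨾ x y p q)

  𝔗-representable : RepresentableRA 0ℓ 𝔗
  𝔗-representable = embedding-representable relationSetAlgebra points 𝔗-homomorphism λ {x} {y} (p , q) →
    ≈-intro {proj₁ x} {proj₁ y} λ a → mk⇔ (reflects x y p a) (reflects y x q a)
    where
    reflects : ∀ (x y : 𝔗.Carrier) → (∀ {uv} → uv ⊩ proj₁ x → uv ⊩ proj₁ y) → ∀ a → proj₁ x a ≡ true →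
        proj₁ y a ≡ true
    reflects (x , lift (K , clx)) (y , lift (L , cly)) x⊆y a xa =
      let uv , e = realised a
          near : ∀ {K} → Match K (a , labᵖ uv)
          near = λ {K} → subst (λ l → Match K (a , l)) (sym e)
              (Match-sym {K = K} (proj₁ (Similar-ι {I = ℕ} {X = A} {K} id) a))
      in to (⊩⇔ {L} {y} {a} {uv} cly near) (x⊆y (forces K clx a xa near))

  module 𝔉 = Algebra 𝔉

  module _ {ℓ : Level} {V : Setoid ℓ ℓ} (φ : Homomorphism 𝔉 (relationSetAlgebra V)) where
    open Homomorphism φ
    open Setoid V using () renaming (Carrier to Base; _≈_ to _≈ᵥ_; refl to ≈ᵥ-refl)

    -- The relation that interprets a set of labels.
    ⟦_⟧ : (A → Bool) → Base → Base → Set ℓ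
    ⟦ x ⟧ u v = proj₁ (h (x , Unitₚ.tt)) (u , v)

    ⟦⟧-mono : ∀ x y {u v} → (∀ a → x a ≡ true → y a ≡ true) → ⟦ x ⟧ u v → ⟦ y ⟧ u v
    ⟦⟧-mono x y x≤y p = proj₂ (proj₁ (∧-homo (x , Unitₚ.tt) (y , Unitₚ.tt))
      (proj₁ (cong-h {x , Unitₚ.tt} {x ∧ y , Unitₚ.tt} (λ a → sym (from (≤⇔ {x} {y}) x≤y a))) p))

    ⟦⟧-∧ : ∀ x y {u v} → ⟦ x ⟧ u v → ⟦ y ⟧ u v → ⟦ x ∧ y ⟧ u v
    ⟦⟧-∧ x y p q = proj₂ (∧-homo (x , Unitₚ.tt) (y , Unitₚ.tt)) (p , q)

    ⟦⟧-resp : ∀ x {u u′ v v′} → u ≈ᵥ u′ → v ≈ᵥ v′ → ⟦ x ⟧ u v → ⟦ x ⟧ u′ v′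
    ⟦⟧-resp x e e′ = proj₂ (h (x , Unitₚ.tt)) (e , e′)

    ⟦⟧-𝟘 : ∀ {u v} → ¬ ⟦ 𝟘 ⟧ u v
    ⟦⟧-𝟘 {u} {v} p with proj₁ 𝟘-homo {u , v} p
    ... | ()

    ⟦⟧-1′ : ∀ {u v} → ⟦ 1′ ⟧ u v ⇔ u ≈ᵥ v
    ⟦⟧-1′ = mk⇔ (proj₁ (op-homo ident [])) (proj₂ (op-homo ident []))

    ⟦⟧-⨾ : ∀ x y {u v} → ⟦ x ⨾ y ⟧ u v ⇔ (∃[ w ] (⟦ x ⟧ u w × ⟦ y ⟧ w v))
    ⟦⟧-⨾ x y = mk⇔ (proj₁ (op-homo comp ((x , Unitₚ.tt) ∷ (y , Unitₚ.tt) ∷ [])))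
        (proj₂ (op-homo comp ((x , Unitₚ.tt) ∷ (y , Unitₚ.tt) ∷ [])))

    -- The points v k reached from o by different labels are different, and the classes
    -- of the edges between them contradict Ramsey's theorem.
    relational-collapse : Base → ⊥
    relational-collapse o = absurd (Ramsey.monochromatic-triangle (em ℓ) E E-total)
      where
      spokeLabel : ℕ → A
      spokeLabel k = at (fin k zero) zero
      spoke : ∀ k → ∃[ v ] (⟦ ⟨ spokeLabel k ⟩ ⟧ o v × ⟦ ⟨ spokeLabel k ⟩ ⟧ v o)
      spoke k = to (⟦⟧-⨾ ⟨ spokeLabel k ⟩ ⟨ spokeLabel k ⟩) (⟦⟧-mono 1′ (⟨ spokeLabel k ⟩ ⨾ ⟨ spokeLabel k ⟩)
        (λ b e → from comp⇔ (spokeLabel k , spokeLabel k , from ⟨⟩⇔ refl , from ⟨⟩⇔ refl ,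
            subst (Tri (spokeLabel k) (spokeLabel k)) (sym (to ident⇔ e)) (Tri-idʳ (spokeLabel k))))
        (from ⟦⟧-1′ ≈ᵥ-refl))
      v : ℕ → Base
      v k = proj₁ (spoke k)
      distinct : ∀ k l → k < l → ¬ ⟦ 1′ ⟧ (v k) (v l)
      distinct k l k<l p = ⟦⟧-𝟘
          (⟦⟧-mono (⟨ spokeLabel k ⟩ ∧ ⟨ spokeLabel l ⟩) 𝟘 clash (⟦⟧-∧ ⟨ spokeLabel k ⟩ ⟨ spokeLabel l ⟩
        (⟦⟧-resp ⟨ spokeLabel k ⟩ ≈ᵥ-refl (to ⟦⟧-1′ p) (proj₁ (proj₂ (spoke k)))) (proj₁ (proj₂ (spoke l)))))
        where
        clash : ∀ b → (⟨ spokeLabel k ⟩ ∧ ⟨ spokeLabel l ⟩) b ≡ true → 𝟘 b ≡ true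
        clash b e with to (∧-true {⟨ spokeLabel k ⟩ b}) e
        ... | e₁ , e₂ with trans (sym (to ⟨⟩⇔ e₁)) (to ⟨⟩⇔ e₂)
        ...   | refl = contradiction k<l (ℕₚ.<-irrefl refl)
      classes : Fin (N * C) → A → Bool
      classes j a = ⌊ Class j a ⌋
      classes′ : Fin (N * C) → 𝔉.Carrier
      classes′ j = classes j , Unitₚ.tt
      E : ℕ → ℕ → Fin (N * C) → Set ℓ
      E k l j = ⟦ classes j ⟧ (v k) (v l)
      E-total : ∀ k l → k < l → ∃[ j ] E k l j
      E-total k l k<l = ⋁-prime 𝔉 (λ x → proj₁ (h x) (v k , v l)) (λ x y → proj₁ (∨-homo x y)) ⟦⟧-𝟘 classes′
        (⟦⟧-mono (- 1′) (proj₁ (⋁ 𝔉 classes′)) covered (proj₂ (-‿homo (1′ , Unitₚ.tt)) (distinct k l k<l)))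
        where
        ∈-⋁ : ∀ {d} (X : Fin d → 𝔉.Carrier) j {a} → proj₁ (X j) a ≡ true → proj₁ (⋁ 𝔉 X) a ≡ true
        ∈-⋁ X zero    {a} p = from (∨-true {proj₁ (X zero) a}) (inj₁ p)
        ∈-⋁ X (suc j) {a} p = from (∨-true {proj₁ (X zero) a}) (inj₂ (∈-⋁ (X ∘ suc) j p))
        covered : ∀ a → (- 1′) a ≡ true → proj₁ (⋁ 𝔉 classes′) a ≡ true
        covered a ne with class a (λ e → to not-true ne (from ident⇔ e))
        ... | j , c = ∈-⋁ classes′ j (from ⌊⌋-true c)
      absurd : (∃[ k ] ∃[ l ] ∃[ m ] ∃[ j ] (k < l × l < m × E k l j × E k m j × E l m j)) → ⊥
      absurd (k , l , m , j , _ , _ , kl , km , lm) =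
          ⟦⟧-𝟘 (⟦⟧-mono ((classes j ⨾ classes j) ∧ classes j) 𝟘 empty
        (⟦⟧-∧ (classes j ⨾ classes j) (classes j) (from (⟦⟧-⨾ (classes j) (classes j)) (v l , kl , lm)) km))
        where
        empty : ∀ a → ((classes j ⨾ classes j) ∧ classes j) a ≡ true → 𝟘 a ≡ true
        empty a e with to (∧-true {(classes j ⨾ classes j) a}) e
        ... | e₁ , e₂ with to comp⇔ e₁
        ...   | b , c , xb , xc , t =
            contradiction t (no-class-triangle j (to ⌊⌋-true xb) (to ⌊⌋-true xc) (to ⌊⌋-true e₂))

  𝔉-nonrepresentable : ∀ {ℓ} → ¬ RepresentableRA ℓ 𝔉
  𝔉-nonrepresentable {ℓ} rep =
    let V , φ , ne = nontrivial-factor em {full = relationSetAlgebra} rep (λ e → contradiction (e idₗ) λ ())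
    in relational-collapse φ (proj₁ (inhabitant (em ℓ) ne))

-- The choice of the numbers of positions and colours

module Main (em : ∀ ℓ → ExcludedMiddle ℓ) (n : ℕ) (2<n : 2 < n) where
  private
    -- The cliques have suc N₀ vertices and there are suc n colours.
    N₀ = n * n + n
    fits : n * n + n ≤ℕ suc N₀
    fits = ℕₚ.n≤1+n N₀
    n<C : n < suc n
    n<C = ℕₚ.n<1+n n
    3≤N : 3 ≤ℕ suc N₀
    3≤N = ℕₚ.≤-trans 2<n (ℕₚ.≤-trans (ℕₚ.m≤n+m n (n * n)) fits)

  open Matrices (em 0ℓ) {N₀} {n} {n} fits n<C 2<n public
  open TermAlgebra (em 0ℓ) {N₀} {n} {n} fits n<C 2<n public using (Tm-representable)
  open CmNonrepresentable em {N₀} {n} {n} fits n<C 2<n public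
  module RA = RelationAlgebras em {N₀} {n} 2<C 3≤N

theorem3p3 : (∀ ℓ → ExcludedMiddle ℓ) →
    ∀ ℓ (n : ℕ) (2<n : 2 < n) →
    (∃[ 𝐀𝐭 ]
    IsAtomStructureOf {F = CylOp PEA n} {ℓ = 0ℓ} IsPEA 𝐀𝐭
    × Representable 0ℓ (Tm 𝐀𝐭)
    × ¬ StronglyRepresentable IsPEA (Representable ℓ) 𝐀𝐭
    × (∀ (t : Signature) → ¬ Representable ℓ (reduct (toPEA {t}) (Cm 𝐀𝐭))))
    ×
    (∃[ 𝔑 ]
    IsRelationAlgebra {a = 0ℓ} {ℓ = 0ℓ} 𝔑
    × Algebra.IsAtomic 𝔑
    × IsPolyadicEqualityBasis n 𝔑 (<⇒≤ 2<n) U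
    × Representable 0ℓ (Tm (Mat n 𝔑))
    × ¬ Representable ℓ (reduct (toPEA {Df}) (Cm (Mat n 𝔑)))
    × WeaklyRepresentable IsRelationAlgebra (RepresentableRA 0ℓ) (At 𝔑)
    × ¬ StronglyRepresentable IsRelationAlgebra (RepresentableRA ℓ) (At 𝔑))
theorem3p3 em ℓ n 2<n =
  ( 𝐀𝐭
  , (Cm 𝐀𝐭 , Cm-atomicWith)
  , Tm-representable
  , (λ strong → Cm-nonrepresentable (strong (Cm 𝐀𝐭) Cm-atomicWith))
  , (λ t → reduct-nonrepresentable {ℓ} {t})
  ) ,
  ( 𝔑.monk
  , 𝔑.isRelationAlgebra
  , 𝔑.isAtomic
  , isPolyadicEqualityBasis
  , Tm-representable
  , reduct-nonrepresentable {ℓ} {Df}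
  , (RA.𝔗 , RA.𝔗-atomicWith , RA.𝔗-representable)
  , (λ strong → RA.𝔉-nonrepresentable (strong RA.𝔉 RA.𝔉-atomicWith))
  )
  where
  open Main em n 2<n
  Cm-atomicWith : AtomicWith IsPEA 𝐀𝐭 (Cm 𝐀𝐭)
  Cm-atomicWith = Cm-isPEA , Cm-isAtomic , At-Cm
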